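{- A digraph admits an odd dijoin if and only if it has neither an odd diamond nor an odd one-direction as a cut minor.
   Context: Digraphs may have loops and parallel/antiparallel edges. A bond of a digraph $D$ is an inclusion-minimal nonempty cut $D[X,Y]$ (edges between the parts of a vertex partition $(X,Y)$); it is directed if no edge has tail in $Y$ and head in $X$. An odd dijoin is a set $J\subseteq E(D)$ with $|J\cap S|$ odd for every directed bond $S$. Contracting an edge set $A$ means deleting the edges of $A$ and identifying each weak component of $D[A]$ to a single vertex (contracting a loop deletes it). A non-loop edge $e=(x,y)$ is deletable if there is a directed $x$–$y$ path in $D$ not using $e$. A cut minor of $D$ is a digraph obtained by a finite sequence of edge contractions, deletions of deletable edges and deletions of isolated vertices. A diamond is a digraph with two vertices $h_1,h_2$ and vertices $x_1,\dots,x_n$, $n\ge 3$, where each $x_i$ has either exactly two outgoing edges, one to each of $h_1,h_2$, or exactly two incoming edges, one from each of $h_1,h_2$, and there are no other edges. A one-direction is a digraph isomorphic to $\vec{K}_{n_1,n_2}$ (complete bipartite graph with all edges oriented from the part of size $n_1$ to the part of size $n_2$) for some $n_1,n_2\ge 2$. A diamond or one-direction is odd if its number of vertices is odd. -}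

module Defs where

open import Data.Nat using (ℕ; _≤_; _%_)
open import Data.Fin using (Fin)
open import Data.Fin.Subset using (Subset; _∈_; _∉_; _∩_; ∣_∣; Nonempty; ∁)
open import Data.Vec using (tabulate; lookup)
open import Data.Bool using (_xor_)
open import Data.Product using (Σ; ∃; _×_)
open import Data.Sum using (_⊎_)
open import Relation.Binary.PropositionalEquality using (_≡_; _≢_)
open import Relation.Nullary using (¬_)

-- A finite digraph with vertices Fin V and edges Fin E; loops and
-- parallel / antiparallel edges are allowed.
record Digraph : Set where
  field
    V    : ℕ
    E    : ℕ
    tail : Fin E → Fin V
    head : Fin E → Fin V

open Digraph public

Odd : ℕ → Set
Odd n = n % 2 ≡ 1

cut : (D : Digraph) → Subset (V D) → Subset (E D)
cut D X = tabulate λ e → lookup X (tail D e) xor lookup X (head D e)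

IsCut : (D : Digraph) → Subset (E D) → Set
IsCut D S = ∃ λ (X : Subset (V D)) → S ≡ cut D X

IsBond : (D : Digraph) → Subset (E D) → Set
IsBond D S =
  IsCut D S × Nonempty S ×
  (∀ (S' : Subset (E D)) → IsCut D S' → Nonempty S' →
     (∀ {e} → e ∈ S' → e ∈ S) → S' ≡ S)

IsDirectedBond : (D : Digraph) → Subset (E D) → Set
IsDirectedBond D S =
  IsBond D S ×
  (∃ λ (X : Subset (V D)) → S ≡ cut D X ×
     (∀ (e : Fin (E D)) → ¬ (tail D e ∉ X × head D e ∈ X)))

IsOddDijoin : (D : Digraph) → Subset (E D) → Set
IsOddDijoin D J = ∀ (S : Subset (E D)) → IsDirectedBond D S → Odd ∣ J ∩ S ∣

HasOddDijoin : Digraph → Set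
HasOddDijoin D = ∃ λ (J : Subset (E D)) → IsOddDijoin D J

data WalkAvoiding (D : Digraph) (e : Fin (E D)) : Fin (V D) → Fin (V D) → Set where
  here  : ∀ {u} → WalkAvoiding D e u u
  there : ∀ {v} (f : Fin (E D)) → f ≢ e →
          WalkAvoiding D e (head D f) v → WalkAvoiding D e (tail D f) v

Deletable : (D : Digraph) → Fin (E D) → Set
Deletable D e = tail D e ≢ head D e × WalkAvoiding D e (tail D e) (head D e)

-- D' is (isomorphic to) D with edge e contracted: e is deleted and its
-- ends are identified (if e is a loop, it is just deleted).
record Contraction (D D' : Digraph) : Set where
  field
    e      : Fin (E D)
    φ      : Fin (V D) → Fin (V D')
    φ-surj : ∀ w → ∃ λ u → φ u ≡ w
    φ-merge : φ (tail D e) ≡ φ (head D e)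
    φ-only : ∀ u v → φ u ≡ φ v →
             u ≡ v ⊎ (u ≡ tail D e × v ≡ head D e) ⊎ (u ≡ head D e × v ≡ tail D e)
    ψ      : Fin (E D') → Fin (E D)
    ψ-inj  : ∀ f g → ψ f ≡ ψ g → f ≡ g
    ψ-avoid : ∀ f → ψ f ≢ e
    ψ-onto : ∀ g → g ≢ e → ∃ λ f → ψ f ≡ g
    tail-ok : ∀ f → tail D' f ≡ φ (tail D (ψ f))
    head-ok : ∀ f → head D' f ≡ φ (head D (ψ f))

record Deletion (D D' : Digraph) : Set where
  field
    e      : Fin (E D)
    e-del  : Deletable D e
    φ      : Fin (V D) → Fin (V D')
    φ-surj : ∀ w → ∃ λ u → φ u ≡ w
    φ-inj  : ∀ u v → φ u ≡ φ v → u ≡ v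
    ψ      : Fin (E D') → Fin (E D)
    ψ-inj  : ∀ f g → ψ f ≡ ψ g → f ≡ g
    ψ-avoid : ∀ f → ψ f ≢ e
    ψ-onto : ∀ g → g ≢ e → ∃ λ f → ψ f ≡ g
    tail-ok : ∀ f → tail D' f ≡ φ (tail D (ψ f))
    head-ok : ∀ f → head D' f ≡ φ (head D (ψ f))

record IsolatedDeletion (D D' : Digraph) : Set where
  field
    v      : Fin (V D)
    v-iso  : ∀ f → tail D f ≢ v × head D f ≢ v
    φ      : Fin (V D') → Fin (V D)
    φ-inj  : ∀ u w → φ u ≡ φ w → u ≡ w
    φ-avoid : ∀ u → φ u ≢ v
    φ-onto : ∀ w → w ≢ v → ∃ λ u → φ u ≡ w
    ψ      : Fin (E D') → Fin (E D)
    ψ-inj  : ∀ f g → ψ f ≡ ψ g → f ≡ g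
    ψ-surj : ∀ g → ∃ λ f → ψ f ≡ g
    tail-ok : ∀ f → tail D (ψ f) ≡ φ (tail D' f)
    head-ok : ∀ f → head D (ψ f) ≡ φ (head D' f)

data CutMinor (D : Digraph) : Digraph → Set where
  done     : CutMinor D D
  contract : ∀ {D₁ D₂} → Contraction D D₁ → CutMinor D₁ D₂ → CutMinor D D₂
  delete   : ∀ {D₁ D₂} → Deletion D D₁ → CutMinor D₁ D₂ → CutMinor D D₂
  deleteIsolated : ∀ {D₁ D₂} → IsolatedDeletion D D₁ → CutMinor D₁ D₂ → CutMinor D D₂

OutVertex : (D : Digraph) → Fin (V D) → Fin (V D) → Fin (V D) → Set
OutVertex D h₁ h₂ x =
  ∃ λ (e₁ : Fin (E D)) → ∃ λ (e₂ : Fin (E D)) →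
    tail D e₁ ≡ x × head D e₁ ≡ h₁ × tail D e₂ ≡ x × head D e₂ ≡ h₂ ×
    (∀ f → tail D f ≡ x ⊎ head D f ≡ x → f ≡ e₁ ⊎ f ≡ e₂)

InVertex : (D : Digraph) → Fin (V D) → Fin (V D) → Fin (V D) → Set
InVertex D h₁ h₂ x =
  ∃ λ (e₁ : Fin (E D)) → ∃ λ (e₂ : Fin (E D)) →
    tail D e₁ ≡ h₁ × head D e₁ ≡ x × tail D e₂ ≡ h₂ × head D e₂ ≡ x ×
    (∀ f → tail D f ≡ x ⊎ head D f ≡ x → f ≡ e₁ ⊎ f ≡ e₂)

IsDiamond : Digraph → Set
IsDiamond D =
  ∃ λ (h₁ : Fin (V D)) → ∃ λ (h₂ : Fin (V D)) →
    h₁ ≢ h₂ × 5 ≤ V D ×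
    (∀ x → x ≢ h₁ → x ≢ h₂ → OutVertex D h₁ h₂ x ⊎ InVertex D h₁ h₂ x) ×
    (∀ f → ¬ ((tail D f ≡ h₁ ⊎ tail D f ≡ h₂) × (head D f ≡ h₁ ⊎ head D f ≡ h₂)))

-- isomorphic to K⃗_{n₁,n₂} with n₁, n₂ ≥ 2 (A = part of size n₁, edges A → ∁A)
IsOneDirection : Digraph → Set
IsOneDirection D =
  ∃ λ (A : Subset (V D)) →
    2 ≤ ∣ A ∣ × 2 ≤ ∣ ∁ A ∣ ×
    (∀ f → tail D f ∈ A × head D f ∉ A) ×
    (∀ a b → a ∈ A → b ∉ A → ∃ λ f → tail D f ≡ a × head D f ≡ b) ×
    (∀ f g → tail D f ≡ tail D g → head D f ≡ head D g → f ≡ g)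

IsOddDiamond : Digraph → Set
IsOddDiamond D = IsDiamond D × Odd (V D)

IsOddOneDirection : Digraph → Set
IsOddOneDirection D = IsOneDirection D × Odd (V D)

HasOddDiamondCutMinor : Digraph → Set
HasOddDiamondCutMinor D = ∃ λ D' → CutMinor D D' × IsOddDiamond D'

HasOddOneDirectionCutMinor : Digraph → Set
HasOddOneDirectionCutMinor D = ∃ λ D' → CutMinor D D' × IsOddOneDirection D'

{-# OPTIONS --safe #-}

-- Odd dijoins survive taking cut minors. In an odd one-direction every single vertex is a directed
-- bond, so an odd dijoin J would meet the (empty) cut of the full vertex set in an odd number of
-- edges. In an odd diamond the same holds for the rim, whose cut is the sum of those of the two
-- closed sets formed by one hub and all sources, and so is met by J in an even number of edges.
--
-- Conversely, let D be a minimal digraph without an odd dijoin. For every edge e the contraction of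
-- e yields an edge set J_e that is odd on all directed bonds avoiding e. Gluing such sets shows that
-- D is 2-connected, so that every source and every sink is a directed bond. A directed cut X is a
-- disjoint union of directed bonds; let F X be the parity of their number. Whenever some edge e
-- avoids the cuts of W, W+u, W+v and W+u+v, the set J_e shows that F is modular on these four sets.
-- If this were always so, F would come from a vertex weighting, and a T-join for these weights would
-- be an odd dijoin. Hence, for some W, u, v, no edge lies inside W or outside W+u+v: every vertex
-- other than u and v is a source or a sink. Giving weight 1 to those vertices and any weights to u
-- and v that make the total even must fail on some directed bond, which forces D to be an odd
-- one-direction (if at most one of u, v is neither a source nor a sink) or an odd diamond with hubs
-- u and v (if both are).

module Submission where

-- The number of bonds in a directed cut might have a parity that depends on the decomposition. `F`
-- fixes one decomposition per closed set, and only the sets J_e make the choice harmless: if e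
-- avoids the cut, the value is the pairing with J_e, which is linear. This is why modularity asks
-- for a single edge avoiding all four cuts at once.
--
-- The endgame repeats one double count. If e has both ends outside a set R of sources and sinks,
-- J_e meets the cut of R with the parity of |R|. If that cut is also a sum of directed bonds
-- avoiding e, their number must have the same parity. Edges are excluded by a mismatch of these two
-- counts.
--
-- One failing weighting does not reveal the diamond. For two inner vertices u and v there are two
-- choices of weights with even total, differing at both u and v, and each yields a failing bond
-- that separates u from v. Comparing the two bonds shows that their closed sides contain different
-- hubs; the common part then consists of sources and the part outside both of sinks. Minimality
-- under deletion serves only to exclude parallel edges and, in the diamond, edges from a source to
-- a sink.

open import Defs
open import Algebra.Bundles using (CommutativeRing)
import Algebra.Properties.Semiring.Sum as SemiringSum
open import Data.Bool using (Bool; true; false; not; _∧_; _∨_; _xor_)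
import Data.Bool.Properties as Boolₚ
open import Data.Empty using (⊥; ⊥-elim)
open import Data.Fin using (Fin; zero; suc; _≟_; punchIn; punchOut)
import Data.Fin.Properties as Finₚ
open import Data.Fin.Subset using (Subset; ∣_∣; _∈_; _∉_; _∩_; ∁; ⁅_⁆)
open import Data.Fin.Subset.Properties using (anySubset?; p⊆q⇒∣p∣≤∣q∣; p⊂q⇒∣p∣<∣q∣; ∣p∣≤n; ∣⁅x⁆∣≡1; x∈⁅x⁆; x∈⁅y⁆⇒x≡y; x∈∁p⇒x∉p; x∉p⇒x∈∁p; _∈?_)
open import Data.Nat using (ℕ; zero; suc; _+_; _≤_; _<_; s≤s; z≤n)
import Data.Nat.Properties as ℕₚ
open import Data.Product using (Σ; ∃; _×_; _,_; proj₁; proj₂)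
open import Data.Sum using (_⊎_; inj₁; inj₂; [_,_])
open import Data.Vec using (tabulate; lookup; []; _∷_)
open import Data.Vec.Properties using (lookup∘tabulate; tabulate-cong; lookup-zipWith; []=⇒lookup; lookup⇒[]=)
open import Function using (_∘_)
open import Function.Bundles using (_⇔_; mk⇔)
open import Relation.Binary.PropositionalEquality using (_≡_; _≢_; _≗_; refl; sym; trans; cong; cong₂; subst; subst₂; module ≡-Reasoning)
open import Relation.Nullary using (¬_; Dec; yes; no; does)
open import Relation.Nullary.Decidable using (map′; ¬?; decidable-stable; dec-true; dec-false; _×-dec_; _⊎-dec_; _→-dec_)

-- Booleans, parities and finite sets

infixr 3 _⇒_
_⇒_ : Bool → Bool → Bool
true  ⇒ b = b
false ⇒ _ = true

infix 4 _==_
_==_ : Bool → Bool → Bool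
a == b = not (a xor b)

infixl 1 _∙_
_∙_ : ∀ {a b} → (a ⇒ b) ≡ true → a ≡ true → b ≡ true
_∙_ {true} p refl = p

⇒-intro : ∀ {a b} → (a ≡ true → b ≡ true) → (a ⇒ b) ≡ true
⇒-intro {true}  f = f refl
⇒-intro {false} f = refl

==⇒≡ : ∀ {a b} → (a == b) ≡ true → a ≡ b
==⇒≡ {true}  {true}  _ = refl
==⇒≡ {false} {false} _ = refl

≡⇒== : ∀ {a b} → a ≡ b → (a == b) ≡ true
≡⇒== {true}  refl = refl
≡⇒== {false} refl = refl

≡f⇒not : ∀ {a} → a ≡ false → not a ≡ true
≡f⇒not = cong not

not⇒≡f : ∀ {a} → not a ≡ true → a ≡ false
not⇒≡f {false} _ = refl

true≢false : ∀ {a} → a ≡ true → a ≡ false → ⊥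
true≢false {true} _ ()

≡⇒xor≡f : ∀ {a b} → a ≡ b → a xor b ≡ false
≡⇒xor≡f {a} refl = Boolₚ.xor-same a

xor≡f⇒≡ : ∀ {a b} → a xor b ≡ false → a ≡ b
xor≡f⇒≡ = ==⇒≡ ∘ cong not

bool-cases : ∀ b → b ≡ true ⊎ b ≡ false
bool-cases true  = inj₁ refl
bool-cases false = inj₂ refl

≢true⇒≡f : ∀ {a} → (a ≡ true → ⊥) → a ≡ false
≢true⇒≡f {true}  h = ⊥-elim (h refl)
≢true⇒≡f {false} _ = refl

-- Boolean identities are proved by truth table, with hypotheses discharged through _∙_.
Formula : ℕ → Set
Formula zero    = Bool
Formula (suc n) = Bool → Formula n

valid : ∀ n → Formula n → Bool
valid zero    b = b
valid (suc n) f = valid n (f true) ∧ valid n (f false)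

Holds : ∀ n → Formula n → Set
Holds zero    b = b ≡ true
Holds (suc n) f = ∀ x → Holds n (f x)

∧-true : ∀ {a b} → a ∧ b ≡ true → a ≡ true × b ≡ true
∧-true {true} p = refl , p

taut : ∀ n (f : Formula n) → valid n f ≡ true → Holds n f
taut zero    f p       = p
taut (suc n) f p true  = taut n (f true) (proj₁ (∧-true p))
taut (suc n) f p false = taut n (f false) (proj₂ (∧-true {valid n (f true)} p))

open CommutativeRing Boolₚ.xor-∧-commutativeRing using (semiring)
open SemiringSum semiring using (sum; sum-cong-≗; ∑-distrib-+; ∑-comm; *-distribˡ-sum)

sum-false : ∀ {n} {f : Fin n → Bool} → (∀ i → f i ≡ false) → sum f ≡ false
sum-false {zero}  h = refl
sum-false {suc n} h = cong₂ _xor_ (h zero) (sum-false (h ∘ suc))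

does⇒ : ∀ {A : Set} (a? : Dec A) → does a? ≡ true → A
does⇒ (yes a) _ = a

¬does⇒ : ∀ {A : Set} (a? : Dec A) → does a? ≡ false → ¬ A
¬does⇒ (no ¬a) _ = ¬a

⟪_⟫ : ∀ {n} → Fin n → Fin n → Bool
⟪ z ⟫ w = does (z ≟ w)

∈⟪⟫ : ∀ {n} {z w : Fin n} → z ≡ w → ⟪ z ⟫ w ≡ true
∈⟪⟫ {z = z} {w} p = dec-true (z ≟ w) p

∉⟪⟫ : ∀ {n} {z w : Fin n} → z ≢ w → ⟪ z ⟫ w ≡ false
∉⟪⟫ {z = z} {w} p = dec-false (z ≟ w) p

⟪⟫⇒≡ : ∀ {n} {z w : Fin n} → ⟪ z ⟫ w ≡ true → z ≡ w
⟪⟫⇒≡ {z = z} {w} = does⇒ (z ≟ w)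

sum-⟪⟫ : ∀ {n} (z : Fin n) (f : Fin n → Bool) → sum (λ w → ⟪ z ⟫ w ∧ f w) ≡ f z
sum-⟪⟫ {suc n} zero f = trans (cong (f zero xor_) (sum-false {n} (λ _ → refl))) (Boolₚ.xor-identityʳ _)
sum-⟪⟫ (suc z) f = sum-⟪⟫ z (f ∘ suc)

sum-single : ∀ {n} (z : Fin n) → sum ⟪ z ⟫ ≡ true
sum-single z = trans (sum-cong-≗ (λ w → sym (Boolₚ.∧-identityʳ (⟪ z ⟫ w)))) (sum-⟪⟫ z (λ _ → true))

sum-not : ∀ {n} (X : Fin n → Bool) → sum (not ∘ X) ≡ sum {n} (λ _ → true) xor sum X
sum-not X = ∑-distrib-+ (λ _ → true) X

sum-complement : ∀ {n} (c X : Fin n → Bool) → sum c ≡ false →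
                 sum (λ v → X v ∧ c v) ≡ false → sum (λ v → not (X v) ∧ c v) ≡ false
sum-complement c X even p = begin
  sum (λ v → not (X v) ∧ c v)
    ≡⟨ sum-cong-≗ (λ v → ==⇒≡ (taut 2 (λ x w → (not x ∧ w) == (w xor (x ∧ w))) refl (X v) (c v))) ⟩
  sum (λ v → c v xor (X v ∧ c v))
    ≡⟨ ∑-distrib-+ c (λ v → X v ∧ c v) ⟩
  sum c xor sum (λ v → X v ∧ c v)
    ≡⟨ cong₂ _xor_ even p ⟩
  false ∎
  where open ≡-Reasoning

-- Expand `k (ψ f)` over the indicator of `ψ f` and exchange the sums. Injectivity leaves one term
-- in the fibre over a point of the image, and `k` vanishes elsewhere.
sum-reindex : ∀ {m n} (ψ : Fin m → Fin n) → (∀ f g → ψ f ≡ ψ g → f ≡ g) →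
              (k : Fin n → Bool) → (∀ e → (∃ λ f → ψ f ≡ e) ⊎ k e ≡ false) →
              sum (k ∘ ψ) ≡ sum k
sum-reindex {m} {n} ψ inj k supp = begin
  sum (λ f → k (ψ f))                         ≡⟨ sum-cong-≗ (λ f → sym (sum-⟪⟫ (ψ f) k)) ⟩
  sum (λ f → sum (λ e → ⟪ ψ f ⟫ e ∧ k e))     ≡⟨ ∑-comm (λ f e → ⟪ ψ f ⟫ e ∧ k e) ⟩
  sum (λ e → sum (λ f → ⟪ ψ f ⟫ e ∧ k e))     ≡⟨ sum-cong-≗ fibre ⟩
  sum k                                       ∎
  where
  open ≡-Reasoning
  fibre : ∀ e → sum (λ f → ⟪ ψ f ⟫ e ∧ k e) ≡ k e
  fibre e with supp e
  ... | inj₂ z = trans (sum-false (λ f → trans (cong (⟪ ψ f ⟫ e ∧_) z) (Boolₚ.∧-zeroʳ _))) (sym z)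
  ... | inj₁ (f₀ , refl) = trans (sum-cong-≗ same) (sum-⟪⟫ f₀ (λ _ → k (ψ f₀)))
    where
    same : ∀ f → ⟪ ψ f ⟫ (ψ f₀) ∧ k (ψ f₀) ≡ ⟪ f₀ ⟫ f ∧ k (ψ f₀)
    same f with f₀ ≟ f
    ... | yes refl = cong (_∧ k (ψ f₀)) (∈⟪⟫ {z = ψ f₀} refl)
    ... | no p     = cong (_∧ k (ψ f₀)) (∉⟪⟫ (λ q → p (sym (inj _ _ q))))

parity : ℕ → Bool
parity zero    = false
parity (suc n) = not (parity n)

parity⇒Odd : ∀ n → parity n ≡ true → Odd n
parity⇒Odd (suc zero)    p = refl
parity⇒Odd (suc (suc n)) p = parity⇒Odd n (trans (sym (Boolₚ.not-involutive _)) p)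

Odd⇒parity : ∀ n → Odd n → parity n ≡ true
Odd⇒parity (suc zero)    p = refl
Odd⇒parity (suc (suc n)) p = trans (Boolₚ.not-involutive _) (Odd⇒parity n p)

sum-lookup : ∀ {n} (S : Subset n) → sum (lookup S) ≡ parity ∣ S ∣
sum-lookup []          = refl
sum-lookup (true ∷ S)  = cong not (sum-lookup S)
sum-lookup (false ∷ S) = sum-lookup S

sum-true : ∀ n → sum {n} (λ _ → true) ≡ parity n
sum-true zero    = refl
sum-true (suc n) = cong not (sum-true n)

VSet : ℕ → Set
VSet n = Fin n → Bool

-- The search runs over vectors, which represent a function only up to `≗`; hence the demand that
-- `P` respect it.
∃set? : ∀ {n} {P : VSet n → Set} → (∀ {X Y} → X ≗ Y → P X → P Y) →
        (∀ X → Dec (P X)) → Dec (∃ P)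
∃set? resp P? = map′ (λ { (S , p) → lookup S , p })
                     (λ { (X , p) → tabulate X , resp (λ v → sym (lookup∘tabulate X v)) p })
                     (anySubset? (λ S → P? (lookup S)))

∀set? : ∀ {n} {P : VSet n → Set} → (∀ {X Y} → X ≗ Y → P X → P Y) →
        (∀ X → Dec (P X)) → Dec (∀ X → P X)
∀set? resp P? = map′ (λ ¬∃ X → decidable-stable (P? X) (λ ¬p → ¬∃ (X , ¬p)))
                     (λ { all (X , ¬p) → ¬p (all X) })
                     (¬? (∃set? (λ X≗Y ¬p p → ¬p (resp (sym ∘ X≗Y) p)) (λ X → ¬? (P? X))))

⟪⟫-sym : ∀ {n} (z w : Fin n) → ⟪ z ⟫ w ≡ ⟪ w ⟫ z
⟪⟫-sym z w with w ≟ z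
... | yes refl = ∈⟪⟫ {z = z} refl
... | no p     = ∉⟪⟫ (p ∘ sym)

iff⇒≡ : ∀ {a b} → (a ≡ true → b ≡ true) → (b ≡ true → a ≡ true) → a ≡ b
iff⇒≡ {true}  {b}     f g = sym (f refl)
iff⇒≡ {false} {true}  f g = g refl
iff⇒≡ {false} {false} f g = refl

-- Cuts and bonds

module Cuts (D : Digraph) where

  private
    t = tail D
    h = head D

  VS : Set
  VS = VSet (V D)

  ES : Set
  ES = VSet (E D)

  δ : VS → ES
  δ X e = X (t e) xor X (h e)

  Crossed : VS → Set
  Crossed X = ∃ λ e → δ X e ≡ true

  infix 4 _⊑_
  _⊑_ : VS → VS → Set
  Z ⊑ X = ∀ e → δ Z e ≡ true → δ X e ≡ true

  Closed : VS → Set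
  Closed X = ∀ e → X (h e) ≡ true → X (t e) ≡ true

  -- `X` and `not ∘ X` describe the same cut, so either of them may be the side that no edge enters.
  Directed : VS → Set
  Directed X = Closed X ⊎ Closed (not ∘ X)

  Bond : VS → Set
  Bond X = Crossed X × (∀ Z → Crossed Z → Z ⊑ X → X ⊑ Z)

  record Dibond (X : VS) : Set where
    constructor dibond
    field
      bond     : Bond X
      directed : Directed X

  open Dibond public

  ⟨_,_⟩ : ES → VS → Bool
  ⟨ J , X ⟩ = sum (λ e → J e ∧ δ X e)

  OddDijoin : ES → Set
  OddDijoin J = ∀ X → Dibond X → ⟨ J , X ⟩ ≡ true

  δ-cong : ∀ {X Y} → X ≗ Y → δ X ≗ δ Y
  δ-cong p e = cong₂ _xor_ (p (t e)) (p (h e))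

  δ-not : ∀ X → δ (not ∘ X) ≗ δ X
  δ-not X e = Boolₚ.xor-annihilates-not (X (t e)) (X (h e))

  δ-xor : ∀ X Y → δ (λ v → X v xor Y v) ≗ (λ e → δ X e xor δ Y e)
  δ-xor X Y e = ==⇒≡ (taut 4 (λ a b c d → ((a xor b) xor (c xor d)) == ((a xor c) xor (b xor d))) refl (X (t e)) (Y (t e)) (X (h e)) (Y (h e)))

  ⟨⟩-congδ : ∀ J {X Y} → δ X ≗ δ Y → ⟨ J , X ⟩ ≡ ⟨ J , Y ⟩
  ⟨⟩-congδ J p = sum-cong-≗ (λ e → cong (J e ∧_) (p e))

  ⟨⟩-cong : ∀ J {X Y} → X ≗ Y → ⟨ J , X ⟩ ≡ ⟨ J , Y ⟩
  ⟨⟩-cong J {X} {Y} p = ⟨⟩-congδ J {X} {Y} (δ-cong p)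

  ⟨⟩-congJ : ∀ {J K} X → J ≗ K → ⟨ J , X ⟩ ≡ ⟨ K , X ⟩
  ⟨⟩-congJ X p = sum-cong-≗ (λ e → cong (_∧ δ X e) (p e))

  ⟨⟩-not : ∀ J X → ⟨ J , not ∘ X ⟩ ≡ ⟨ J , X ⟩
  ⟨⟩-not J X = ⟨⟩-congδ J {not ∘ X} {X} (δ-not X)

  ⟨⟩-full : ∀ J → ⟨ J , (λ _ → true) ⟩ ≡ false
  ⟨⟩-full J = sum-false (λ e → Boolₚ.∧-zeroʳ (J e))

  ⟨⟩-uncrossed : ∀ J {X} → (∀ e → δ X e ≡ false) → ⟨ J , X ⟩ ≡ false
  ⟨⟩-uncrossed J p = sum-false (λ e → trans (cong (J e ∧_) (p e)) (Boolₚ.∧-zeroʳ (J e)))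

  ⟨⟩-xor : ∀ J X Y → ⟨ J , (λ v → X v xor Y v) ⟩ ≡ ⟨ J , X ⟩ xor ⟨ J , Y ⟩
  ⟨⟩-xor J X Y = trans
    (sum-cong-≗ (λ e → trans (cong (J e ∧_) (δ-xor X Y e)) (Boolₚ.∧-distribˡ-xor (J e) (δ X e) (δ Y e))))
    (∑-distrib-+ (λ e → J e ∧ δ X e) (λ e → J e ∧ δ Y e))

  ⟨⟩-xorJ : ∀ J K X → ⟨ (λ e → J e xor K e) , X ⟩ ≡ ⟨ J , X ⟩ xor ⟨ K , X ⟩
  ⟨⟩-xorJ J K X = trans
    (sum-cong-≗ (λ e → Boolₚ.∧-distribʳ-xor (δ X e) (J e) (K e)))
    (∑-distrib-+ (λ e → J e ∧ δ X e) (λ e → K e ∧ δ X e))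

  -- Modulo 2 a cut is the sum of the stars of the vertices on one side: an edge with both ends in
  -- `X` is counted twice.
  δ-vertices : ∀ X e → sum (λ z → X z ∧ δ ⟪ z ⟫ e) ≡ δ X e
  δ-vertices X e = begin
    sum (λ z → X z ∧ (⟪ z ⟫ (t e) xor ⟪ z ⟫ (h e)))
      ≡⟨ sum-cong-≗ (λ z → trans (cong (X z ∧_) (cong₂ _xor_ (⟪⟫-sym z (t e)) (⟪⟫-sym z (h e)))) (swap (X z) (⟪ t e ⟫ z) (⟪ h e ⟫ z))) ⟩
    sum (λ z → (⟪ t e ⟫ z ∧ X z) xor (⟪ h e ⟫ z ∧ X z))
      ≡⟨ ∑-distrib-+ (λ z → ⟪ t e ⟫ z ∧ X z) (λ z → ⟪ h e ⟫ z ∧ X z) ⟩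
    sum (λ z → ⟪ t e ⟫ z ∧ X z) xor sum (λ z → ⟪ h e ⟫ z ∧ X z)
      ≡⟨ cong₂ _xor_ (sum-⟪⟫ (t e) X) (sum-⟪⟫ (h e) X) ⟩
    δ X e ∎
    where
    open ≡-Reasoning
    swap : ∀ a b c → a ∧ (b xor c) ≡ (b ∧ a) xor (c ∧ a)
    swap a b c = ==⇒≡ (taut 3 (λ a b c → (a ∧ (b xor c)) == ((b ∧ a) xor (c ∧ a))) refl a b c)

  ⟨⟩-vertices : ∀ J X → ⟨ J , X ⟩ ≡ sum (λ z → X z ∧ ⟨ J , ⟪ z ⟫ ⟩)
  ⟨⟩-vertices J X = begin
    sum (λ e → J e ∧ δ X e)
      ≡⟨ sum-cong-≗ (λ e → trans (cong (J e ∧_) (sym (δ-vertices X e))) (*-distribˡ-sum (J e) (λ z → X z ∧ δ ⟪ z ⟫ e))) ⟩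
    sum (λ e → sum (λ z → J e ∧ (X z ∧ δ ⟪ z ⟫ e)))
      ≡⟨ ∑-comm (λ e z → J e ∧ (X z ∧ δ ⟪ z ⟫ e)) ⟩
    sum (λ z → sum (λ e → J e ∧ (X z ∧ δ ⟪ z ⟫ e)))
      ≡⟨ sum-cong-≗ (λ z → trans (sum-cong-≗ (λ e → swap (J e) (X z) (δ ⟪ z ⟫ e))) (sym (*-distribˡ-sum (X z) (λ e → J e ∧ δ ⟪ z ⟫ e)))) ⟩
    sum (λ z → X z ∧ ⟨ J , ⟪ z ⟫ ⟩) ∎
    where
    open ≡-Reasoning
    swap : ∀ a b c → a ∧ (b ∧ c) ≡ b ∧ (a ∧ c)
    swap a b c = ==⇒≡ (taut 3 (λ a b c → (a ∧ (b ∧ c)) == (b ∧ (a ∧ c))) refl a b c)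

  -- The star-counting half of the parity contradictions below: the cut of `R` is the sum of the
  -- stars in `R`, and each contributes one.
  ⟨⟩-odd-vertices : ∀ J R → (∀ z → R z ≡ true → ⟨ J , ⟪ z ⟫ ⟩ ≡ true) → ⟨ J , R ⟩ ≡ sum R
  ⟨⟩-odd-vertices J R odd = trans (⟨⟩-vertices J R) (sum-cong-≗ step)
    where
    step : ∀ z → R z ∧ ⟨ J , ⟪ z ⟫ ⟩ ≡ R z
    step z with R z | odd z
    ... | true  | o = o refl
    ... | false | _ = refl

  Closed-cong : ∀ {X Y} → X ≗ Y → Closed X → Closed Y
  Closed-cong p c e q = trans (sym (p (t e))) (c e (trans (p (h e)) q))

  Closed-notnot : ∀ {X} → Closed X → Closed (not ∘ not ∘ X)
  Closed-notnot {X} = Closed-cong {X} (λ v → sym (Boolₚ.not-involutive (X v)))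

  Directed-cong : ∀ {X Y} → X ≗ Y → Directed X → Directed Y
  Directed-cong p (inj₁ c) = inj₁ (Closed-cong p c)
  Directed-cong p (inj₂ c) = inj₂ (Closed-cong (cong not ∘ p) c)

  Directed-not : ∀ {X} → Directed X → Directed (not ∘ X)
  Directed-not {X} (inj₁ c) = inj₂ (Closed-notnot {X} c)
  Directed-not (inj₂ c) = inj₁ c

  Bond-congδ : ∀ X Y → δ X ≗ δ Y → Bond X → Bond Y
  Bond-congδ X Y p ((e , c) , min) =
    (e , trans (sym (p e)) c) ,
    λ Z cr sub f q → min Z cr (λ g r → trans (p g) (sub g r)) f (trans (p f) q)

  Dibond-cong : ∀ {X Y} → X ≗ Y → Dibond X → Dibond Y
  Dibond-cong {X} {Y} p (dibond b d) = dibond (Bond-congδ X Y (δ-cong p) b) (Directed-cong p d)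

  Dibond-not : ∀ {X} → Dibond X → Dibond (not ∘ X)
  Dibond-not {X} (dibond b d) = dibond (Bond-congδ X (not ∘ X) (λ e → sym (δ-not X e)) b) (Directed-not {X} d)

  Crossed? : ∀ X → Dec (Crossed X)
  Crossed? X = Finₚ.any? (λ e → δ X e Boolₚ.≟ true)

  _⊑?_ : ∀ Z X → Dec (Z ⊑ X)
  Z ⊑? X = Finₚ.all? (λ e → (δ Z e Boolₚ.≟ true) →-dec (δ X e Boolₚ.≟ true))

  Closed? : ∀ X → Dec (Closed X)
  Closed? X = Finₚ.all? (λ e → (X (h e) Boolₚ.≟ true) →-dec (X (t e) Boolₚ.≟ true))

  Directed? : ∀ X → Dec (Directed X)
  Directed? X = Closed? X ⊎-dec Closed? (not ∘ X)

  Bond? : ∀ X → Dec (Bond X)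
  Bond? X = Crossed? X ×-dec
    ∀set? (λ {Z} {Z′} p min cr sub f q →
             trans (sym (δ-cong p f))
               (min (proj₁ cr , trans (δ-cong p (proj₁ cr)) (proj₂ cr))
                    (λ e r → sub e (trans (sym (δ-cong p e)) r)) f q))
          (λ Z → Crossed? Z →-dec (Z ⊑? X →-dec X ⊑? Z))

  Dibond? : ∀ X → Dec (Dibond X)
  Dibond? X = map′ (λ { (b , d) → dibond b d }) (λ { (dibond b d) → b , d }) (Bond? X ×-dec Directed? X)

  OddDijoin? : ∀ J → Dec (OddDijoin J)
  OddDijoin? J = ∀set? (λ p o d → trans (⟨⟩-cong J (sym ∘ p)) (o (Dibond-cong (sym ∘ p) d)))
                       (λ X → Dibond? X →-dec (⟨ J , X ⟩ Boolₚ.≟ true))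

  -- Decidability is what permits the converse direction to argue from the absence of an odd dijoin.
  ∃OddDijoin? : Dec (∃ OddDijoin)
  ∃OddDijoin? = ∃set? (λ p o X d → trans (⟨⟩-congJ X (sym ∘ p)) (o X d)) OddDijoin?

  private
    lookup-cut : ∀ X e → lookup (cut D X) e ≡ δ (lookup X) e
    lookup-cut X e = lookup∘tabulate _ e

    lookup-cut-tabulate : ∀ X e → lookup (cut D (tabulate X)) e ≡ δ X e
    lookup-cut-tabulate X e = trans (lookup-cut (tabulate X) e) (δ-cong (lookup∘tabulate X) e)

    parity-cut : ∀ J X → parity ∣ J ∩ cut D X ∣ ≡ ⟨ lookup J , lookup X ⟩
    parity-cut J X = trans (sym (sum-lookup (J ∩ cut D X)))
      (sum-cong-≗ (λ e → trans (lookup-zipWith _∧_ e J (cut D X)) (cong (lookup J e ∧_) (lookup-cut X e))))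

    IsBond⇒Bond : ∀ X → IsBond D (cut D X) → Bond (lookup X)
    IsBond⇒Bond X (_ , (e , e∈) , min) =
      (e , trans (sym (lookup-cut X e)) ([]=⇒lookup e∈)) ,
      λ Z (f , f∈) sub e e∈X →
        trans (sym (lookup-cut-tabulate Z e))
          (trans (cong (λ S → lookup S e)
             (min (cut D (tabulate Z)) (tabulate Z , refl)
               (f , lookup⇒[]= f _ (trans (lookup-cut-tabulate Z f) f∈))
               (λ {e′} e′∈ → lookup⇒[]= e′ _ (trans (lookup-cut X e′)
                  (sub e′ (trans (sym (lookup-cut-tabulate Z e′)) ([]=⇒lookup e′∈)))))))
            (trans (lookup-cut X e) e∈X))

    Bond⇒IsBond : ∀ X → Bond X → IsBond D (cut D (tabulate X))
    Bond⇒IsBond X ((e , e∈) , min) =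
      (tabulate X , refl) , (e , lookup⇒[]= e _ (trans (lookup-cut-tabulate X e) e∈)) , min′
      where
      min′ : ∀ S → IsCut D S → _ → (∀ {e} → e ∈ S → e ∈ cut D (tabulate X)) → S ≡ cut D (tabulate X)
      min′ _ (Z , refl) (f , f∈) sub = tabulate-cong λ e′ → iff⇒≡
        (λ r → trans (δ-cong (lookup∘tabulate X) e′) (sub′ e′ r))
        (λ r → min (lookup Z) (f , trans (sym (lookup-cut Z f)) ([]=⇒lookup f∈)) sub′ e′
                   (trans (sym (δ-cong (lookup∘tabulate X) e′)) r))
        where
        sub′ : lookup Z ⊑ X
        sub′ e′ r = trans (sym (lookup-cut-tabulate X e′))
          ([]=⇒lookup (sub (lookup⇒[]= e′ _ (trans (lookup-cut Z e′) r))))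

  HasOddDijoin⇒∃ : HasOddDijoin D → ∃ OddDijoin
  HasOddDijoin⇒∃ (J , odd) = lookup J , λ
    { X (dibond b (inj₁ c)) → closed X b c
    ; X (dibond b (inj₂ c)) → trans (sym (⟨⟩-not (lookup J) X))
        (closed (not ∘ X) (Bond-congδ X (not ∘ X) (λ e → sym (δ-not X e)) b) c) }
    where
    closed : ∀ X → Bond X → Closed X → ⟨ lookup J , X ⟩ ≡ true
    closed X b c = trans (⟨⟩-cong (lookup J) (sym ∘ lookup∘tabulate X))
      (trans (sym (parity-cut J (tabulate X)))
        (Odd⇒parity ∣ J ∩ cut D (tabulate X) ∣ (odd (cut D (tabulate X)) (Bond⇒IsBond X b , tabulate X , refl ,
          λ { e (t∉ , h∈) → t∉ (lookup⇒[]= (t e) _ (trans (lookup∘tabulate X (t e))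
                (c e (trans (sym (lookup∘tabulate X (h e))) ([]=⇒lookup h∈))))) }))))

  ∃⇒HasOddDijoin : ∃ OddDijoin → HasOddDijoin D
  ∃⇒HasOddDijoin (J , odd) = tabulate J , λ
    { _ (b , X , refl , dir) → parity⇒Odd ∣ tabulate J ∩ cut D X ∣ (trans (parity-cut (tabulate J) X)
        (trans (⟨⟩-congJ (lookup X) (lookup∘tabulate J))
          (odd (lookup X) (dibond (IsBond⇒Bond X b) (inj₁ (closed X dir)))))) }
    where
    closed : ∀ X → (∀ e → ¬ (t e ∉ X × h e ∈ X)) → Closed (lookup X)
    closed X dir e p = decidable-stable (lookup X (t e) Boolₚ.≟ true)
      λ q → dir e ((q ∘ []=⇒lookup) , lookup⇒[]= (h e) X p)

-- Odd dijoins of minors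

Image : ∀ {m n} → (Fin m → Fin n) → Fin n → Set
Image ψ e = ∃ λ f → ψ f ≡ e

-- The default `false` keeps a deleted edge out of the extended set, as `undelete-dijoin` requires.
extend : ∀ {m n} → (Fin m → Fin n) → VSet m → VSet n
extend ψ J e with Finₚ.any? (λ f → ψ f ≟ e)
... | yes (f , _) = J f
... | no _        = false

extend-ψ : ∀ {m n} (ψ : Fin m → Fin n) → (∀ f g → ψ f ≡ ψ g → f ≡ g) →
           ∀ J f → extend ψ J (ψ f) ≡ J f
extend-ψ ψ inj J f with Finₚ.any? (λ g → ψ g ≟ ψ f)
... | yes (g , p) = cong J (inj g f p)
... | no p        = ⊥-elim (p (f , refl))

extend-missed : ∀ {m n} (ψ : Fin m → Fin n) J {e} → (∀ f → ψ f ≢ e) → extend ψ J e ≡ false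
extend-missed ψ J {e} miss with Finₚ.any? (λ g → ψ g ≟ e)
... | yes (g , p) = ⊥-elim (miss g p)
... | no p        = refl

-- Contractions and deletions of isolated vertices alike: the cuts of D′ are
-- the cuts of D contained in the image of ψ.
module Restriction (D D′ : Digraph) (ψ : Fin (E D′) → Fin (E D))
  (ψ-inj : ∀ f g → ψ f ≡ ψ g → f ≡ g) where

  private
    module C = Cuts D
    module C′ = Cuts D′

  Supported : C.VS → Set
  Supported X = ∀ e → Image ψ e ⊎ C.δ X e ≡ false

  record _~_ (X : C.VS) (X′ : C′.VS) : Set where
    constructor related
    field
      ~tail     : ∀ f → X (tail D (ψ f)) ≡ X′ (tail D′ f)
      ~head     : ∀ f → X (head D (ψ f)) ≡ X′ (head D′ f)
      supported : Supported X

  open _~_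

  ~δ : ∀ {X X′} → X ~ X′ → ∀ f → C.δ X (ψ f) ≡ C′.δ X′ f
  ~δ r f = cong₂ _xor_ (~tail r f) (~head r f)

  ~not : ∀ {X X′} → X ~ X′ → (not ∘ X) ~ (not ∘ X′)
  ~not {X} r = related (cong not ∘ ~tail r) (cong not ∘ ~head r)
    (λ e → [ inj₁ , (λ p → inj₂ (trans (C.δ-not X e) p)) ] (supported r e))

  ~in-image : ∀ {X X′} → X ~ X′ → ∀ e → C.δ X e ≡ true → Image ψ e
  ~in-image r e p = [ (λ i → i) , (λ q → ⊥-elim (true≢false p q)) ] (supported r e)

  ~closed : ∀ {X X′} → X ~ X′ → C.Closed X → C′.Closed X′
  ~closed r c f p = trans (sym (~tail r f)) (c (ψ f) (trans (~head r f) p))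

  ~closed⁻ : ∀ {X X′} → X ~ X′ → C′.Closed X′ → C.Closed X
  ~closed⁻ {X} r c e p with supported r e
  ... | inj₁ (f , refl) = trans (~tail r f) (c f (trans (sym (~head r f)) p))
  ... | inj₂ q = ==⇒≡ {X (tail D e)} {true} (taut 2 (λ a b → b ⇒ not (a xor b) ⇒ (a == true)) refl (X (tail D e)) (X (head D e)) ∙ p ∙ ≡f⇒not q)

  ~⟨⟩ : ∀ {X X′} → X ~ X′ → ∀ J → C′.⟨ J ∘ ψ , X′ ⟩ ≡ C.⟨ J , X ⟩
  ~⟨⟩ {X} r J = trans (sum-cong-≗ (λ f → cong (J (ψ f) ∧_) (sym (~δ r f))))
    (sum-reindex ψ ψ-inj (λ e → J e ∧ C.δ X e)
      (λ e → [ inj₁ , (λ p → inj₂ (trans (cong (J e ∧_) p) (Boolₚ.∧-zeroʳ (J e)))) ] (supported r e)))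

  module _ (lift : ∀ X′ → ∃ λ X → X ~ X′) (lower : ∀ X → Supported X → ∃ λ X′ → X ~ X′) where

    ~dibond : ∀ {X X′} → X ~ X′ → C.Dibond X → C′.Dibond X′
    ~dibond {X} {X′} r (C.dibond ((e , p) , min) d) = C′.dibond (crossed , min′) (dir d)
      where
      crossed : C′.Crossed X′
      crossed with ~in-image r e p
      ... | f , refl = f , trans (sym (~δ r f)) p
      min′ : ∀ Z′ → C′.Crossed Z′ → Z′ C′.⊑ X′ → X′ C′.⊑ Z′
      min′ Z′ (f , q) sub f₁ q₁ with lift Z′
      ... | Z , s = trans (sym (~δ s f₁)) (min Z (ψ f , trans (~δ s f) q) sub′ (ψ f₁) (trans (~δ r f₁) q₁))
        where
        sub′ : Z C.⊑ X
        sub′ e z with ~in-image s e z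
        ... | g , refl = trans (~δ r g) (sub g (trans (sym (~δ s g)) z))
      dir : C.Directed X → C′.Directed X′
      dir (inj₁ c) = inj₁ (~closed r c)
      dir (inj₂ c) = inj₂ (~closed (~not r) c)

    -- A competitor `Z` with `Z ⊑ X` crosses only edges in the image of `ψ`, so it is supported and
    -- `lower` carries it to `D′`, where minimality is known.
    ~dibond⁻ : ∀ {X X′} → X ~ X′ → C′.Dibond X′ → C.Dibond X
    ~dibond⁻ {X} {X′} r (C′.dibond ((f , p) , min) d) = C.dibond ((ψ f , trans (~δ r f) p) , min′) (dir d)
      where
      min′ : ∀ Z → C.Crossed Z → Z C.⊑ X → X C.⊑ Z
      min′ Z (e , q) sub e₁ q₁ with lower Z supp
        where
        supp : Supported Z
        supp e with bool-cases (C.δ Z e)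
        ... | inj₁ z = inj₁ (~in-image r e (sub e z))
        ... | inj₂ z = inj₂ z
      ... | Z′ , s with ~in-image s e q | ~in-image r e₁ q₁
      ...   | f , refl | f₁ , refl =
        trans (~δ s f₁) (min Z′ (f , trans (sym (~δ s f)) q)
          (λ g z → trans (sym (~δ r g)) (sub (ψ g) (trans (~δ s g) z))) f₁ (trans (sym (~δ r f₁)) q₁))
      dir : C′.Directed X′ → C.Directed X
      dir (inj₁ c) = inj₁ (~closed⁻ r c)
      dir (inj₂ c) = inj₂ (~closed⁻ (~not r) c)

    restrict-dijoin : ∃ C.OddDijoin → ∃ C′.OddDijoin
    restrict-dijoin (J , odd) = J ∘ ψ , λ X′ d →
      let X , r = lift X′ in trans (~⟨⟩ r J) (odd X (~dibond⁻ r d))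

    extend-dijoin : ∃ C′.OddDijoin → ∃ λ J → ∀ X → C.Dibond X → Supported X → C.⟨ J , X ⟩ ≡ true
    extend-dijoin (J′ , odd) = extend ψ J′ , λ X d s →
      let X′ , r = lower X s in
      trans (sym (~⟨⟩ r (extend ψ J′)))
        (trans (C′.⟨⟩-congJ X′ (extend-ψ ψ ψ-inj J′)) (odd X′ (~dibond r d)))

module _ {D D′ : Digraph} (c : Contraction D D′) where
  open Contraction c
  open Restriction D D′ ψ ψ-inj
  private
    module C = Cuts D
    module C′ = Cuts D′

    onto : ∀ (X : C.VS) → C.δ X e ≡ false → Supported X
    onto X p g with g ≟ e
    ... | yes refl = inj₂ p
    ... | no q     = inj₁ (ψ-onto g q)

    lift : ∀ X′ → ∃ λ X → X ~ X′
    lift X′ = X′ ∘ φ , related (λ f → cong X′ (sym (tail-ok f))) (λ f → cong X′ (sym (head-ok f)))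
      (onto (X′ ∘ φ) (≡⇒xor≡f (cong X′ φ-merge)))

    lower : ∀ X → Supported X → ∃ λ X′ → X ~ X′
    lower X s = X′ , related (λ f → trans (sym (factor _)) (cong X′ (sym (tail-ok f))))
                             (λ f → trans (sym (factor _)) (cong X′ (sym (head-ok f)))) s
      where
      X′ : C′.VS
      X′ w = X (proj₁ (φ-surj w))
      ends : X (tail D e) ≡ X (head D e)
      ends = [ (λ { (f , p) → ⊥-elim (ψ-avoid f p) }) , (λ p → xor≡f⇒≡ p) ] (s e)
      factor : ∀ u → X′ (φ u) ≡ X u
      factor u with φ-only _ u (proj₂ (φ-surj (φ u)))
      ... | inj₁ p = cong X p
      ... | inj₂ (inj₁ (p , q)) = trans (cong X p) (trans ends (cong X (sym q)))
      ... | inj₂ (inj₂ (p , q)) = trans (cong X p) (trans (sym ends) (cong X (sym q)))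

  contract-dijoin : ∃ C.OddDijoin → ∃ C′.OddDijoin
  contract-dijoin = restrict-dijoin lift lower

  uncontract-dijoin : ∃ C′.OddDijoin → ∃ λ J → ∀ X → C.Dibond X → C.δ X e ≡ false → C.⟨ J , X ⟩ ≡ true
  uncontract-dijoin o with extend-dijoin lift lower o
  ... | J , odd = J , λ X d p → odd X d (onto X p)

module _ {D D′ : Digraph} (i : IsolatedDeletion D D′) where
  open IsolatedDeletion i
  open Restriction D D′ ψ ψ-inj
  private
    module C = Cuts D
    module C′ = Cuts D′

    lift : ∀ X′ → ∃ λ X → X ~ X′
    lift X′ = extend φ X′ , related (λ f → trans (cong (extend φ X′) (tail-ok f)) (extend-ψ φ φ-inj X′ _))
                                    (λ f → trans (cong (extend φ X′) (head-ok f)) (extend-ψ φ φ-inj X′ _))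
                                    (inj₁ ∘ ψ-surj)

    lower : ∀ X → Supported X → ∃ λ X′ → X ~ X′
    lower X s = X ∘ φ , related (λ f → cong X (tail-ok f)) (λ f → cong X (head-ok f)) s

  isolated-dijoin : ∃ C.OddDijoin → ∃ C′.OddDijoin
  isolated-dijoin = restrict-dijoin lift lower

  unisolated-dijoin : ∃ C′.OddDijoin → ∃ C.OddDijoin
  unisolated-dijoin o with extend-dijoin lift lower o
  ... | J , odd = J , λ X d → odd X d (inj₁ ∘ ψ-surj)

-- Directed walks and the deletion of edges.

module Walks (D : Digraph) (e : Fin (E D)) where
  open Cuts D

  walk-constant : ∀ {u v} (K : VS) → (∀ f → f ≢ e → δ K f ≡ false) → WalkAvoiding D e u v → K u ≡ K v
  walk-constant K c here            = refl
  walk-constant K c (there f f≢e w) = trans (xor≡f⇒≡ (c f f≢e)) (walk-constant K c w)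

  walk-crosses : ∀ {u v} (K : VS) → WalkAvoiding D e u v → K u xor K v ≡ true → ∃ λ f → f ≢ e × δ K f ≡ true
  walk-crosses {u} {v} K w p with Finₚ.any? (λ f → ¬? (f ≟ e) ×-dec (δ K f Boolₚ.≟ true))
  ... | yes q = q
  ... | no q  = ⊥-elim (true≢false p
    (≡⇒xor≡f (walk-constant K (λ f n → ≢true⇒≡f (λ r → q (f , n , r))) w)))

  walk-closed : ∀ {u v} (X : VS) → (∀ f → f ≢ e → X (head D f) ≡ true → X (tail D f) ≡ true) →
                WalkAvoiding D e u v → X v ≡ true → X u ≡ true
  walk-closed X c here          p = p
  walk-closed X c (there f n w) p = c f n (walk-closed X c w p)

  -- A directed walk meets a directed cut at most once.
  walk-same-side : ∀ {u v} (X K : VS) → Closed X → (∀ f → f ≢ e → δ X f ≡ false → δ K f ≡ false) →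
                   WalkAvoiding D e u v → X u ≡ X v → K u ≡ K v
  walk-same-side X K c sub here p = refl
  walk-same-side {v = v} X K c sub (there f n w) p =
    trans (xor≡f⇒≡ (sub f n (≡⇒xor≡f same)))
          (walk-same-side X K c sub w (trans (sym same) p))
    where
    same : X (tail D f) ≡ X (head D f)
    same = ==⇒≡ (taut 3 (λ a b z → (z ⇒ b) ⇒ (b ⇒ a) ⇒ (a == z) ⇒ (a == b)) refl (X (tail D f)) (X (head D f)) (X v)
             ∙ ⇒-intro (walk-closed X (λ f _ → c f) w) ∙ ⇒-intro (c f) ∙ ≡⇒== p)

  -- `P` is the edge set of the walk counted modulo 2; the crossings of any `X` telescope along the
  -- walk.
  walk-edges : ∀ {u v} → WalkAvoiding D e u v →
               ∃ λ (P : ES) → P e ≡ false × (∀ X → ⟨ P , X ⟩ ≡ X u xor X v)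
  walk-edges {u} here = (λ _ → false) , refl , λ X → trans (sum-false {E D} (λ _ → refl)) (sym (Boolₚ.xor-same (X u)))
  walk-edges {v = v} (there f f≢e w) with walk-edges w
  ... | P , avoids , sums = (λ g → ⟪ f ⟫ g xor P g) , cong₂ _xor_ (∉⟪⟫ f≢e) avoids , λ X →
    trans (⟨⟩-xorJ ⟪ f ⟫ P X) (trans (cong₂ _xor_ (sum-⟪⟫ f (δ X)) (sums X))
      (==⇒≡ (taut 3 (λ a b c → ((a xor b) xor (b xor c)) == (a xor c)) refl (X (tail D f)) (X (head D f)) (X v))))

module _ {D D′ : Digraph} (d : Deletion D D′) where
  open Deletion d
  private
    module C = Cuts D
    module C′ = Cuts D′
    open Walks D e

    walk : WalkAvoiding D e (tail D e) (head D e)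
    walk = proj₂ e-del

    record _~_ (X : C.VS) (X′ : C′.VS) : Set where
      constructor related
      field
        ~tail : ∀ f → X (tail D (ψ f)) ≡ X′ (tail D′ f)
        ~head : ∀ f → X (head D (ψ f)) ≡ X′ (head D′ f)
    open _~_

    lift : ∀ X′ → (X′ ∘ φ) ~ X′
    lift X′ = related (λ f → cong X′ (sym (tail-ok f))) (λ f → cong X′ (sym (head-ok f)))

    lower : ∀ X → X ~ (λ w → X (proj₁ (φ-surj w)))
    lower X = related (λ f → factor (tail D (ψ f)) (tail-ok f)) (λ f → factor (head D (ψ f)) (head-ok f))
      where
      factor : ∀ u {w} → w ≡ φ u → X u ≡ X (proj₁ (φ-surj w))
      factor u refl = cong X (sym (φ-inj _ u (proj₂ (φ-surj (φ u)))))

    ~δ : ∀ {X X′} → X ~ X′ → ∀ f → C.δ X (ψ f) ≡ C′.δ X′ f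
    ~δ r f = cong₂ _xor_ (~tail r f) (~head r f)

    ~not : ∀ {X X′} → X ~ X′ → (not ∘ X) ~ (not ∘ X′)
    ~not r = related (cong not ∘ ~tail r) (cong not ∘ ~head r)

    ~⟨⟩ : ∀ {X X′} → X ~ X′ → ∀ J → J e ≡ false → C′.⟨ J ∘ ψ , X′ ⟩ ≡ C.⟨ J , X ⟩
    ~⟨⟩ {X} r J p = trans (sum-cong-≗ (λ f → cong (J (ψ f) ∧_) (sym (~δ r f))))
      (sum-reindex ψ ψ-inj (λ g → J g ∧ C.δ X g) supp)
      where
      supp : ∀ g → Image ψ g ⊎ J g ∧ C.δ X g ≡ false
      supp g with g ≟ e
      ... | yes refl = inj₂ (cong (_∧ C.δ X e) p)
      ... | no q     = inj₁ (ψ-onto g q)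

    ~closed : ∀ {X X′} → X ~ X′ → C.Closed X → C′.Closed X′
    ~closed r c f p = trans (sym (~tail r f)) (c (ψ f) (trans (~head r f) p))

    -- The deleted edge cannot enter `X` either: membership passes backwards along the walk from the
    -- head of `e` to its tail.
    ~closed⁻ : ∀ {X X′} → X ~ X′ → C′.Closed X′ → C.Closed X
    ~closed⁻ {X} {X′} r c g with g ≟ e
    ... | yes refl = walk-closed X off walk
      where
      off : ∀ f → f ≢ e → X (head D f) ≡ true → X (tail D f) ≡ true
      off f n p with ψ-onto f n
      ... | f′ , refl = trans (~tail r f′) (c f′ (trans (sym (~head r f′)) p))
    ... | no q with ψ-onto g q
    ...   | f′ , refl = λ p → trans (~tail r f′) (c f′ (trans (sym (~head r f′)) p))

    crossed : ∀ {X X′} → X ~ X′ → C.Crossed X → C′.Crossed X′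
    crossed {X} {X′} r (g , p) with g ≟ e
    ... | no q with ψ-onto g q
    ...   | f , refl = f , trans (sym (~δ r f)) p
    crossed {X} {X′} r (g , p) | yes refl with walk-crosses X walk p
    ...   | f , n , q with ψ-onto f n
    ...     | f′ , refl = f′ , trans (sym (~δ r f′)) q

    -- A cut through `e` also meets the walk, so a competitor `Z` keeps an edge in `D′` and agrees
    -- with `X` off `e` by minimality there. Then `X xor Z` is constant along the walk, which yields
    -- agreement on `e`.
    ~dibond⁻ : ∀ {X X′} → X ~ X′ → C′.Dibond X′ → C.Dibond X
    ~dibond⁻ {X} {X′} r (C′.dibond ((f , p) , min) dir) = C.dibond ((ψ f , trans (~δ r f) p) , min′) (directed dir)
      where
      directed : C′.Directed X′ → C.Directed X
      directed (inj₁ c) = inj₁ (~closed⁻ r c)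
      directed (inj₂ c) = inj₂ (~closed⁻ (~not r) c)
      min′ : ∀ Z → C.Crossed Z → Z C.⊑ X → X C.⊑ Z
      min′ Z cr sub g q = trans (sym (same g)) q
        where
        s = lower Z
        sup : ∀ f → C.δ X (ψ f) ≡ true → C.δ Z (ψ f) ≡ true
        sup f x = trans (~δ s f) (min (λ w → Z (proj₁ (φ-surj w))) (crossed s cr)
          (λ f₁ z → trans (sym (~δ r f₁)) (sub (ψ f₁) (trans (~δ s f₁) z))) f (trans (sym (~δ r f)) x))
        off : ∀ f → f ≢ e → C.δ X f ≡ C.δ Z f
        off f n with ψ-onto f n
        ... | f′ , refl = iff⇒≡ (sup f′) (sub (ψ f′))
        same : ∀ f → C.δ X f ≡ C.δ Z f
        same f with f ≟ e
        ... | no n = off f n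
        ... | yes refl = ==⇒≡ (taut 4 (λ a b c d → ((a xor b) == (c xor d)) ⇒ ((a xor c) == (b xor d))) refl
                 (X (tail D e)) (Z (tail D e)) (X (head D e)) (Z (head D e))
                 ∙ ≡⇒== (walk-constant (λ v → X v xor Z v)
                     (λ f n → trans (C.δ-xor X Z f) (≡⇒xor≡f (off f n))) walk))

    -- Bonds alone need not survive: a cut lying below `X` off `e` could contain `e` although `X`
    -- does not. Directedness prevents this, since a walk with both ends on one side of a directed
    -- cut never crosses it.
    ~dibond : ∀ {X X′} → X ~ X′ → C.Dibond X → C′.Dibond X′
    ~dibond {X} {X′} r (C.dibond (cr , min) dir) = C′.dibond (crossed r cr , min′) (directed dir)
      where
      directed : C.Directed X → C′.Directed X′
      directed (inj₁ c) = inj₁ (~closed r c)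
      directed (inj₂ c) = inj₂ (~closed (~not r) c)
      min′ : ∀ Z′ → C′.Crossed Z′ → Z′ C′.⊑ X′ → X′ C′.⊑ Z′
      min′ Z′ (f , p) sub f₁ q =
        trans (sym (~δ s f₁)) (min Z (ψ f , trans (~δ s f) p) sub′ (ψ f₁) (trans (~δ r f₁) q))
        where
        Z = Z′ ∘ φ
        s = lift Z′
        off : ∀ f → f ≢ e → C.δ Z f ≡ true → C.δ X f ≡ true
        off f n z with ψ-onto f n
        ... | f′ , refl = trans (~δ r f′) (sub f′ (trans (sym (~δ s f′)) z))
        off-false : ∀ f → f ≢ e → C.δ X f ≡ false → C.δ Z f ≡ false
        off-false f n x = ≢true⇒≡f (λ z → true≢false (off f n z) x)
        same-side : C.Directed X → C.δ X e ≡ false → C.δ Z e ≡ false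
        same-side (inj₁ c) x = ≡⇒xor≡f (walk-same-side X Z c off-false walk (xor≡f⇒≡ x))
        same-side (inj₂ c) x = ≡⇒xor≡f
          (walk-same-side (not ∘ X) Z c (λ f n y → off-false f n (trans (sym (C.δ-not X f)) y)) walk
            (cong not (xor≡f⇒≡ x)))
        sub′ : Z C.⊑ X
        sub′ g z with g ≟ e
        ... | no n = off g n z
        ... | yes refl with bool-cases (C.δ X e)
        ...   | inj₁ x = x
        ...   | inj₂ x = ⊥-elim (true≢false z (same-side dir x))

  -- If e ∈ J, replace it in J by the edges of the walk that makes e deletable.
  delete-dijoin : ∃ C.OddDijoin → ∃ C′.OddDijoin
  delete-dijoin (J , odd) with walk-edges walk
  ... | P , avoids , sums = K ∘ ψ , λ X′ d →
      trans (~⟨⟩ (lift X′) K Ke) (trans (K-sums (X′ ∘ φ)) (odd (X′ ∘ φ) (~dibond⁻ (lift X′) d)))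
    where
    Q K : C.ES
    Q g = J e ∧ (P g xor ⟪ e ⟫ g)
    K g = J g xor Q g
    Ke : K e ≡ false
    Ke rewrite avoids | ∈⟪⟫ {z = e} refl = ==⇒≡ (taut 1 (λ a → (a xor (a ∧ true)) == false) refl (J e))
    Q-sums : ∀ X → C.⟨ Q , X ⟩ ≡ false
    Q-sums X = begin
      sum (λ g → (J e ∧ (P g xor ⟪ e ⟫ g)) ∧ C.δ X g)
        ≡⟨ sum-cong-≗ (λ g → Boolₚ.∧-assoc (J e) (P g xor ⟪ e ⟫ g) (C.δ X g)) ⟩
      sum (λ g → J e ∧ ((P g xor ⟪ e ⟫ g) ∧ C.δ X g))
        ≡⟨ sym (*-distribˡ-sum (J e) (λ g → (P g xor ⟪ e ⟫ g) ∧ C.δ X g)) ⟩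
      J e ∧ C.⟨ (λ g → P g xor ⟪ e ⟫ g) , X ⟩
        ≡⟨ cong (J e ∧_) (trans (C.⟨⟩-xorJ P ⟪ e ⟫ X) (≡⇒xor≡f (trans (sums X) (sym (sum-⟪⟫ e (C.δ X)))))) ⟩
      J e ∧ false
        ≡⟨ Boolₚ.∧-zeroʳ (J e) ⟩
      false ∎
      where open ≡-Reasoning
    K-sums : ∀ X → C.⟨ K , X ⟩ ≡ C.⟨ J , X ⟩
    K-sums X = trans (C.⟨⟩-xorJ J Q X) (trans (cong (C.⟨ J , X ⟩ xor_) (Q-sums X)) (Boolₚ.xor-identityʳ _))

  undelete-dijoin : ∃ C′.OddDijoin → ∃ C.OddDijoin
  undelete-dijoin (J′ , odd) = extend ψ J′ , λ X d →
    trans (sym (~⟨⟩ (lower X) (extend ψ J′) (extend-missed ψ J′ ψ-avoid)))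
      (trans (C′.⟨⟩-congJ (λ w → X (proj₁ (φ-surj w))) (extend-ψ ψ ψ-inj J′)) (odd _ (~dibond (lower X) d)))

minor-dijoin : ∀ {D D′} → CutMinor D D′ → ∃ (Cuts.OddDijoin D) → ∃ (Cuts.OddDijoin D′)
minor-dijoin done                 = λ o → o
minor-dijoin (contract c m)       = minor-dijoin m ∘ contract-dijoin c
minor-dijoin (delete d m)         = minor-dijoin m ∘ delete-dijoin d
minor-dijoin (deleteIsolated i m) = minor-dijoin m ∘ isolated-dijoin i

-- Odd diamonds and odd one-directions

another : ∀ {n} (A : Subset n) → 2 ≤ ∣ A ∣ → ∀ a → ∃ λ b → b ∈ A × b ≢ a
another A 2≤ a with Finₚ.any? (λ b → (b ∈? A) ×-dec ¬? (b ≟ a))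
... | yes p = p
... | no p  = ⊥-elim (ℕₚ.<⇒≱ 2≤ (ℕₚ.≤-trans (p⊆q⇒∣p∣≤∣q∣ sub) (ℕₚ.≤-reflexive (∣⁅x⁆∣≡1 a))))
  where
  sub : ∀ {b} → b ∈ A → b ∈ ⁅ a ⁆
  sub {b} b∈ with b ≟ a
  ... | yes refl = x∈⁅x⁆ a
  ... | no q     = ⊥-elim (p (b , b∈ , q))

module _ (D : Digraph) where
  open Cuts D

  oddly-many-pure : ∃ OddDijoin → (∀ z → Dibond ⟪ z ⟫) → ¬ Odd (V D)
  oddly-many-pure (J , odd) pure o = true≢false
    (trans (⟨⟩-odd-vertices J (λ _ → true) (λ z _ → odd ⟪ z ⟫ (pure z))) (trans (sum-true (V D)) (Odd⇒parity (V D) o)))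
    (⟨⟩-full J)

  -- A cut below the star of `z` is constant off `z`, so it contains all of the star or none of it.
  star-bond : ∀ z → Crossed ⟪ z ⟫ →
              (∀ Z → Z ⊑ ⟪ z ⟫ → ∀ x y → x ≢ z → y ≢ z → Z x ≡ Z y) → Bond ⟪ z ⟫
  star-bond z cr conn = cr , min
    where
    split : ∀ Z e → δ ⟪ z ⟫ e ≡ true →
            (∃ λ y → y ≢ z × δ Z e ≡ Z z xor Z y)
    split Z e p with z ≟ tail D e | z ≟ head D e
    split Z e () | yes p | yes q
    ... | yes refl | no q     = head D e , q ∘ sym , refl
    ... | no q     | yes refl = tail D e , q ∘ sym , Boolₚ.xor-comm (Z (tail D e)) _
    split Z e () | no p | no q
    min : ∀ Z → Crossed Z → Z ⊑ ⟪ z ⟫ → ⟪ z ⟫ ⊑ Z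
    min Z (f , q) sub e p with split Z f (sub f q) | split Z e p
    ... | y , ny , ey | x , nx , ex =
      trans ex (trans (cong (Z z xor_) (conn Z sub x y nx ny)) (trans (sym ey) q))

  source⇒closed : ∀ z → (∀ e → head D e ≢ z) → Closed ⟪ z ⟫
  source⇒closed z s e p = ⊥-elim (s e (sym (⟪⟫⇒≡ p)))

  sink⇒closed : ∀ z → (∀ e → tail D e ≢ z) → Closed (not ∘ ⟪ z ⟫)
  sink⇒closed z s e p = ≡f⇒not (∉⟪⟫ (s e ∘ sym))

  uncrossed : ∀ {z} Z → Z ⊑ ⟪ z ⟫ → ∀ e → tail D e ≢ z → head D e ≢ z → Z (tail D e) ≡ Z (head D e)
  uncrossed {z} Z sub e p q = xor≡f⇒≡ (≢true⇒≡f λ c → true≢false (sub e c) (cong₂ _xor_ (∉⟪⟫ (p ∘ sym)) (∉⟪⟫ (q ∘ sym))))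

  -- Two vertices in each part leave some `a` in `A` and `b` outside `A` when `z` is removed. These
  -- two are adjacent, and every other vertex is adjacent to one of them.
  one-direction-pure : IsOneDirection D → ∀ z → Dibond ⟪ z ⟫
  one-direction-pure (A , 2≤A , 2≤B , oriented , complete , _) z = helper (z ∈? A)
    where
    B≢ : ∀ {b} → b ∈ ∁ A → b ∉ A
    B≢ = x∈∁p⇒x∉p
    join : ∀ Z → Z ⊑ ⟪ z ⟫ → ∀ a b → a ∈ A → b ∉ A → a ≢ z → b ≢ z → Z a ≡ Z b
    join Z sub a b a∈ b∉ a≢ b≢ with complete a b a∈ b∉
    ... | e , refl , refl = uncrossed Z sub e a≢ b≢
    conn : ∀ Z → Z ⊑ ⟪ z ⟫ → ∀ x y → x ≢ z → y ≢ z → Z x ≡ Z y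
    conn Z sub x y x≢ y≢ with another A 2≤A z | another (∁ A) 2≤B z
    ... | a , a∈ , a≢ | b , b∈ , b≢ = trans (toA x x≢) (sym (toA y y≢))
      where
      toA : ∀ x → x ≢ z → Z x ≡ Z a
      toA x x≢ with x ∈? A
      ... | yes x∈ = trans (join Z sub x b x∈ (B≢ b∈) x≢ b≢) (sym (join Z sub a b a∈ (B≢ b∈) a≢ b≢))
      ... | no x∉  = sym (join Z sub a x a∈ x∉ a≢ x≢)
    helper : Dec (z ∈ A) → Dibond ⟪ z ⟫
    helper (yes z∈) with another (∁ A) 2≤B z
    ... | b , b∈ , b≢ with complete z b z∈ (B≢ b∈)
    ...   | e , refl , refl = dibond (star-bond z (e , cong₂ _xor_ (∈⟪⟫ {z = z} refl) (∉⟪⟫ (b≢ ∘ sym))) conn)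
        (inj₁ (source⇒closed z (λ f p → proj₂ (oriented f) (subst (_∈ A) (sym p) z∈))))
    helper (no z∉) with another A 2≤A z
    ... | a , a∈ , a≢ with complete a z a∈ z∉
    ...   | e , refl , refl = dibond (star-bond z (e , cong₂ _xor_ (∉⟪⟫ (a≢ ∘ sym)) (∈⟪⟫ {z = z} refl)) conn)
        (inj₂ (sink⇒closed z (λ f p → z∉ (subst (_∈ A) p (proj₁ (oriented f))))))

  odd-one-direction : IsOddOneDirection D → ¬ ∃ OddDijoin
  odd-one-direction (od , o) J = oddly-many-pure J (one-direction-pure od) o

  module Diamond (h₁ h₂ : Fin (V D)) (h₁≢h₂ : h₁ ≢ h₂) (5≤ : 5 ≤ V D)
    (rim : ∀ x → x ≢ h₁ → x ≢ h₂ → OutVertex D h₁ h₂ x ⊎ InVertex D h₁ h₂ x)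
    (hubs : ∀ f → ¬ ((tail D f ≡ h₁ ⊎ tail D f ≡ h₂) × (head D f ≡ h₁ ⊎ head D f ≡ h₂))) where

    Hub : Fin (V D) → Set
    Hub x = x ≡ h₁ ⊎ x ≡ h₂

    Hub? : ∀ x → Dec (Hub x)
    Hub? x = (x ≟ h₁) ⊎-dec (x ≟ h₂)

    Spoke : Fin (V D) → Fin (V D) → Set
    Spoke x h = ∃ λ e → (tail D e ≡ x × head D e ≡ h) ⊎ (tail D e ≡ h × head D e ≡ x)

    rim′ : ∀ x → ¬ Hub x → OutVertex D h₁ h₂ x ⊎ InVertex D h₁ h₂ x
    rim′ x nh = rim x (nh ∘ inj₁) (nh ∘ inj₂)

    spoke : ∀ x → ¬ Hub x → Spoke x h₁ × Spoke x h₂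
    spoke x nh with rim′ x nh
    ... | inj₁ (e₁ , e₂ , p , q , r , s , _) = (e₁ , inj₁ (p , q)) , (e₂ , inj₁ (r , s))
    ... | inj₂ (e₁ , e₂ , p , q , r , s , _) = (e₁ , inj₂ (p , q)) , (e₂ , inj₂ (r , s))

    -- Otherwise all vertices would be among `h₁`, `h₂` and `z`. For a rim vertex `z` this supplies
    -- another one, through which the hubs stay joined once `z` is removed.
    third : ∀ z → ∃ λ x → ¬ Hub x × x ≢ z
    third z with Finₚ.any? (λ x → ¬? (Hub? x) ×-dec ¬? (x ≟ z))
    ... | yes p = p
    ... | no p  = ⊥-elim (ℕₚ.<⇒≱ 5≤ (ℕₚ.m≤n⇒m≤1+n (Finₚ.injective⇒≤ {f = code} code-inj)))
      where
      Case : Fin (V D) → Set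
      Case x = x ≡ h₁ ⊎ x ≡ h₂ ⊎ x ≡ z
      cases : ∀ x → Case x
      cases x with x ≟ h₁ | x ≟ h₂ | x ≟ z
      ... | yes q | _ | _ = inj₁ q
      ... | no _ | yes q | _ = inj₂ (inj₁ q)
      ... | no _ | no _ | yes q = inj₂ (inj₂ q)
      ... | no q | no r | no s = ⊥-elim (p (x , [ q , r ] , s))
      index : ∀ {x} → Case x → Fin 3
      index (inj₁ _) = zero
      index (inj₂ (inj₁ _)) = suc zero
      index (inj₂ (inj₂ _)) = suc (suc zero)
      code : Fin (V D) → Fin 3
      code x = index (cases x)
      index-inj : ∀ {x y} (a : Case x) (b : Case y) → index a ≡ index b → x ≡ y
      index-inj (inj₁ a) (inj₁ b) _ = trans a (sym b)
      index-inj (inj₂ (inj₁ a)) (inj₂ (inj₁ b)) _ = trans a (sym b)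
      index-inj (inj₂ (inj₂ a)) (inj₂ (inj₂ b)) _ = trans a (sym b)
      index-inj (inj₁ a) (inj₂ (inj₁ b)) ()
      index-inj (inj₁ a) (inj₂ (inj₂ b)) ()
      index-inj (inj₂ (inj₁ a)) (inj₁ b) ()
      index-inj (inj₂ (inj₁ a)) (inj₂ (inj₂ b)) ()
      index-inj (inj₂ (inj₂ a)) (inj₁ b) ()
      index-inj (inj₂ (inj₂ a)) (inj₂ (inj₁ b)) ()
      code-inj : ∀ {x y} → code x ≡ code y → x ≡ y
      code-inj {x} {y} = index-inj (cases x) (cases y)

    spoke-uncrossed : ∀ {z} Z → Z ⊑ ⟪ z ⟫ → ∀ {x h} → Spoke x h → x ≢ z → h ≢ z → Z x ≡ Z h
    spoke-uncrossed Z sub (e , inj₁ (refl , refl)) p q = uncrossed Z sub e p q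
    spoke-uncrossed Z sub (e , inj₂ (refl , refl)) p q = sym (uncrossed Z sub e q p)

    spoke-crossed : ∀ {x h} → ¬ Hub x → Hub h → Spoke x h → Crossed ⟪ x ⟫
    spoke-crossed nx hub (e , inj₁ (refl , refl)) = e , cong₂ _xor_ (∈⟪⟫ {z = tail D e} refl) (∉⟪⟫ (λ p → nx (subst Hub (sym p) hub)))
    spoke-crossed nx hub (e , inj₂ (refl , refl)) = e , cong₂ _xor_ (∉⟪⟫ (λ p → nx (subst Hub (sym p) hub))) (∈⟪⟫ {z = head D e} refl)

    rim-pure : ∀ x → ¬ Hub x → Dibond ⟪ x ⟫
    rim-pure z nz = dibond (star-bond z (spoke-crossed nz (inj₁ refl) (proj₁ (spoke z nz))) conn) (dir (rim′ z nz))
      where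
      h₁≢ : h₁ ≢ z
      h₁≢ p = nz (inj₁ (sym p))
      h₂≢ : h₂ ≢ z
      h₂≢ p = nz (inj₂ (sym p))
      conn : ∀ Z → Z ⊑ ⟪ z ⟫ → ∀ x y → x ≢ z → y ≢ z → Z x ≡ Z y
      conn Z sub x y x≢ y≢ = trans (to-h₁ x x≢) (sym (to-h₁ y y≢))
        where
        to-h₁ : ∀ x → x ≢ z → Z x ≡ Z h₁
        to-h₁ x x≢ with Hub? x
        ... | no nx = spoke-uncrossed Z sub (proj₁ (spoke x nx)) x≢ h₁≢
        ... | yes (inj₁ refl) = refl
        ... | yes (inj₂ refl) with third z
        ...   | w , nw , w≢ = trans (sym (spoke-uncrossed Z sub (proj₂ (spoke w nw)) w≢ h₂≢))
                                    (spoke-uncrossed Z sub (proj₁ (spoke w nw)) w≢ h₁≢)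
      dir : OutVertex D h₁ h₂ z ⊎ InVertex D h₁ h₂ z → Directed ⟪ z ⟫
      dir (inj₁ (e₁ , e₂ , _ , q , _ , s , only)) = inj₁ (source⇒closed z no-in)
        where
        no-in : ∀ e → head D e ≢ z
        no-in e p with only e (inj₂ p)
        ... | inj₁ refl = h₁≢ (trans (sym q) p)
        ... | inj₂ refl = h₂≢ (trans (sym s) p)
      dir (inj₂ (e₁ , e₂ , q , _ , s , _ , only)) = inj₂ (sink⇒closed z no-out)
        where
        no-out : ∀ e → tail D e ≢ z
        no-out e p with only e (inj₁ p)
        ... | inj₁ refl = h₁≢ (trans (sym q) p)
        ... | inj₂ refl = h₂≢ (trans (sym s) p)

    abstract
      out : VS
      out x with Hub? x
      ... | yes _ = false
      ... | no nh with rim′ x nh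
      ...   | inj₁ _ = true
      ...   | inj₂ _ = false

      out-vertex : ∀ x → out x ≡ true → OutVertex D h₁ h₂ x × ¬ Hub x
      out-vertex x p with Hub? x
      ... | yes _ = ⊥-elim (true≢false p refl)
      ... | no nh with rim′ x nh
      ...   | inj₁ o = o , nh
      ...   | inj₂ _ = ⊥-elim (true≢false p refl)

      hub-out : ∀ x → Hub x → out x ≡ false
      hub-out x hx with Hub? x
      ... | yes _ = refl
      ... | no nh = ⊥-elim (nh hx)

      in-vertex : ∀ x → ¬ Hub x → out x ≡ false → InVertex D h₁ h₂ x
      in-vertex x nh p with Hub? x
      ... | yes hx = ⊥-elim (nh hx)
      ... | no nh′ with rim′ x nh′
      ...   | inj₂ i = i
      ...   | inj₁ _ = ⊥-elim (true≢false refl p)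

    out-no-in : ∀ {x} → OutVertex D h₁ h₂ x → ¬ Hub x → ∀ e → head D e ≢ x
    out-no-in (e₁ , e₂ , _ , q , _ , s , only) nh e p with only e (inj₂ p)
    ... | inj₁ refl = nh (inj₁ (trans (sym p) q))
    ... | inj₂ refl = nh (inj₂ (trans (sym p) s))

    in-no-out : ∀ {x} → InVertex D h₁ h₂ x → ¬ Hub x → ∀ e → tail D e ≢ x
    in-no-out (e₁ , e₂ , q , _ , s , _ , only) nh e p with only e (inj₁ p)
    ... | inj₁ refl = nh (inj₁ (trans (sym p) q))
    ... | inj₂ refl = nh (inj₂ (trans (sym p) s))

    module Side (h : Fin (V D)) (k : Fin (V D)) (h≢k : h ≢ k) (hub-h : Hub h) (hub-k : Hub k)
      (two : ∀ x → Hub x → x ≡ h ⊎ x ≡ k) (to-h : ∀ x → ¬ Hub x → Spoke x h) (to-k : ∀ x → ¬ Hub x → Spoke x k) where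

      side : VS
      side x = ⟪ h ⟫ x xor out x

      side-h : side h ≡ true
      side-h = cong₂ _xor_ (∈⟪⟫ {z = h} refl) (hub-out h hub-h)

      side-k : side k ≡ false
      side-k = cong₂ _xor_ (∉⟪⟫ h≢k) (hub-out k hub-k)

      side-rim : ∀ x → ¬ Hub x → side x ≡ out x
      side-rim x nh = cong (_xor out x) (∉⟪⟫ (λ p → nh (subst Hub p hub-h)))

      side-closed : Closed side
      side-closed e p with Hub? (head D e)
      ... | no nh = ⊥-elim (out-no-in (proj₁ o) nh e refl)
        where o = out-vertex (head D e) (trans (sym (side-rim _ nh)) p)
      ... | yes hh with two _ hh
      ...   | inj₂ q = ⊥-elim (true≢false p (trans (cong side q) side-k))
      ...   | inj₁ q with Hub? (tail D e)
      ...     | yes th = ⊥-elim (hubs e (th , hh))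
      ...     | no nt with bool-cases (out (tail D e))
      ...       | inj₁ o = trans (side-rim _ nt) o
      ...       | inj₂ i = ⊥-elim (in-no-out (in-vertex _ nt i) nt e refl)

      same-side : ∀ Z → Z ⊑ side → ∀ {x l} → Spoke x l → side x ≡ side l → Z x ≡ Z l
      same-side Z sub (e , inj₁ (refl , refl)) p = xor≡f⇒≡ (≢true⇒≡f λ c → true≢false (sub e c) (≡⇒xor≡f p))
      same-side Z sub (e , inj₂ (refl , refl)) p = sym (xor≡f⇒≡ (≢true⇒≡f λ c → true≢false (sub e c) (≡⇒xor≡f (sym p))))

      crosses : ∀ {x l} → Spoke x l → side x xor side l ≡ true → Crossed side
      crosses (e , inj₁ (refl , refl)) p = e , p
      crosses (e , inj₂ (refl , refl)) p = e , trans (Boolₚ.xor-comm (side (tail D e)) _) p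

      side-crossed : Crossed side
      side-crossed with third h
      ... | x , nx , _ with bool-cases (out x)
      ...   | inj₁ o = crosses (to-k x nx) (cong₂ _xor_ (trans (side-rim x nx) o) side-k)
      ...   | inj₂ i = crosses (to-h x nx) (cong₂ _xor_ (trans (side-rim x nx) i) side-h)

      -- Each rim vertex is joined to the hub on its own side, so a cut below `side` takes only the
      -- values `Z h` and `Z k`; once it is crossed these differ, and it is the whole cut.
      side-dibond : Dibond side
      side-dibond = dibond (side-crossed , min) (inj₁ side-closed)
        where
        min : ∀ Z → Crossed Z → Z ⊑ side → side ⊑ Z
        min Z (f , cf) sub e ce = helper (side-value (tail D f)) (side-value (head D f)) (side-value (tail D e)) (side-value (head D e))
          where
          value : Bool → Bool
          value true  = Z h
          value false = Z k
          side-value : ∀ x → Z x ≡ value (side x)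
          side-value x with Hub? x
          ... | yes hx with two x hx
          ...   | inj₁ refl = cong value (sym side-h)
          ...   | inj₂ refl = cong value (sym side-k)
          side-value x | no nx with bool-cases (out x)
          ...   | inj₁ o = trans (same-side Z sub (to-h x nx) (trans sx (sym side-h))) (cong value (sym sx))
            where sx = trans (side-rim x nx) o
          ...   | inj₂ i = trans (same-side Z sub (to-k x nx) (trans sx (sym side-k))) (cong value (sym sx))
            where sx = trans (side-rim x nx) i
          differ : ∀ a b → value a xor value b ≡ true → Z h xor Z k ≡ true
          differ true  true  p = ⊥-elim (true≢false p (Boolₚ.xor-same (Z h)))
          differ true  false p = p
          differ false true  p = trans (Boolₚ.xor-comm (Z h) (Z k)) p
          differ false false p = ⊥-elim (true≢false p (Boolₚ.xor-same (Z k)))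
          differ⁻ : ∀ a b → a xor b ≡ true → Z h xor Z k ≡ true → value a xor value b ≡ true
          differ⁻ true  false _ p = p
          differ⁻ false true  _ p = trans (Boolₚ.xor-comm (Z k) (Z h)) p
          helper : _ → _ → _ → _ → δ Z e ≡ true
          helper a b c d = trans (cong₂ _xor_ c d) (differ⁻ (side (tail D e)) (side (head D e)) ce
            (differ (side (tail D f)) (side (head D f)) (trans (sym (cong₂ _xor_ a b)) cf)))

    two₁ : ∀ x → Hub x → x ≡ h₁ ⊎ x ≡ h₂
    two₁ x p = p
    two₂ : ∀ x → Hub x → x ≡ h₂ ⊎ x ≡ h₁
    two₂ x (inj₁ p) = inj₂ p
    two₂ x (inj₂ p) = inj₁ p
    module S₁ = Side h₁ h₂ h₁≢h₂ (inj₁ refl) (inj₂ refl) two₁ (λ x n → proj₁ (spoke x n)) (λ x n → proj₂ (spoke x n))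
    module S₂ = Side h₂ h₁ (h₁≢h₂ ∘ sym) (inj₂ refl) (inj₁ refl) two₂ (λ x n → proj₂ (spoke x n)) (λ x n → proj₁ (spoke x n))

    -- The two sides differ exactly in the hubs, so the rim has even weight in any odd dijoin.
    no-dijoin : Odd (V D) → ¬ ∃ OddDijoin
    no-dijoin o (J , odd) = true≢false rim-odd rim-even
      where
      R : VS
      R x = true xor (S₁.side x xor S₂.side x)
      R-rim : ∀ x → R x ≡ true → ¬ Hub x
      R-rim x r (inj₁ refl) = true≢false r (cong₂ (λ a b → true xor (a xor b)) S₁.side-h S₂.side-k)
      R-rim x r (inj₂ refl) = true≢false r (cong₂ (λ a b → true xor (a xor b)) S₁.side-k S₂.side-h)
      rim-even : ⟨ J , R ⟩ ≡ false
      rim-even = trans (⟨⟩-xor J (λ _ → true) (λ x → S₁.side x xor S₂.side x)) (cong₂ _xor_ (⟨⟩-full J)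
        (trans (⟨⟩-xor J S₁.side S₂.side) (cong₂ _xor_ (odd _ S₁.side-dibond) (odd _ S₂.side-dibond))))
      sum-R : sum R ≡ true
      sum-R = begin
        sum R ≡⟨ sum-cong-≗ (λ x → ==⇒≡ (taut 3 (λ a b c → (true xor ((a xor c) xor (b xor c))) == (true xor (a xor b))) refl (⟪ h₁ ⟫ x) (⟪ h₂ ⟫ x) (out x))) ⟩
        sum (λ x → true xor (⟪ h₁ ⟫ x xor ⟪ h₂ ⟫ x))
          ≡⟨ ∑-distrib-+ (λ _ → true) (λ x → ⟪ h₁ ⟫ x xor ⟪ h₂ ⟫ x) ⟩
        sum {V D} (λ _ → true) xor sum (λ x → ⟪ h₁ ⟫ x xor ⟪ h₂ ⟫ x)
          ≡⟨ cong₂ _xor_ (trans (sum-true (V D)) (Odd⇒parity (V D) o)) (trans (∑-distrib-+ ⟪ h₁ ⟫ ⟪ h₂ ⟫) (cong₂ _xor_ (sum-single h₁) (sum-single h₂))) ⟩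
        true ∎
        where
        open ≡-Reasoning
      rim-odd : ⟨ J , R ⟩ ≡ true
      rim-odd = trans (⟨⟩-odd-vertices J R (λ z r → odd _ (rim-pure z (R-rim z r)))) sum-R

  odd-diamond : IsOddDiamond D → ¬ ∃ OddDijoin
  odd-diamond ((h₁ , h₂ , h₁≢h₂ , 5≤ , rim , hubs) , o) = Diamond.no-dijoin h₁ h₂ h₁≢h₂ 5≤ rim hubs o

-- Critical digraphs

size : ∀ {n} → VSet n → ℕ
size X = ∣ tabulate X ∣

size-< : ∀ {n} {X Y : VSet n} → (∀ v → X v ≡ true → Y v ≡ true) →
         ∀ v → Y v ≡ true → X v ≡ false → size X < size Y
size-< {X = X} {Y} sub v y x = p⊂q⇒∣p∣<∣q∣ {p = tabulate X} {tabulate Y}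
  ((λ {w} p → lookup⇒[]= w _ (trans (lookup∘tabulate Y w) (sub w (trans (sym (lookup∘tabulate X w)) ([]=⇒lookup p))))) ,
   v , lookup⇒[]= v _ (trans (lookup∘tabulate Y v) y) ,
   λ p → true≢false (trans (sym (lookup∘tabulate X v)) ([]=⇒lookup p)) x)

bool-≡ : ∀ {a b} → (a ≡ true → b ≡ false → ⊥) → (b ≡ true → a ≡ false → ⊥) → a ≡ b
bool-≡ {true}  {true}  _ _ = refl
bool-≡ {true}  {false} f _ = ⊥-elim (f refl refl)
bool-≡ {false} {true}  _ g = ⊥-elim (g refl refl)
bool-≡ {false} {false} _ _ = refl

-- Directed cuts as disjoint unions of dibonds.

module Decomposition (D : Digraph) where
  open Cuts D
  private
    t = tail D
    h = head D

  _⊓_ : VS → VS → VS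
  (X ⊓ Z) v = X v ∧ Z v

  Directed-⊓ : ∀ X Z → Directed X → Z ⊑ X → Directed (X ⊓ Z)
  Directed-⊓ X Z (inj₁ c) sub = inj₁ λ e p →
    taut 4 (λ a b c d → (b ⇒ a) ⇒ ((c xor d) ⇒ (a xor b)) ⇒ (b ∧ d) ⇒ (a ∧ c)) refl (X (t e)) (X (h e)) (Z (t e)) (Z (h e))
      ∙ ⇒-intro (c e) ∙ ⇒-intro (sub e) ∙ p
  Directed-⊓ X Z (inj₂ c) sub = inj₂ λ e p →
    taut 4 (λ a b c d → (not b ⇒ not a) ⇒ ((c xor d) ⇒ (a xor b)) ⇒ not (b ∧ d) ⇒ not (a ∧ c)) refl (X (t e)) (X (h e)) (Z (t e)) (Z (h e))
      ∙ ⇒-intro (c e) ∙ ⇒-intro (sub e) ∙ p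

  -- A decomposition is remembered only through its effect on edge sets `J`. The second component is
  -- separate because the first says nothing about `b` when no such `J` exists.
  Value : VS → Bool → Set
  Value X b = (∀ J → (∀ Z → Dibond Z → Z ⊑ X → ⟨ J , Z ⟩ ≡ true) → ⟨ J , X ⟩ ≡ b) × (Bond X → b ≡ true)

  private
    module _ (X Z : VS) (e : Fin (E D)) where
      split-taut : ∀ (f : Formula 4) → valid 4 f ≡ true → f (X (t e)) (X (h e)) (Z (t e)) (Z (h e)) ≡ true
      split-taut f p = taut 4 f p (X (t e)) (X (h e)) (Z (t e)) (Z (h e))

  -- A directed cut is a disjoint union of dibonds; the value is the parity of their number.
  decompose : ∀ k X → size (δ X) < k → Directed X → ∃ (Value X)
  decompose (suc k) X (s≤s le) dir with Crossed? X
  ... | no n = false , (λ J _ → ⟨⟩-uncrossed J {X} (λ e → ≢true⇒≡f (λ p → n (e , p)))) , (λ b → ⊥-elim (n (proj₁ b)))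
  ... | yes cr with ∃set? {P = λ Z → Crossed Z × Z ⊑ X × (∃ λ e → δ X e ≡ true × δ Z e ≡ false)}
                     (λ { {Z} {Z′} p ((e , a) , sub , f , x , z) →
                          (e , trans (sym (δ-cong p e)) a) , (λ g q → sub g (trans (δ-cong p g) q)) ,
                          f , x , trans (sym (δ-cong p f)) z })
                     (λ Z → Crossed? Z ×-dec (Z ⊑? X) ×-dec Finₚ.any? (λ e → (δ X e Boolₚ.≟ true) ×-dec (δ Z e Boolₚ.≟ false)))
  ...   | no n = true , (λ J odd → odd X (dibond bondX dir) (λ _ p → p)) , (λ _ → refl)
    where
    bondX : Bond X
    bondX = cr , λ Z crZ sub e x → decidable-stable (δ Z e Boolₚ.≟ true)
      (λ z → n (Z , crZ , sub , e , x , ≢true⇒≡f z))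
  ...   | yes (Z , (eZ , crZ) , sub , e₀ , x₀ , z₀) = pieces (Crossed? X₁) (Crossed? X₂) (Crossed? Y₁) (Crossed? Y₂)
    where
    X₁ X₂ Y₁ Y₂ : VS
    X₁ = X ⊓ Z
    X₂ = X ⊓ (not ∘ Z)
    Y₁ = (not ∘ X) ⊓ Z
    Y₂ = (not ∘ X) ⊓ (not ∘ Z)
    subY : Z ⊑ (not ∘ X)
    subY e z = trans (δ-not X e) (sub e z)
    sub-not : ∀ X′ → Z ⊑ X′ → (not ∘ Z) ⊑ X′
    sub-not X′ s e z = s e (trans (sym (δ-not Z e)) z)
    combine : ∀ A B → Directed A → Directed B → Crossed A → Crossed B →
              (∀ e → δ X e ≡ δ A e xor δ B e) → (∀ e → δ A e ≡ true → δ B e ≡ true → ⊥) → ∃ (Value X)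
    combine A B dA dB (eA , crA) (eB , crB) sums disj =
      let bA , vA , _ = decompose k A (ℕₚ.<-≤-trans (size-< A⊑X eB (inX eB (inj₂ crB)) (≢true⇒≡f (λ p → disj eB p crB))) le) dA
          bB , vB , _ = decompose k B (ℕₚ.<-≤-trans (size-< B⊑X eA (inX eA (inj₁ crA)) (≢true⇒≡f (disj eA crA))) le) dB
      in bA xor bB ,
         (λ J odd → trans (⟨⟩-congδ J {X} {λ v → A v xor B v} (λ e → trans (sums e) (sym (δ-xor A B e))))
           (trans (⟨⟩-xor J A B) (cong₂ _xor_
             (vA J (λ Z′ d s → odd Z′ d (λ e p → A⊑X e (s e p))))
             (vB J (λ Z′ d s → odd Z′ d (λ e p → B⊑X e (s e p))))))) ,
         λ b → ⊥-elim (disj eB (proj₂ b A (eA , crA) A⊑X eB (inX eB (inj₂ crB))) crB)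
      where
      inX : ∀ e → δ A e ≡ true ⊎ δ B e ≡ true → δ X e ≡ true
      inX e (inj₁ a) = trans (sums e) (cong₂ _xor_ a (≢true⇒≡f (disj e a)))
      inX e (inj₂ b) = trans (sums e) (cong₂ _xor_ (≢true⇒≡f (λ a → disj e a b)) b)
      A⊑X : A ⊑ X
      A⊑X e a = inX e (inj₁ a)
      B⊑X : B ⊑ X
      B⊑X e b = inX e (inj₂ b)
    none : ∀ {A} → ¬ Crossed A → ∀ e → not (δ A e) ≡ true
    none n e = ≡f⇒not (≢true⇒≡f (λ p → n (e , p)))
    -- `X₁`, `X₂` split the cut along `Z` within `X`, and `Y₁`, `Y₂` within the complement. If each
    -- splitting had an uncrossed piece, the two pieces together would make `Z` or `X xor Z`
    -- uncrossed, up to complement, against `eZ` or `e₀`.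
    pieces : Dec (Crossed X₁) → Dec (Crossed X₂) → Dec (Crossed Y₁) → Dec (Crossed Y₂) → ∃ (Value X)
    pieces (yes p) (yes q) _ _ = combine X₁ X₂ (Directed-⊓ X Z dir sub) (Directed-⊓ X (not ∘ Z) dir (sub-not X sub)) p q
      (λ e → ==⇒≡ (split-taut X Z e (λ a b c d → ((c xor d) ⇒ (a xor b)) ⇒ ((a xor b) == (((a ∧ c) xor (b ∧ d)) xor ((a ∧ not c) xor (b ∧ not d))))) refl ∙ ⇒-intro (sub e)))
      (λ e u v → true≢false (split-taut X Z e (λ a b c d → ((c xor d) ⇒ (a xor b)) ⇒ ((a ∧ c) xor (b ∧ d)) ⇒ ((a ∧ not c) xor (b ∧ not d)) ⇒ false) refl ∙ ⇒-intro (sub e) ∙ u ∙ v) refl)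
    pieces _ _ (yes p) (yes q) = combine Y₁ Y₂ (Directed-⊓ (not ∘ X) Z (Directed-not {X} dir) subY)
      (Directed-⊓ (not ∘ X) (not ∘ Z) (Directed-not {X} dir) (sub-not (not ∘ X) subY)) p q
      (λ e → ==⇒≡ (split-taut X Z e (λ a b c d → ((c xor d) ⇒ (a xor b)) ⇒ ((a xor b) == (((not a ∧ c) xor (not b ∧ d)) xor ((not a ∧ not c) xor (not b ∧ not d))))) refl ∙ ⇒-intro (sub e)))
      (λ e u v → true≢false (split-taut X Z e (λ a b c d → ((c xor d) ⇒ (a xor b)) ⇒ ((not a ∧ c) xor (not b ∧ d)) ⇒ ((not a ∧ not c) xor (not b ∧ not d)) ⇒ false) refl ∙ ⇒-intro (sub e) ∙ u ∙ v) refl)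
    pieces (no p) _ (no q) _ = ⊥-elim (true≢false (split-taut X Z eZ (λ a b c d → not ((a ∧ c) xor (b ∧ d)) ⇒ not ((not a ∧ c) xor (not b ∧ d)) ⇒ (a xor b) ⇒ (c xor d) ⇒ false) refl
      ∙ none {X₁} p eZ ∙ none {Y₁} q eZ ∙ sub eZ crZ ∙ crZ) refl)
    pieces (no p) _ _ (no q) = ⊥-elim (true≢false (split-taut X Z e₀ (λ a b c d → not ((a ∧ c) xor (b ∧ d)) ⇒ not ((not a ∧ not c) xor (not b ∧ not d)) ⇒ (a xor b) ⇒ not (c xor d) ⇒ false) refl
      ∙ none {X₁} p e₀ ∙ none {Y₂} q e₀ ∙ x₀ ∙ ≡f⇒not z₀) refl)
    pieces _ (no p) (no q) _ = ⊥-elim (true≢false (split-taut X Z e₀ (λ a b c d → not ((a ∧ not c) xor (b ∧ not d)) ⇒ not ((not a ∧ c) xor (not b ∧ d)) ⇒ (a xor b) ⇒ not (c xor d) ⇒ false) refl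
      ∙ none {X₂} p e₀ ∙ none {Y₁} q e₀ ∙ x₀ ∙ ≡f⇒not z₀) refl)
    pieces _ (no p) _ (no q) = ⊥-elim (true≢false (split-taut X Z eZ (λ a b c d → not ((a ∧ not c) xor (b ∧ not d)) ⇒ not ((not a ∧ not c) xor (not b ∧ not d)) ⇒ (a xor b) ⇒ (c xor d) ⇒ false) refl
      ∙ none {X₂} p eZ ∙ none {Y₂} q eZ ∙ sub eZ crZ ∙ crZ) refl)

  private
    value : ∀ (S : Subset (V D)) → Dec (Closed (lookup S)) → Bool
    value S (yes c) = proj₁ (decompose _ (lookup S) ℕₚ.≤-refl (inj₁ c))
    value S (no _)  = false

    value-spec : ∀ S d → Closed (lookup S) → Value (lookup S) (value S d)
    value-spec S (yes c) _ = proj₂ (decompose _ (lookup S) ℕₚ.≤-refl (inj₁ c))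
    value-spec S (no n)  c = ⊥-elim (n c)

  abstract
    -- Tabulating first makes the chosen decomposition the same for sets equal up to `≗`. Sets that
    -- are not closed receive the default `false`.
    F : VS → Bool
    F X = value (tabulate X) (Closed? (lookup (tabulate X)))

    F-cong : ∀ {X Y} → X ≗ Y → F X ≡ F Y
    F-cong p = cong (λ S → value S (Closed? (lookup S))) (tabulate-cong p)

    F-spec : ∀ X → Closed X → Value X (F X)
    F-spec X c = (λ J odd → trans (⟨⟩-cong J (sym ∘ same)) (proj₁ spec J (λ Z d s → odd Z d (λ e z → trans (sym (δ-cong same e)) (s e z))))) ,
                 (λ b → proj₂ spec (Bond-congδ X X′ (λ e → sym (δ-cong same e)) b))
      where
      X′ : VS
      X′ = lookup (tabulate X)
      same : X′ ≗ X
      same = lookup∘tabulate X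
      spec : Value X′ (F X)
      spec = value-spec (tabulate X) (Closed? X′) (Closed-cong {X} (sym ∘ same) c)

Touched : Digraph → Set
Touched D = ∀ v → ∃ λ e → tail D e ≡ v ⊎ head D e ≡ v

-- What an odd dijoin of the contraction of `e` says about `D`: the dibonds avoiding `e` are those
-- that survive the contraction.
EdgeCritical : Digraph → Set
EdgeCritical D = ∀ e → ∃ λ J → ∀ X → Dibond X → δ X e ≡ false → ⟨ J , X ⟩ ≡ true
  where open Cuts D

module Critical (D : Digraph) (no-dijoin : ¬ ∃ (Cuts.OddDijoin D))
  (critical : EdgeCritical D) (touched : Touched D) where
  open Cuts D
  open Decomposition D
  private
    t = tail D
    h = head D

  in-some-dibond : ∀ e → ¬ (∀ X → Dibond X → δ X e ≡ false)
  in-some-dibond e none with critical e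
  ... | J , odd = no-dijoin (J , λ X d → odd X d (none X d))

  no-loop : ∀ e → t e ≢ h e
  no-loop e p = in-some-dibond e (λ X _ → ≡⇒xor≡f (cong X p))

  with-vertex : ¬ (Fin (V D) → ⊥)
  with-vertex k = no-dijoin ((λ _ → false) , λ X d → ⊥-elim (k (t (proj₁ (proj₁ (bond d))))))

  -- If every bond lies on one side of an edge partition, then odd dijoins for
  -- the two sides, taken from critical edges of the opposite sides, can be glued.
  inseparable : ∀ (P : ES) → (∀ X → ∃ λ X₁ → ∀ e → δ X₁ e ≡ δ X e ∧ P e) →
                ∀ e₁ e₂ → P e₁ ≡ true → P e₂ ≡ false → ⊥
  inseparable P part e₁ e₂ p₁ p₂ with critical e₁ | critical e₂
  ... | J₁ , odd₁ | J₂ , odd₂ = no-dijoin (J , odd)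
    where
    J : ES
    J e = (J₂ e ∧ P e) xor (J₁ e ∧ not (P e))
    odd : OddDijoin J
    odd X d with part X
    ... | X₁ , eq with Crossed? X₁
    ...   | yes cr = trans (sum-cong-≗ λ e → ==⇒≡ (taut 4 (λ j₁ j₂ p d → (d ⇒ p) ⇒ ((((j₂ ∧ p) xor (j₁ ∧ not p)) ∧ d) == (j₂ ∧ d))) refl (J₁ e) (J₂ e) (P e) (δ X e) ∙ ⇒-intro (inP e)))
                           (odd₂ X d (≢true⇒≡f (λ c → true≢false (inP e₂ c) p₂)))
      where
      inP : ∀ e → δ X e ≡ true → P e ≡ true
      inP e c = proj₂ (∧-true {δ X e} (trans (sym (eq e)) (proj₂ (bond d) X₁ cr (λ f q → proj₁ (∧-true (trans (sym (eq f)) q))) e c)))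
    ...   | no n = trans (sum-cong-≗ λ e → ==⇒≡ (taut 4 (λ j₁ j₂ p d → (d ⇒ not p) ⇒ ((((j₂ ∧ p) xor (j₁ ∧ not p)) ∧ d) == (j₁ ∧ d))) refl (J₁ e) (J₂ e) (P e) (δ X e) ∙ ⇒-intro (≡f⇒not ∘ outP e)))
                         (odd₁ X d (≢true⇒≡f (λ c → true≢false p₁ (outP e₁ c))))
      where
      outP : ∀ e → δ X e ≡ true → P e ≡ false
      outP e c = ≢true⇒≡f (λ p → n (e , trans (eq e) (cong₂ _∧_ c p)))

  -- Otherwise the edges inside `Z` and those outside form a partition as in `inseparable`, with
  -- `X ⊓ Z` cutting out the first class. Both classes are nonempty because every vertex is touched.
  connected : ∀ Z → (∀ e → δ Z e ≡ false) → ∀ x y → Z x ≡ Z y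
  connected Z unc x y = bool-≡ (apart x y) (apart y x)
    where
    touching : ∀ v → ∃ λ e → Z (t e) ≡ Z v
    touching v with touched v
    ... | e , inj₁ p = e , cong Z p
    ... | e , inj₂ p = e , trans (xor≡f⇒≡ (unc e)) (cong Z p)
    apart : ∀ x y → Z x ≡ true → Z y ≡ false → ⊥
    apart x y p q with touching x | touching y
    ... | e₁ , r₁ | e₂ , r₂ = inseparable (Z ∘ t)
      (λ X → X ⊓ Z , λ e → ==⇒≡ (taut 4 (λ a b c d → (c == d) ⇒ (((a ∧ c) xor (b ∧ d)) == ((a xor b) ∧ c))) refl (X (t e)) (X (h e)) (Z (t e)) (Z (h e)) ∙ ≡f⇒not (unc e)))
      e₁ e₂ (trans r₁ p) (trans r₂ q)

  δ⟪⟫-end : ∀ a e → δ ⟪ a ⟫ e ≡ true → a ≡ t e ⊎ a ≡ h e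
  δ⟪⟫-end a e p with a ≟ t e | a ≟ h e
  ... | yes q | _     = inj₁ q
  ... | no _  | yes q = inj₂ q
  ... | no _  | no _  = ⊥-elim (true≢false p refl)

  -- A failure would make `a` a cut vertex. `P` collects the edges having an end on the side of `Z`
  -- opposite to `a`. Shifting `X` and `Z` to be `false` at `a` makes their conjunction restrict the
  -- cut of `X` to exactly these edges.
  star-is-bond : ∀ a → Bond ⟪ a ⟫
  star-is-bond a = crossed , min
    where
    crossed : Crossed ⟪ a ⟫
    crossed with touched a
    ... | e , inj₁ refl = e , cong₂ _xor_ (∈⟪⟫ {z = t e} refl) (∉⟪⟫ (no-loop e))
    ... | e , inj₂ refl = e , cong₂ _xor_ (∉⟪⟫ (no-loop e ∘ sym)) (∈⟪⟫ {z = h e} refl)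
    min : ∀ Z → Crossed Z → Z ⊑ ⟪ a ⟫ → ⟪ a ⟫ ⊑ Z
    min Z (f , cf) sub e ce = decidable-stable (δ Z e Boolₚ.≟ true)
      (λ n → inseparable P part f e Pf (Pe (≢true⇒≡f n)))
      where
      P : ES
      P g = (Z (t g) xor Z a) ∨ (Z (h g) xor Z a)
      Pf : P f ≡ true
      Pf = taut 3 (λ x y z → (x xor y) ⇒ ((x xor z) ∨ (y xor z))) refl (Z (t f)) (Z (h f)) (Z a) ∙ cf
      Pe : δ Z e ≡ false → P e ≡ false
      Pe q with δ⟪⟫-end a e ce
      ... | inj₁ refl = not⇒≡f (taut 2 (λ x y → not (x xor y) ⇒ not ((x xor x) ∨ (y xor x))) refl (Z (t e)) (Z (h e)) ∙ ≡f⇒not q)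
      ... | inj₂ refl = not⇒≡f (taut 2 (λ x y → not (x xor y) ⇒ not ((x xor y) ∨ (y xor y))) refl (Z (t e)) (Z (h e)) ∙ ≡f⇒not q)
      part : ∀ X → ∃ λ X₁ → ∀ g → δ X₁ g ≡ δ X g ∧ P g
      part X = (λ v → (X v xor X a) ∧ (Z v xor Z a)) , eq
        where
        eq : ∀ g → _
        eq g with bool-cases (δ ⟪ a ⟫ g)
        ... | inj₂ q = ==⇒≡ (taut 6 (λ x y xa z w za → (z == w) ⇒ ((((x xor xa) ∧ (z xor za)) xor ((y xor xa) ∧ (w xor za))) == ((x xor y) ∧ ((z xor za) ∨ (w xor za))))) refl
                (X (t g)) (X (h g)) (X a) (Z (t g)) (Z (h g)) (Z a) ∙ ≡f⇒not (≢true⇒≡f (λ c → true≢false (sub g c) q)))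
        ... | inj₁ q with δ⟪⟫-end a g q
        ...   | inj₁ refl = ==⇒≡ (taut 4 (λ x y z w → (((x xor x) ∧ (z xor z)) xor ((y xor x) ∧ (w xor z))) == ((x xor y) ∧ ((z xor z) ∨ (w xor z)))) refl
                (X (t g)) (X (h g)) (Z (t g)) (Z (h g)))
        ...   | inj₂ refl = ==⇒≡ (taut 4 (λ x y z w → (((x xor y) ∧ (z xor w)) xor ((y xor y) ∧ (w xor w))) == ((x xor y) ∧ ((z xor w) ∨ (w xor w)))) refl
                (X (t g)) (X (h g)) (Z (t g)) (Z (h g)))

  Uncut : VS → VS → Set
  Uncut X K = ∀ e → X (t e) ≡ true → X (h e) ≡ true → δ K e ≡ false

  -- Connectivity of the digraph induced on `X`, phrased through functions constant along edges, so
  -- that no undirected paths need to be built.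
  Connected : VS → Set
  Connected X = ∀ K → Uncut X K → ∀ x y → X x ≡ true → X y ≡ true → K x ≡ K y

  -- If `K` splits `X`, then `X ⊓ K` lies below `X`. Either it is uncrossed, or minimality gives it
  -- the same cut as `X`, so that `X xor (X ⊓ K)` is uncrossed; `connected` refutes both.
  bond⇒connected : ∀ X → Bond X → Connected X
  bond⇒connected X b K unc x y x∈ y∈ = bool-≡ (apart x y x∈ y∈) (apart y x y∈ x∈)
    where
    Z : VS
    Z = X ⊓ K
    sub : Z ⊑ X
    sub e = taut 4 (λ a b c d → (a ⇒ b ⇒ not (c xor d)) ⇒ ((a ∧ c) xor (b ∧ d)) ⇒ (a xor b)) refl (X (t e)) (X (h e)) (K (t e)) (K (h e))
      ∙ ⇒-intro (λ p → ⇒-intro (λ q → ≡f⇒not (unc e p q))) ∙_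
    apart : ∀ x y → X x ≡ true → X y ≡ true → K x ≡ true → K y ≡ false → ⊥
    apart x y x∈ y∈ p q with Crossed? Z
    ... | no n = true≢false (cong₂ _∧_ x∈ p) (trans (connected Z (λ e → ≢true⇒≡f (λ c → n (e , c))) x y) (cong₂ _∧_ y∈ q))
    ... | yes cr = true≢false (cong₂ (λ a b → a xor (a ∧ b)) y∈ q)
        (trans (connected (λ v → X v xor Z v) same y x) (cong₂ (λ a b → a xor (a ∧ b)) x∈ p))
      where
      same : ∀ e → δ (λ v → X v xor Z v) e ≡ false
      same e = trans (δ-xor X Z e) (≡⇒xor≡f (iff⇒≡ (proj₂ b Z cr sub e) (sub e)))

  crossing-ends : ∀ X e → δ X e ≡ true → ∃ λ x → ∃ λ y → X x ≡ true × X y ≡ false × (∀ K → δ K e ≡ K x xor K y)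
  crossing-ends X e p with bool-cases (X (t e))
  ... | inj₁ q = t e , h e , q , not⇒≡f (trans (sym (cong (_xor X (h e)) q)) p) , λ K → refl
  ... | inj₂ q = h e , t e , trans (sym (cong (_xor X (h e)) q)) p , q , λ K → Boolₚ.xor-comm (K (t e)) (K (h e))

  connected⇒bond : ∀ X → Crossed X → Connected X → Connected (not ∘ X) → Bond X
  connected⇒bond X cr c c′ = cr , min
    where
    min : ∀ Z → Crossed Z → Z ⊑ X → X ⊑ Z
    min Z (f , cf) sub e ce with crossing-ends X f (sub f cf) | crossing-ends X e ce
    ... | x , y , x∈ , y∉ , ends | x′ , y′ , x′∈ , y′∉ , ends′ =
      trans (ends′ Z) (trans (cong₂ _xor_
        (c Z (λ g p q → ≢true⇒≡f λ z → true≢false (sub g z) (≡⇒xor≡f (trans p (sym q)))) x′ x x′∈ x∈)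
        (c′ Z (λ g p q → ≢true⇒≡f λ z → true≢false (trans (δ-not X g) (sub g z)) (≡⇒xor≡f (trans p (sym q)))) y′ y (≡f⇒not y′∉) (≡f⇒not y∉)))
        (trans (sym (ends Z)) cf))

  -- Paths from r, recorded only through their intersection parities with cuts.
  path : ∀ r v → ∃ λ J → ∀ X → ⟨ J , X ⟩ ≡ X v xor X r
  path r v = does⇒ (Joined? v) (trans (connected K uncut v r) (dec-true (Joined? r) ((λ _ → false) , λ X → trans (sum-false {E D} (λ _ → refl)) (sym (Boolₚ.xor-same (X r))))))
    where
    Joined : Fin (V D) → Set
    Joined v = ∃ λ J → ∀ X → ⟨ J , X ⟩ ≡ X v xor X r
    Joined? : ∀ v → Dec (Joined v)
    Joined? v = ∃set? (λ p q X → trans (⟨⟩-congJ X (sym ∘ p)) (q X)) (λ J →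
      ∀set? (λ p q → trans (⟨⟩-cong J (sym ∘ p)) (trans q (cong₂ _xor_ (p v) (p r)))) (λ X → ⟨ J , X ⟩ Boolₚ.≟ (X v xor X r)))
    K : VS
    K v = does (Joined? v)
    extend-by : ∀ e x y → (∀ X → δ X e ≡ X x xor X y) → Joined y → Joined x
    extend-by e x y ends (J , q) = (λ g → ⟪ e ⟫ g xor J g) , λ X →
      trans (⟨⟩-xorJ ⟪ e ⟫ J X) (trans (cong₂ _xor_ (trans (sum-⟪⟫ e (δ X)) (ends X)) (q X))
        (==⇒≡ (taut 3 (λ a b c → ((a xor b) xor (b xor c)) == (a xor c)) refl (X x) (X y) (X r))))
    uncut : ∀ e → δ K e ≡ false
    uncut e = ≡⇒xor≡f (iff⇒≡
      (λ p → dec-true (Joined? (h e)) (extend-by e (h e) (t e) (λ X → Boolₚ.xor-comm (X (t e)) (X (h e))) (does⇒ (Joined? (t e)) p)))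
      (λ p → dec-true (Joined? (t e)) (extend-by e (t e) (h e) (λ X → refl) (does⇒ (Joined? (h e)) p))))

  -- Add up the paths from `r` to the vertices of weight one. Each also contributes `X r`, and these
  -- contributions cancel because `c` is even.
  T-join : (c : VS) → sum c ≡ false → Fin (V D) → ∃ λ J → ∀ X → ⟨ J , X ⟩ ≡ sum (λ v → X v ∧ c v)
  T-join c even r = J , sums
    where
    P : Fin (V D) → ES
    P v = proj₁ (path r v)
    J : ES
    J e = sum (λ v → c v ∧ P v e)
    sums : ∀ X → ⟨ J , X ⟩ ≡ sum (λ v → X v ∧ c v)
    sums X = begin
      sum (λ e → J e ∧ δ X e)
        ≡⟨ sum-cong-≗ (λ e → trans (Boolₚ.∧-comm (J e) (δ X e)) (trans (*-distribˡ-sum (δ X e) (λ v → c v ∧ P v e)) (sum-cong-≗ (λ v → swap (δ X e) (c v) (P v e))))) ⟩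
      sum (λ e → sum (λ v → c v ∧ (P v e ∧ δ X e)))
        ≡⟨ ∑-comm (λ e v → c v ∧ (P v e ∧ δ X e)) ⟩
      sum (λ v → sum (λ e → c v ∧ (P v e ∧ δ X e)))
        ≡⟨ sum-cong-≗ (λ v → trans (sym (*-distribˡ-sum (c v) (λ e → P v e ∧ δ X e))) (trans (cong (c v ∧_) (proj₂ (path r v) X)) (dist (c v) (X v) (X r)))) ⟩
      sum (λ v → (X v ∧ c v) xor (X r ∧ c v))
        ≡⟨ ∑-distrib-+ (λ v → X v ∧ c v) (λ v → X r ∧ c v) ⟩
      sum (λ v → X v ∧ c v) xor sum (λ v → X r ∧ c v)
        ≡⟨ cong (sum (λ v → X v ∧ c v) xor_) (trans (sym (*-distribˡ-sum (X r) c)) (trans (cong (X r ∧_) even) (Boolₚ.∧-zeroʳ (X r)))) ⟩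
      sum (λ v → X v ∧ c v) xor false
        ≡⟨ Boolₚ.xor-identityʳ _ ⟩
      sum (λ v → X v ∧ c v) ∎
      where
      open ≡-Reasoning
      swap : ∀ a b c → a ∧ (b ∧ c) ≡ b ∧ (c ∧ a)
      swap a b c = ==⇒≡ (taut 3 (λ a b c → (a ∧ (b ∧ c)) == (b ∧ (c ∧ a))) refl a b c)
      dist : ∀ a b c → a ∧ (b xor c) ≡ (b ∧ a) xor (c ∧ a)
      dist a b c = ==⇒≡ (taut 3 (λ a b c → (a ∧ (b xor c)) == ((b ∧ a) xor (c ∧ a))) refl a b c)

  -- The absence of an odd dijoin in the form used from here on: if an even weighting were odd on
  -- every dibond, its T-join would be an odd dijoin.
  bad-dibond : (c : VS) → sum c ≡ false → (∀ X → Dibond X → sum (λ v → X v ∧ c v) ≡ false → ⊥) → ⊥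
  bad-dibond c even bad = with-vertex λ r →
    let J , sums = T-join c even r in
    no-dijoin (J , λ X d → decidable-stable (⟨ J , X ⟩ Boolₚ.≟ true)
      (λ n → bad X d (trans (sym (sums X)) (≢true⇒≡f n))))

-- Closed sets and the modularity of `F`.

add : ∀ {n} → VSet n → Fin n → VSet n
add W u v = W v ∨ ⟪ u ⟫ v

add-old : ∀ {n} (W : VSet n) u {v} → W v ≡ true → add W u v ≡ true
add-old W u {v} p = cong (_∨ ⟪ u ⟫ v) p

add-new : ∀ {n} (W : VSet n) u → add W u u ≡ true
add-new W u = trans (cong (W u ∨_) (∈⟪⟫ {z = u} refl)) (Boolₚ.∨-zeroʳ (W u))

add-∉ : ∀ {n} (W : VSet n) u {v} → W v ≡ false → u ≢ v → add W u v ≡ false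
add-∉ W u p q = cong₂ _∨_ p (∉⟪⟫ q)

add-cases : ∀ {n} (W : VSet n) u {v} → add W u v ≡ true → W v ≡ true ⊎ u ≡ v
add-cases W u {v} p with bool-cases (W v)
... | inj₁ q = inj₁ q
... | inj₂ q = inj₂ (⟪⟫⇒≡ (trans (sym (cong (_∨ ⟪ u ⟫ v) q)) p))

add-xor : ∀ {n} (W : VSet n) u → W u ≡ false → add W u ≗ (λ v → W v xor ⟪ u ⟫ v)
add-xor W u p v with u ≟ v
... | yes refl = trans (Boolₚ.∨-zeroʳ (W u)) (sym (cong (_xor true) p))
... | no _ = ==⇒≡ (taut 1 (λ a → (a ∨ false) == (a xor false)) refl (W v))

module Layers (D : Digraph) (no-dijoin : ¬ ∃ (Cuts.OddDijoin D))
  (critical : EdgeCritical D) (touched : Touched D) where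
  open Cuts D
  open Decomposition D
  open Critical D no-dijoin critical touched
  private
    t = tail D
    h = head D

  ⟨⟩-add : ∀ J W u → W u ≡ false → ⟨ J , add W u ⟩ ≡ ⟨ J , W ⟩ xor ⟨ J , ⟪ u ⟫ ⟩
  ⟨⟩-add J W u p = trans (⟨⟩-cong J (add-xor W u p)) (⟨⟩-xor J W ⟪ u ⟫)

  -- Dibonds contained in a cut avoiding `e` avoid `e` themselves, so on all such cuts `F` agrees
  -- with one linear functional.
  F-critical : ∀ e Z → Closed Z → δ Z e ≡ false → F Z ≡ ⟨ proj₁ (critical e) , Z ⟩
  F-critical e Z c p = sym (proj₁ (F-spec Z c) (proj₁ (critical e))
    (λ X d sub → proj₂ (critical e) X d (≢true⇒≡f (λ x → true≢false (sub e x) p))))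

  F-uncrossed : ∀ Z → Closed Z → (∀ e → δ Z e ≡ false) → F Z ≡ false
  F-uncrossed Z c unc = trans
    (sym (proj₁ (F-spec Z c) (λ _ → false) (λ { X (dibond ((e , x) , _) _) sub → ⊥-elim (true≢false (sub e x) (unc e)) })))
    (⟨⟩-uncrossed (λ _ → false) {Z} unc)

  abstract
    private
      Below : Fin (V D) → Fin (V D) → Set
      Below v w = ∀ X → Closed X → X v ≡ true → X w ≡ true

      Below? : ∀ v w → Dec (Below v w)
      Below? v w = ∀set? {P = λ X → Closed X → X v ≡ true → X w ≡ true}
        (λ {X} {Y} p q c y → trans (sym (p w)) (q (Closed-cong {Y} (sym ∘ p) c) (trans (p v) y)))
        (λ X → Closed? X →-dec ((X v Boolₚ.≟ true) →-dec (X w Boolₚ.≟ true)))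

    -- The ancestors of `v`, obtained as the intersection of the closed sets containing `v`; this
    -- form is decidable without enumerating paths.
    down : Fin (V D) → VS
    down v w = does (Below? v w)

    down-elim : ∀ v w → down v w ≡ true → ∀ X → Closed X → X v ≡ true → X w ≡ true
    down-elim v w = does⇒ (Below? v w)

    down-intro : ∀ v w → (∀ X → Closed X → X v ≡ true → X w ≡ true) → down v w ≡ true
    down-intro v w = dec-true (Below? v w)

  down-self : ∀ v → down v v ≡ true
  down-self v = down-intro v v (λ _ _ p → p)

  down-closed : ∀ v → Closed (down v)
  down-closed v e p = down-intro v (t e) (λ X c q → c e (down-elim v (h e) p X c q))

  -- An edge on a directed cycle lies in no directed cut, against `in-some-dibond`.
  acyclic : ∀ e → down (t e) (h e) ≡ false
  acyclic e = ≢true⇒≡f λ p → in-some-dibond e λ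
    { X (dibond _ (inj₁ c)) → flat X c p
    ; X (dibond _ (inj₂ c)) → trans (sym (δ-not X e)) (flat (not ∘ X) c p) }
    where
    flat : ∀ X → Closed X → down (t e) (h e) ≡ true → δ X e ≡ false
    flat X c p = ≡⇒xor≡f (iff⇒≡ (down-elim (t e) (h e) p X c) (c e))

  rank : Fin (V D) → ℕ
  rank v = size (down v)

  rank-< : ∀ e → rank (t e) < rank (h e)
  rank-< e = size-< {X = down (t e)} {down (h e)}
    (λ w p → down-intro (h e) w (λ X c q → down-elim (t e) w p X c (c e q)))
    (h e) (down-self (h e)) (acyclic e)

  down⁻ : Fin (V D) → VS
  down⁻ v w = down v w ∧ not (⟪ v ⟫ w)

  down⁻-closed : ∀ v → Closed (down⁻ v)
  down⁻-closed v e p with ∧-true {down v (h e)} p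
  ... | q , _ = cong₂ _∧_ (down-closed v e q) (≡f⇒not (∉⟪⟫ {z = v} (λ { refl → true≢false q (acyclic e) })))

  add-closed : ∀ W u → Closed W → (∀ e → h e ≡ u → W (t e) ≡ true) → Closed (add W u)
  add-closed W u c below e p with add-cases W u p
  ... | inj₁ q = add-old W u (c e q)
  ... | inj₂ q = add-old W u (below e (sym q))

  minimal-missing : ∀ (W B : VS) → Closed B → ∀ k u → rank u < k → B u ≡ true → W u ≡ false →
                    ∃ λ u → B u ≡ true × W u ≡ false × (∀ e → h e ≡ u → W (t e) ≡ true)
  minimal-missing W B c (suc k) u (s≤s le) b w with Finₚ.any? (λ e → (h e ≟ u) ×-dec (W (t e) Boolₚ.≟ false))
  ... | yes (e , refl , q) = minimal-missing W B c k (t e) (ℕₚ.<-≤-trans (rank-< e) le) (c e b) q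
  ... | no n = u , b , w , λ e p → decidable-stable (W (t e) Boolₚ.≟ true) (λ q → n (e , p , ≢true⇒≡f q))

  -- Adding the missing vertices of `B` in topological order keeps every intermediate set closed.
  -- `minimal-missing` finds the next one by descending along in-edges, which ends because `rank`
  -- drops.
  closed-induction : ∀ B → Closed B → (P : VS → Set) → (∀ {X Y} → X ≗ Y → P X → P Y) →
    (∀ W u → Closed W → Closed (add W u) → B u ≡ true → W u ≡ false → P W → P (add W u)) →
    ∀ W → Closed W → (∀ v → W v ≡ true → B v ≡ true) → P W → P B
  closed-induction B cB P resp step W = go (suc (size (missing W))) W ℕₚ.≤-refl
    where
    missing : VS → VS
    missing W v = B v ∧ not (W v)
    go : ∀ k W → size (missing W) < k → Closed W → (∀ v → W v ≡ true → B v ≡ true) → P W → P B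
    go (suc k) W (s≤s le) c sub p with Finₚ.any? (λ u → (B u Boolₚ.≟ true) ×-dec (W u Boolₚ.≟ false))
    ... | no n = resp (λ v → iff⇒≡ (sub v) (λ b → decidable-stable (W v Boolₚ.≟ true) (λ w → n (v , b , ≢true⇒≡f w)))) p
    ... | yes (u₀ , b₀ , w₀) with minimal-missing W B cB (suc (rank u₀)) u₀ ℕₚ.≤-refl b₀ w₀
    ...   | u , b , w , below = go k (add W u)
            (ℕₚ.<-≤-trans (size-< {X = missing (add W u)} {missing W}
              (λ v → taut 3 (λ b w s → (b ∧ not (w ∨ s)) ⇒ (b ∧ not w)) refl (B v) (W v) (⟪ u ⟫ v) ∙_)
              u (cong₂ (λ a b → a ∧ not b) b w) (trans (cong (λ z → B u ∧ not z) (add-new W u)) (Boolₚ.∧-zeroʳ (B u)))) le)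
            c′ (λ v → [ sub v , (λ { refl → b }) ] ∘ add-cases W u) (step W u c c′ b w p)
      where
      c′ : Closed (add W u)
      c′ = add-closed W u c below

  add-add-closed : ∀ W u v → Closed (add W u) → Closed (add W v) → Closed (add (add W u) v)
  add-add-closed W u v cu cv e p with add-cases (add W u) v p
  ... | inj₁ q = add-old (add W u) v (cu e q)
  ... | inj₂ refl with add-cases W v (cv e (add-new W v))
  ...   | inj₁ q = add-old (add W u) v (add-old W u q)
  ...   | inj₂ q = ⊥-elim (no-loop e (sym q))

  Inside : VS → Fin (E D) → Set
  Inside W e = W (t e) ≡ true × W (h e) ≡ true

  Outside : VS → Fin (E D) → Set
  Outside W e = W (t e) ≡ false × W (h e) ≡ false

  Independent-edges : Set
  Independent-edges = ∀ W u v → u ≢ v → W u ≡ false → W v ≡ false →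
    Closed W → Closed (add W u) → Closed (add W v) → ∃ λ e → Inside W e ⊎ Outside (add (add W u) v) e

  -- F is a valuation on closed sets, hence comes from a weighting of the vertices.
  module Modular (free : Independent-edges) where

    -- The marginal value of `v` over its proper ancestors, the least closed set to which `v` can be
    -- added; `increment` shows that every larger closed set without `v` gives the same value.
    weight : VS
    weight v = F (add (down⁻ v) v) xor F (down⁻ v)

    exchange : ∀ W u v → u ≢ v → W u ≡ false → W v ≡ false → Closed W → Closed (add W u) → Closed (add W v) →
               F (add (add W u) v) xor F (add W u) ≡ F (add W v) xor F W
    exchange W u v u≢v u∉ v∉ c cu cv with free W u v u≢v u∉ v∉ c cu cv
    ... | e , side = begin
      F (add (add W u) v) xor F (add W u)
        ≡⟨ cong₂ _xor_ (trans (at _ (add-add-closed W u v cu cv) (flat₃ side)) (trans (⟨⟩-add J (add W u) v (add-∉ W u v∉ u≢v)) (cong (_xor ⟨ J , ⟪ v ⟫ ⟩) (⟨⟩-add J W u u∉))))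
                       (trans (at _ cu (flat₁ side)) (⟨⟩-add J W u u∉)) ⟩
      ((w xor ⟨ J , ⟪ u ⟫ ⟩) xor ⟨ J , ⟪ v ⟫ ⟩) xor (w xor ⟨ J , ⟪ u ⟫ ⟩)
        ≡⟨ ==⇒≡ (taut 3 (λ a b c → (((a xor b) xor c) xor (a xor b)) == ((a xor c) xor a)) refl w ⟨ J , ⟪ u ⟫ ⟩ ⟨ J , ⟪ v ⟫ ⟩) ⟩
      (w xor ⟨ J , ⟪ v ⟫ ⟩) xor w
        ≡⟨ sym (cong₂ _xor_ (trans (at _ cv (flat₂ side)) (⟨⟩-add J W v v∉)) (at _ c (flat₀ side))) ⟩
      F (add W v) xor F W ∎
      where
      open ≡-Reasoning
      J : ES
      J = proj₁ (critical e)
      w : Bool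
      w = ⟨ J , W ⟩
      at : ∀ Z → Closed Z → Z (t e) ≡ Z (h e) → F Z ≡ ⟨ J , Z ⟩
      at Z cZ p = F-critical e Z cZ (≡⇒xor≡f p)
      big : Fin (V D) → Bool
      big = add (add W u) v
      Side : Set
      Side = Inside W e ⊎ Outside big e
      flat₃ : Side → big (t e) ≡ big (h e)
      flat₃ (inj₁ (p , q)) = trans (add-old (add W u) v (add-old W u p)) (sym (add-old (add W u) v (add-old W u q)))
      flat₃ (inj₂ (p , q)) = trans p (sym q)
      not-in : ∀ {x} → big x ≡ false → W x ≡ false × u ≢ x × v ≢ x
      not-in {x} p = ≢true⇒≡f (λ q → true≢false (add-old (add W u) v (add-old W u q)) p) ,
        (λ { refl → true≢false (add-old (add W u) v (add-new W u)) p }) ,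
        (λ { refl → true≢false (add-new (add W u) v) p })
      flat₀ : Side → W (t e) ≡ W (h e)
      flat₀ (inj₁ (p , q)) = trans p (sym q)
      flat₀ (inj₂ (p , q)) = trans (proj₁ (not-in p)) (sym (proj₁ (not-in q)))
      flat₁ : Side → add W u (t e) ≡ add W u (h e)
      flat₁ (inj₁ (p , q)) = trans (add-old W u p) (sym (add-old W u q))
      flat₁ (inj₂ (p , q)) with not-in p | not-in q
      ... | a , b , _ | a′ , b′ , _ = trans (add-∉ W u a b) (sym (add-∉ W u a′ b′))
      flat₂ : Side → add W v (t e) ≡ add W v (h e)
      flat₂ (inj₁ (p , q)) = trans (add-old W v p) (sym (add-old W v q))
      flat₂ (inj₂ (p , q)) with not-in p | not-in q
      ... | a , _ , b | a′ , _ , b′ = trans (add-∉ W v a b) (sym (add-∉ W v a′ b′))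

    add-cong : ∀ {X Y : VS} v → X ≗ Y → add X v ≗ add Y v
    add-cong v p w = cong (_∨ ⟪ v ⟫ w) (p w)

    increment : ∀ B v → Closed B → Closed (add B v) → B v ≡ false → F (add B v) xor F B ≡ weight v
    increment B v cB cBv v∉ = proj₂ (closed-induction B cB
      (λ W → Closed (add W v) × F (add W v) xor F W ≡ weight v)
      (λ {X} {Y} p (c , q) → Closed-cong {add X v} (add-cong v p) c , trans (cong₂ _xor_ (F-cong (add-cong v (sym ∘ p))) (F-cong (sym ∘ p))) q)
      step (down⁻ v) (down⁻-closed v) sub (down⁻v , refl))
      where
      step : ∀ W u → Closed W → Closed (add W u) → B u ≡ true → W u ≡ false →
             Closed (add W v) × F (add W v) xor F W ≡ weight v →
             Closed (add (add W u) v) × F (add (add W u) v) xor F (add W u) ≡ weight v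
      step W u c cu b w (cv , q) with bool-cases (W v)
      ... | inj₂ v∉W = add-add-closed W u v cu cv ,
                       trans (exchange W u v (λ { refl → true≢false b v∉ }) w v∉W c cu cv) q
      -- The induction does not record that `W` lies in `B`, so this case must be answered; adding
      -- `v` is idle both before and after adding `u`.
      ... | inj₁ v∈W = add-add-closed W u v cu cv ,
                       trans (≡⇒xor≡f (F-cong (absorb (add W u) (add-old W u v∈W)))) (trans (sym (≡⇒xor≡f (F-cong (absorb W v∈W)))) q)
        where
        absorb : ∀ X → X v ≡ true → add X v ≗ X
        absorb X p w with v ≟ w
        ... | yes refl = trans (Boolₚ.∨-zeroʳ (X v)) (sym p)
        ... | no _     = Boolₚ.∨-identityʳ (X w)
      down⁻v : Closed (add (down⁻ v) v)
      down⁻v = add-closed (down⁻ v) v (down⁻-closed v) (λ { e refl →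
        cong₂ _∧_ (down-closed (h e) e (down-self (h e))) (≡f⇒not (∉⟪⟫ (no-loop e ∘ sym))) })
      sub : ∀ w → down⁻ v w ≡ true → B w ≡ true
      sub w p with ∧-true {down v w} p
      ... | q , r with add-cases B v (down-elim v w q (add B v) cBv (add-new B v))
      ...   | inj₁ b = b
      ...   | inj₂ refl = ⊥-elim (true≢false (∈⟪⟫ {z = v} refl) (not⇒≡f r))

    F-weight : ∀ X → Closed X → F X ≡ sum (λ v → X v ∧ weight v)
    F-weight X c = closed-induction X c (λ W → F W ≡ sum (λ v → W v ∧ weight v))
      (λ p q → trans (F-cong (sym ∘ p)) (trans q (sum-cong-≗ (λ v → cong (_∧ weight v) (p v)))))
      step (λ _ → false) (λ _ ()) (λ _ ())
      (trans (F-uncrossed (λ _ → false) (λ _ ()) (λ _ → refl)) (sym (sum-false {V D} (λ _ → refl))))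
      where
      step : ∀ W u → Closed W → Closed (add W u) → X u ≡ true → W u ≡ false →
             F W ≡ sum (λ v → W v ∧ weight v) → F (add W u) ≡ sum (λ v → add W u v ∧ weight v)
      step W u c cu _ w p = begin
        F (add W u)
          ≡⟨ ==⇒≡ (taut 3 (λ a b c → ((a xor b) == c) ⇒ (a == (b xor c))) refl (F (add W u)) (F W) (weight u) ∙ ≡⇒== (increment W u c cu w)) ⟩
        F W xor weight u
          ≡⟨ cong₂ _xor_ p (sym (sum-⟪⟫ u weight)) ⟩
        sum (λ v → W v ∧ weight v) xor sum (λ v → ⟪ u ⟫ v ∧ weight v)
          ≡⟨ sym (∑-distrib-+ (λ v → W v ∧ weight v) (λ v → ⟪ u ⟫ v ∧ weight v)) ⟩
        sum (λ v → (W v ∧ weight v) xor (⟪ u ⟫ v ∧ weight v))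
          ≡⟨ sum-cong-≗ (λ v → trans (sym (Boolₚ.∧-distribʳ-xor (weight v) (W v) (⟪ u ⟫ v))) (cong (_∧ weight v) (sym (add-xor W u w v)))) ⟩
        sum (λ v → add W u v ∧ weight v) ∎
        where open ≡-Reasoning

    weight-even : sum weight ≡ false
    weight-even = trans (sym (F-weight (λ _ → true) (λ _ _ → refl))) (F-uncrossed (λ _ → true) (λ _ _ → refl) (λ _ → refl))

    contradiction : ⊥
    contradiction = bad-dibond weight weight-even λ
      { X (dibond b (inj₁ c)) p → closed X b c p
      ; X (dibond b (inj₂ c)) p → closed (not ∘ X) (Bond-congδ X (not ∘ X) (λ e → sym (δ-not X e)) b) c
          (sum-complement weight X weight-even p) }
      where
      closed : ∀ X → Bond X → Closed X → sum (λ v → X v ∧ weight v) ≡ false → ⊥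
      closed X b c p = true≢false (proj₂ (F-spec X c) b) (trans (F-weight X c) p)

  two-impure : (∀ u v → u ≢ v → (∀ z → z ≢ u → z ≢ v → Dibond ⟪ z ⟫) → ⊥) → ⊥
  two-impure k = Modular.contradiction free
    where
    free : Independent-edges
    free W u v u≢v u∉ v∉ c cu cv with Finₚ.any? (λ e →
      ((W (t e) Boolₚ.≟ true) ×-dec (W (h e) Boolₚ.≟ true)) ⊎-dec
      ((add (add W u) v (t e) Boolₚ.≟ false) ×-dec (add (add W u) v (h e) Boolₚ.≟ false)))
    ... | yes p = p
    ... | no n  = ⊥-elim (k u v u≢v pure)
      where
      pure : ∀ z → z ≢ u → z ≢ v → Dibond ⟪ z ⟫
      pure z z≢u z≢v with bool-cases (W z)
      -- An edge into `z` would start in `W`, as `W` is closed, and so lie inside `W`. Dually, an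
      -- edge leaving a vertex beyond `W`, `u` and `v` would stay beyond them.
      ... | inj₁ z∈ = dibond (star-is-bond z) (inj₁ (source⇒closed D z
            (λ { e refl → n (e , inj₁ (c e z∈ , z∈)) })))
      ... | inj₂ z∉ = dibond (star-is-bond z) (inj₂ (sink⇒closed D z
            (λ { e refl → n (e , inj₂ (z∉′ , ≢true⇒≡f (λ p → true≢false (add-add-closed W u v cu cv e p) z∉′))) })))
        where
        z∉′ : add (add W u) v z ≡ false
        z∉′ = add-∉ (add W u) v (add-∉ W u z∉ (z≢u ∘ sym)) (z≢v ∘ sym)

-- Recognising the obstruction

two⇒2≤ : ∀ {n} (S : Subset n) {a b} → a ≢ b → a ∈ S → b ∈ S → 2 ≤ ∣ S ∣
two⇒2≤ S {a} {b} a≢b a∈ b∈ = subst (_< ∣ S ∣) (∣⁅x⁆∣≡1 a) (p⊂q⇒∣p∣<∣q∣ {p = ⁅ a ⁆} {S}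
  ((λ p → subst (_∈ S) (sym (x∈⁅y⁆⇒x≡y a p)) a∈) , b , b∈ , λ p → a≢b (sym (x∈⁅y⁆⇒x≡y a p))))

-- `no-parallel` and `no-shortcut` carry all that is used of minimality under deletion: an edge
-- parallel to another edge or to a directed path of length two is deletable.
module Final (D : Digraph) (no-dijoin : ¬ ∃ (Cuts.OddDijoin D))
  (critical : EdgeCritical D) (touched : Touched D)
  (no-parallel : ∀ e f → tail D e ≡ tail D f → head D e ≡ head D f → e ≡ f)
  (no-shortcut : ∀ e f g → tail D e ≡ tail D f → head D f ≡ tail D g → head D g ≡ head D e → ⊥)
  (no-diamond : ¬ IsOddDiamond D) (no-one-direction : ¬ IsOddOneDirection D) where
  open Cuts D
  open Decomposition D
  open Critical D no-dijoin critical touched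
  open Layers D no-dijoin critical touched using (Inside; Outside; two-impure)
  private
    t = tail D
    h = head D

  J : Fin (E D) → ES
  J e = proj₁ (critical e)

  J-odd : ∀ e {X} → Dibond X → X (t e) ≡ X (h e) → ⟨ J e , X ⟩ ≡ true
  J-odd e {X} d p = proj₂ (critical e) X d (≡⇒xor≡f p)

  N : Bool
  N = sum {V D} (λ _ → true)

  all-pure-in : VS → Set
  all-pure-in R = ∀ z → R z ≡ true → Dibond ⟪ z ⟫

  pure-value : ∀ e R → all-pure-in R → Outside R e → ⟨ J e , R ⟩ ≡ sum R
  pure-value e R pure (p , q) = ⟨⟩-odd-vertices (J e) R (λ z r →
    J-odd e (pure z r) (trans (∉⟪⟫ {z = z} (λ { refl → true≢false r p })) (sym (∉⟪⟫ {z = z} (λ { refl → true≢false r q })))))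

  -- An edge `e` beyond `R` avoids the cut of `R` and every star in `R`, so `J e` is odd on all of
  -- them; counting stars then makes the size of `R` odd.
  even-side : ∀ R → Dibond R → all-pure-in R → sum R ≡ false → ∀ e → Outside R e → ⊥
  even-side R d pure even e o@(p , q) =
    true≢false (J-odd e d (trans p (sym q))) (trans (pure-value e R pure o) even)

  abstract
    neighbour : ∀ X → Connected X → ∀ s w → X s ≡ true → X w ≡ true → s ≢ w →
                ∃ λ e → Inside X e × (t e ≡ s ⊎ h e ≡ s)
    neighbour X c s w s∈ w∈ s≢w with Finₚ.any? (λ e → ((X (t e) Boolₚ.≟ true) ×-dec (X (h e) Boolₚ.≟ true)) ×-dec ((t e ≟ s) ⊎-dec (h e ≟ s)))
    ... | yes p = p
    ... | no n = ⊥-elim (true≢false (∈⟪⟫ {z = s} refl) (trans (c ⟪ s ⟫ uncut s w s∈ w∈) (∉⟪⟫ s≢w)))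
      where
      uncut : Uncut X ⟪ s ⟫
      uncut e p q = cong₂ _xor_ (∉⟪⟫ (λ r → n (e , (p , q) , inj₁ (sym r)))) (∉⟪⟫ (λ r → n (e , (p , q) , inj₂ (sym r))))

  edgeless : ∀ X → Connected X → (∀ e → ¬ Inside X e) → ∀ x y → X x ≡ true → X y ≡ true → x ≡ y
  edgeless X c none x y x∈ y∈ with x ≟ y
  ... | yes p = p
  ... | no n with neighbour X c x y x∈ y∈ n
  ...   | e , i , _ = ⊥-elim (none e i)

  abstract
    pure-ends : ∀ z → Dibond ⟪ z ⟫ → (∀ e → h e ≢ z) ⊎ (∀ e → t e ≢ z)
    pure-ends z (dibond _ (inj₁ c)) = inj₁ λ { e refl → no-loop e (sym (⟪⟫⇒≡ (c e (∈⟪⟫ {z = h e} refl)))) }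
    pure-ends z (dibond _ (inj₂ c)) = inj₂ λ { e refl → true≢false (∈⟪⟫ {z = t e} refl) (not⇒≡f (c e (≡f⇒not (∉⟪⟫ (no-loop e))))) }

  abstract
    -- C is the component of s in P; its complement is connected because every other component
    -- of P is attached to the connected set not ∘ P.
    component : ∀ P → Directed P → Connected (not ∘ P) → ∀ r s → P r ≡ false → P s ≡ true →
                ∃ λ C → (∀ z → C z ≡ true → P z ≡ true) × C s ≡ true × Uncut P C × Dibond C
    component P dir conn r s r∉ s∈ = C , C⊆P , Cs , uncut , dibond (connected⇒bond C crossed C-conn C′-conn) (C-directed dir)
      where
      Reached : Fin (V D) → Set
      Reached z = ∀ Z → Uncut P Z → Z s ≡ true → Z z ≡ true
      Reached? : ∀ z → Dec (Reached z)
      Reached? z = ∀set? {P = λ Z → Uncut P Z → Z s ≡ true → Z z ≡ true}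
        (λ p q u y → trans (sym (p z)) (q (λ e a b → trans (δ-cong p e) (u e a b)) (trans (p s) y)))
        (λ Z → Finₚ.all? (λ e → (P (t e) Boolₚ.≟ true) →-dec ((P (h e) Boolₚ.≟ true) →-dec (δ Z e Boolₚ.≟ false)))
               →-dec ((Z s Boolₚ.≟ true) →-dec (Z z Boolₚ.≟ true)))
      C : VS
      C z = P z ∧ does (Reached? z)
      C⊆P : ∀ z → C z ≡ true → P z ≡ true
      C⊆P z p = proj₁ (∧-true p)
      C-elim : ∀ z → C z ≡ true → Reached z
      C-elim z p = does⇒ (Reached? z) (proj₂ (∧-true {P z} p))
      C-intro : ∀ z → P z ≡ true → Reached z → C z ≡ true
      C-intro z p q = cong₂ _∧_ p (dec-true (Reached? z) q)
      Cs : C s ≡ true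
      Cs = C-intro s s∈ (λ _ _ p → p)
      uncut : Uncut P C
      uncut e p q = ≡⇒xor≡f (iff⇒≡
        (λ c → C-intro (h e) q (λ Z u z → trans (sym (xor≡f⇒≡ (u e p q))) (C-elim (t e) c Z u z)))
        (λ c → C-intro (t e) p (λ Z u z → trans (xor≡f⇒≡ (u e p q)) (C-elim (h e) c Z u z))))
      crossed : Crossed C
      crossed with Crossed? C
      ... | yes p = p
      ... | no n = ⊥-elim (true≢false Cs (trans (connected C (λ e → ≢true⇒≡f (λ p → n (e , p))) s r) (cong (_∧ does (Reached? r)) r∉)))
      C-conn : Connected C
      C-conn K unc x y x∈ y∈ = trans (to-s x x∈) (sym (to-s y y∈))
        where
        Z : VS
        Z z = C z ⇒ (K z == K s)
        Z-uncut : Uncut P Z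
        Z-uncut e p q = not⇒≡f (taut 5 (λ c d k l m → (c == d) ⇒ (c ⇒ d ⇒ (k == l)) ⇒ ((c ⇒ (k == m)) == (d ⇒ (l == m)))) refl
          (C (t e)) (C (h e)) (K (t e)) (K (h e)) (K s) ∙ ≡f⇒not (uncut e p q) ∙ ⇒-intro (λ a → ⇒-intro (λ b → ≡f⇒not (unc e a b))))
        to-s : ∀ x → C x ≡ true → K x ≡ K s
        to-s x x∈ = ==⇒≡ (C-elim x x∈ Z Z-uncut (⇒-intro {C s} (λ _ → ≡⇒== {K s} refl)) ∙ x∈)
      C′-conn : Connected (not ∘ C)
      C′-conn K unc x y x∉ y∉ = trans (to-r x x∉) (sym (to-r y y∉))
        where
        outside-P : ∀ z → P z ≡ false → K z ≡ K r
        outside-P z p = conn K (λ e a b → unc e (nP e a) (nP′ e b)) z r (≡f⇒not p) (≡f⇒not r∉)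
          where
          shrink : ∀ z → not (P z) ≡ true → not (C z) ≡ true
          shrink z p = ≡f⇒not (≢true⇒≡f (λ c → true≢false (C⊆P z c) (not⇒≡f p)))
          nP : ∀ e → not (P (t e)) ≡ true → not (C (t e)) ≡ true
          nP e = shrink (t e)
          nP′ : ∀ e → not (P (h e)) ≡ true → not (C (h e)) ≡ true
          nP′ e = shrink (h e)
        -- Marks the vertices of `P` beyond `C` where `K` differs from its value at `r`. No edge
        -- crosses this set and it misses `r`, so it is empty.
        K′ : VS
        K′ z = (P z ∧ not (C z)) ∧ (K z xor K r)
        K′-uncut : ∀ e → δ K′ e ≡ false
        K′-uncut e = not⇒≡f (taut 7 (λ p q c d k l m →
            (p ⇒ q ⇒ (c == d)) ⇒ (not c ⇒ not d ⇒ (k == l)) ⇒ (not p ⇒ (k == m)) ⇒ (not q ⇒ (l == m)) ⇒ (c ⇒ p) ⇒ (d ⇒ q) ⇒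
            not (((p ∧ not c) ∧ (k xor m)) xor ((q ∧ not d) ∧ (l xor m)))) refl
          (P (t e)) (P (h e)) (C (t e)) (C (h e)) (K (t e)) (K (h e)) (K r)
          ∙ ⇒-intro (λ a → ⇒-intro (λ b → ≡f⇒not (uncut e a b)))
          ∙ ⇒-intro (λ a → ⇒-intro (λ b → ≡f⇒not (unc e a b)))
          ∙ ⇒-intro (λ a → ≡⇒== (outside-P (t e) (not⇒≡f a)))
          ∙ ⇒-intro (λ a → ≡⇒== (outside-P (h e) (not⇒≡f a)))
          ∙ ⇒-intro (C⊆P (t e)) ∙ ⇒-intro (C⊆P (h e)))
        to-r : ∀ x → not (C x) ≡ true → K x ≡ K r
        to-r x x∉ = ==⇒≡ (taut 4 (λ p c k m → (not p ⇒ (k == m)) ⇒ not c ⇒ not ((p ∧ not c) ∧ (k xor m)) ⇒ (k == m)) refl (P x) (C x) (K x) (K r)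
          ∙ ⇒-intro (λ a → ≡⇒== (outside-P x (not⇒≡f a))) ∙ x∉
          ∙ ≡f⇒not (trans (connected K′ K′-uncut x r) (cong (λ b → (b ∧ not (C r)) ∧ (K r xor K r)) r∉)))
      C-directed : Directed P → Directed C
      C-directed (inj₁ c) = inj₁ λ e p → trans (xor≡f⇒≡ (uncut e (c e (C⊆P _ p)) (C⊆P _ p))) p
      C-directed (inj₂ c) = inj₂ λ e p → taut 4 (λ a b c d → (not b ⇒ not a) ⇒ (a ⇒ b ⇒ (c == d)) ⇒ (c ⇒ a) ⇒ not d ⇒ not c) refl
        (P (t e)) (P (h e)) (C (t e)) (C (h e)) ∙ ⇒-intro (c e) ∙ ⇒-intro (λ a → ⇒-intro (λ b → ≡f⇒not (uncut e a b))) ∙ ⇒-intro (C⊆P (t e)) ∙ p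

  odd-V : N ≡ true → Odd (V D)
  odd-V p = parity⇒Odd (V D) (trans (sym (sum-true (V D))) p)

  -- Every vertex a source or a sink: one-directions.

  module AllPure (pure : ∀ z → Dibond ⟪ z ⟫) (odd : N ≡ true) where

    -- The number of vertices is odd, so one side of `C` is even, and `even-side` forbids an edge on
    -- the other.
    trivial-side : ∀ C → Dibond C → ∀ e f → Inside C e → Outside C f → ⊥
    trivial-side C d e f (p , q) o with bool-cases (sum C)
    ... | inj₂ even = even-side C d (λ z _ → pure z) even f o
    ... | inj₁ odd′ = even-side (not ∘ C) (Dibond-not d) (λ z _ → pure z)
      (trans (sum-not C) (cong₂ _xor_ odd odd′)) e (cong not p , cong not q)

    Source? : ∀ z → Dec (∀ e → h e ≢ z)
    Source? z = Finₚ.all? (λ e → ¬? (h e ≟ z))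

    A : VS
    A z = does (Source? z)

    source : ∀ {z} → A z ≡ true → ∀ e → h e ≢ z
    source {z} = does⇒ (Source? z)

    sink : ∀ {z} → A z ≡ false → ∀ e → t e ≢ z
    sink {z} p with pure-ends z (pure z)
    ... | inj₁ q = ⊥-elim (¬does⇒ (Source? z) p q)
    ... | inj₂ q = q

    tail-source : ∀ e → A (t e) ≡ true
    tail-source e = decidable-stable (A (t e) Boolₚ.≟ true) (λ n → sink (≢true⇒≡f n) e refl)

    head-sink : ∀ e → A (h e) ≡ false
    head-sink e = ≢true⇒≡f (λ p → source p e refl)

    -- If `b` were not an out-neighbour of `a`, remove `a` and all its out-neighbours and take the
    -- component of `b`. An edge into `b` lies inside it and an edge out of `a` beyond it, against
    -- `trivial-side`.
    complete : ∀ a b → A a ≡ true → A b ≡ false → ∃ λ e → t e ≡ a × h e ≡ b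
    complete a b a∈ b∉ with Finₚ.any? (λ e → (t e ≟ a) ×-dec (h e ≟ b))
    ... | yes p = p
    ... | no n = ⊥-elim (finish (touched a) (touched b) (component P (inj₁ P-closed) conn a b (P-near a (inj₁ refl)) (P-far b far-b)))
      where
      Near : Fin (V D) → Set
      Near z = a ≡ z ⊎ (∃ λ e → t e ≡ a × h e ≡ z)
      Near? : ∀ z → Dec (Near z)
      Near? z = (a ≟ z) ⊎-dec Finₚ.any? (λ e → (t e ≟ a) ×-dec (h e ≟ z))
      P : VS
      P z = not (does (Near? z))
      P-near : ∀ z → Near z → P z ≡ false
      P-near z n = cong not (dec-true (Near? z) n)
      P-far : ∀ z → ¬ Near z → P z ≡ true
      P-far z n = cong not (dec-false (Near? z) n)
      near : ∀ z → P z ≡ false → Near z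
      near z p = does⇒ (Near? z) (trans (sym (Boolₚ.not-involutive (does (Near? z)))) (cong not p))
      far-b : ¬ Near b
      far-b (inj₁ p) = true≢false a∈ (trans (cong A p) b∉)
      far-b (inj₂ p) = n p
      far-tail : ∀ e → ¬ Near (h e) → ¬ Near (t e)
      far-tail e f (inj₁ p) = f (inj₂ (e , sym p , refl))
      far-tail e f (inj₂ (g , _ , q)) = true≢false (tail-source e) (trans (cong A (sym q)) (head-sink g))
      P-closed : Closed P
      P-closed e p = P-far (t e) (far-tail e (λ q → true≢false p (P-near (h e) q)))
      conn : Connected (not ∘ P)
      conn K unc x y x∈ y∈ = trans (to-a x (near x (not⇒≡f x∈))) (sym (to-a y (near y (not⇒≡f y∈))))
        where
        to-a : ∀ x → Near x → K x ≡ K a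
        to-a x (inj₁ p) = cong K (sym p)
        to-a x (inj₂ (e , refl , refl)) = sym (xor≡f⇒≡ (unc e (≡f⇒not (P-near (t e) (inj₁ refl))) (≡f⇒not (P-near (h e) (inj₂ (e , refl , refl))))))
      finish : (∃ λ e → t e ≡ a ⊎ h e ≡ a) → (∃ λ e → t e ≡ b ⊎ h e ≡ b) →
               (∃ λ C → (∀ z → C z ≡ true → P z ≡ true) × C b ≡ true × Uncut P C × Dibond C) → ⊥
      finish (e , inj₂ p) _ _ = source a∈ e p
      finish (e , inj₁ _) (f , inj₁ p) _ = sink b∉ f p
      finish (e , inj₁ refl) (f , inj₂ refl) (C , C⊆P , Cb , uncut , d) =
        trivial-side C d f e
          (trans (xor≡f⇒≡ (uncut f (P-far (t f) (far-tail f far-b)) (P-far (h f) far-b))) Cb , Cb)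
          (≢true⇒≡f (λ c → true≢false (C⊆P _ c) (P-near (t e) (inj₁ refl))) ,
           ≢true⇒≡f (λ c → true≢false (C⊆P _ c) (P-near (h e) (inj₂ (e , refl , refl)))))

    -- If `a` met every edge, minimality of its star would make `b` meet every edge too. By
    -- connectivity `a` and `b` would then be the only vertices, an even number.
    not-star : ∀ a b → a ≢ b → ¬ (∀ e → δ ⟪ a ⟫ e ≡ true)
    not-star a b a≢b star = true≢false odd (trans (sum-cong-≗ (λ z → sym (all z)))
      (trans (∑-distrib-+ ⟪ a ⟫ ⟪ b ⟫) (cong₂ _xor_ (sum-single a) (sum-single b))))
      where
      both : ⟪ a ⟫ ⊑ ⟪ b ⟫
      both = proj₂ (bond (pure a)) ⟪ b ⟫ (proj₁ (bond (pure b))) (λ e _ → star e)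
      all : ∀ z → ⟪ a ⟫ z xor ⟪ b ⟫ z ≡ true
      all z = trans (connected (λ z → ⟪ a ⟫ z xor ⟪ b ⟫ z)
          (λ e → trans (δ-xor ⟪ a ⟫ ⟪ b ⟫ e) (cong₂ _xor_ (star e) (both e (star e)))) z a)
        (cong₂ _xor_ (∈⟪⟫ {z = a} refl) (∉⟪⟫ (a≢b ∘ sym)))

    second-source : ∀ e → ∃ λ a → A a ≡ true × t e ≢ a
    second-source e with Finₚ.any? (λ a → (A a Boolₚ.≟ true) ×-dec ¬? (t e ≟ a))
    ... | yes p = p
    ... | no n = ⊥-elim (not-star (t e) (h e) (no-loop e) (λ f →
      let p = decidable-stable (t e ≟ t f) (λ q → n (t f , tail-source f , q)) in
      cong₂ _xor_ (∈⟪⟫ p) (∉⟪⟫ (λ q → no-loop f (trans (sym p) q)))))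

    second-sink : ∀ e → ∃ λ b → A b ≡ false × h e ≢ b
    second-sink e with Finₚ.any? (λ b → (A b Boolₚ.≟ false) ×-dec ¬? (h e ≟ b))
    ... | yes p = p
    ... | no n = ⊥-elim (not-star (h e) (t e) (no-loop e ∘ sym) (λ f →
      let p = decidable-stable (h e ≟ h f) (λ q → n (h f , head-sink f , q)) in
      cong₂ _xor_ (∉⟪⟫ (λ q → no-loop f (trans (sym q) p))) (∈⟪⟫ p)))

    S : Subset (V D)
    S = tabulate A

    in-S : ∀ {z} → A z ≡ true → z ∈ S
    in-S {z} p = lookup⇒[]= z S (trans (lookup∘tabulate A z) p)

    S-in : ∀ {z} → z ∈ S → A z ≡ true
    S-in {z} p = trans (sym (lookup∘tabulate A z)) ([]=⇒lookup p)

    out-S : ∀ {z} → A z ≡ false → z ∉ S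
    out-S p q = true≢false (S-in q) p

    contradiction : ⊥
    contradiction = with-vertex λ v →
      let e , _ = touched v
          a , a∈ , a≢ = second-source e
          b , b∉ , b≢ = second-sink e
      in no-one-direction
        ((S , two⇒2≤ S a≢ (in-S (tail-source e)) (in-S a∈) ,
          two⇒2≤ (∁ S) b≢ (x∉p⇒x∈∁p (out-S (head-sink e))) (x∉p⇒x∈∁p (out-S b∉)) ,
          (λ f → in-S (tail-source f) , out-S (head-sink f)) ,
          (λ a b p q → complete a b (S-in p) (≢true⇒≡f (q ∘ in-S))) , no-parallel) , odd-V odd)

  -- Weight one everywhere, replaced by `a` at `u` and by `b` at `v` when these are distinct. With
  -- `u` in both places and `b` equal to `true`, the weight at `u` is `a`.
  weight₂ : Fin (V D) → Fin (V D) → Bool → Bool → VS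
  weight₂ u v a b z = true xor ((⟪ u ⟫ z ∧ not a) xor (⟪ v ⟫ z ∧ not b))

  weight₂-sum : ∀ u v a b X → sum (λ z → X z ∧ weight₂ u v a b z) ≡ sum X xor ((X u ∧ not a) xor (X v ∧ not b))
  weight₂-sum u v a b X = begin
    sum (λ z → X z ∧ weight₂ u v a b z)
      ≡⟨ sum-cong-≗ (λ z → ==⇒≡ (taut 5 (λ x p q a b → (x ∧ (true xor ((p ∧ a) xor (q ∧ b)))) == (x xor ((p ∧ (x ∧ a)) xor (q ∧ (x ∧ b))))) refl (X z) (⟪ u ⟫ z) (⟪ v ⟫ z) (not a) (not b))) ⟩
    sum (λ z → X z xor ((⟪ u ⟫ z ∧ (X z ∧ not a)) xor (⟪ v ⟫ z ∧ (X z ∧ not b))))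
      ≡⟨ ∑-distrib-+ X (λ z → (⟪ u ⟫ z ∧ (X z ∧ not a)) xor (⟪ v ⟫ z ∧ (X z ∧ not b))) ⟩
    sum X xor sum (λ z → (⟪ u ⟫ z ∧ (X z ∧ not a)) xor (⟪ v ⟫ z ∧ (X z ∧ not b)))
      ≡⟨ cong (sum X xor_) (trans (∑-distrib-+ (λ z → ⟪ u ⟫ z ∧ (X z ∧ not a)) (λ z → ⟪ v ⟫ z ∧ (X z ∧ not b)))
           (cong₂ _xor_ (sum-⟪⟫ u (λ z → X z ∧ not a)) (sum-⟪⟫ v (λ z → X z ∧ not b)))) ⟩
    sum X xor ((X u ∧ not a) xor (X v ∧ not b)) ∎
    where open ≡-Reasoning

  -- A dibond of even weight with u and v on one side: the other side is even, so this side has no edges.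
  module _ (u v : Fin (V D)) (a b : Bool) (pure : ∀ z → z ≢ u → z ≢ v → Dibond ⟪ z ⟫) where

    light-side : ∀ R → Dibond R → R u ≡ false → R v ≡ false → sum (λ z → R z ∧ weight₂ u v a b z) ≡ false →
                 sum R ≡ false × (∀ x y → R x ≡ false → R y ≡ false → x ≡ y)
    light-side R d u∉ v∉ p = even , λ x y x∉ y∉ → edgeless (not ∘ R) (bond⇒connected (not ∘ R) (bond (Dibond-not d)))
      (λ { e (q , r) → even-side R d (λ z z∈ → pure z (λ { refl → true≢false z∈ u∉ }) (λ { refl → true≢false z∈ v∉ })) even e (not⇒≡f q , not⇒≡f r) })
      x y (≡f⇒not x∉) (≡f⇒not y∉)
      where
      even : sum R ≡ false
      even = trans (sym (Boolₚ.xor-identityʳ (sum R))) (trans (cong (sum R xor_) (sym (cong₂ (λ x y → (x ∧ not a) xor (y ∧ not b)) u∉ v∉)))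
        (trans (sym (weight₂-sum u v a b R)) p))

  -- By `light-side` the dibond of even weight is the star of `u`, with an even number of vertices
  -- on the other side. So `u` is pure as well and the total number of vertices is odd.
  almost-pure : ∀ u → (∀ z → z ≢ u → Dibond ⟪ z ⟫) → ⊥
  almost-pure u pure = bad-dibond c c-even bad
    where
    c : VS
    -- The other vertices weigh `not N` in total, so `u` must weigh `not N` too.
    c = weight₂ u u (not N) true
    c-even : sum c ≡ false
    c-even = trans (weight₂-sum u u (not N) true (λ _ → true)) (==⇒≡ (taut 1 (λ n → (n xor ((not (not n)) xor false)) == false) refl N))
    bad′ : ∀ R → Dibond R → R u ≡ false → sum (λ z → R z ∧ c z) ≡ false → ⊥
    bad′ R d u∉ p with light-side u u (not N) true (λ z z≢ _ → pure z z≢) R d u∉ u∉ p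
    ... | even , single = AllPure.contradiction all-pure odd
      where
      same : (not ∘ R) ≗ ⟪ u ⟫
      same z = iff⇒≡ (λ q → ∈⟪⟫ (single u z u∉ (not⇒≡f q))) (λ q → ≡f⇒not (trans (cong R (sym (⟪⟫⇒≡ q))) u∉))
      all-pure : ∀ z → Dibond ⟪ z ⟫
      all-pure z with z ≟ u
      ... | yes refl = Dibond-cong same (Dibond-not d)
      ... | no n = pure z n
      odd : N ≡ true
      odd = trans (sym (Boolₚ.xor-identityʳ N)) (trans (cong (N xor_) (sym even)) (trans (sym (sum-not R)) (trans (sum-cong-≗ same) (sum-single u))))
    bad : ∀ X → Dibond X → sum (λ z → X z ∧ c z) ≡ false → ⊥
    bad X d p with bool-cases (X u)
    ... | inj₂ q = bad′ X d q p
    ... | inj₁ q = bad′ (not ∘ X) (Dibond-not d) (cong not q) (sum-complement c X c-even p)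

  -- Two impure vertices: diamonds.

  module TwoInner (u v : Fin (V D)) (u≢v : u ≢ v) (pure : ∀ z → z ≢ u → z ≢ v → Dibond ⟪ z ⟫)
    (¬pure-u : ¬ Dibond ⟪ u ⟫) (¬pure-v : ¬ Dibond ⟪ v ⟫) where

    abstract
      in-edge : ∀ w → ¬ Dibond ⟪ w ⟫ → ∃ λ e → h e ≡ w
      in-edge w n with Finₚ.any? (λ e → h e ≟ w)
      ... | yes p = p
      ... | no m  = ⊥-elim (n (dibond (star-is-bond w) (inj₁ (source⇒closed D w (λ e p → m (e , p))))))

      out-edge : ∀ w → ¬ Dibond ⟪ w ⟫ → ∃ λ e → t e ≡ w
      out-edge w n with Finₚ.any? (λ e → t e ≟ w)
      ... | yes p = p
      ... | no m  = ⊥-elim (n (dibond (star-is-bond w) (inj₂ (sink⇒closed D w (λ e p → m (e , p))))))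

    -- An edge `e` into `w` has both ends in `X` and in `X′`, both being closed. So `J e` is odd on
    -- each cut and even on their sum, whereas the symmetric difference consists of an odd number of
    -- pure vertices away from `e`.
    same-orientation : ∀ w w′ X X′ → ¬ Dibond ⟪ w ⟫ → (∀ z → z ≢ w → z ≢ w′ → Dibond ⟪ z ⟫) →
      Dibond X → Closed X → Dibond X′ → Closed X′ →
      X w ≡ true → X′ w ≡ true → X w′ ≡ false → X′ w′ ≡ false → sum X xor sum X′ ≡ true → ⊥
    same-orientation w w′ X X′ ¬pw pure d c d′ c′ p p′ q q′ s = at (in-edge w ¬pw)
      where
      R : VS
      R z = X z xor X′ z
      R-pure : all-pure-in R
      R-pure z r = pure z (λ { refl → true≢false r (cong₂ _xor_ p p′) }) (λ { refl → true≢false r (cong₂ _xor_ q q′) })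
      R-sum : sum R ≡ true
      R-sum = trans (∑-distrib-+ X X′) s
      at : (∃ λ e → h e ≡ w) → ⊥
      at (e , refl) = true≢false (trans (pure-value e R R-pure (cong₂ _xor_ (c e p) (c′ e p′) , cong₂ _xor_ p p′)) R-sum)
        (trans (⟨⟩-xor (J e) X X′) (cong₂ _xor_ (J-odd e d (trans (c e p) (sym p))) (J-odd e d′ (trans (c′ e p′) (sym p′)))))

    module Opposite (X X′ : VS) (d : Dibond X) (c : Closed X) (d′ : Dibond X′) (c′ : Closed X′)
      (u∈ : X u ≡ true) (v∈ : X′ v ≡ true) (v∉ : X v ≡ false) (u∉ : X′ u ≡ false)
      (sums : sum X xor sum X′ ≡ not N) where

      -- The vertices in both or in neither of `X` and `X′`: the prospective rim, which misses `u`
      -- and `v`.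
      R : VS
      R z = true xor (X z xor X′ z)

      R-sum : sum R ≡ true
      R-sum = begin
        sum R                           ≡⟨ ∑-distrib-+ (λ _ → true) (λ z → X z xor X′ z) ⟩
        N xor sum (λ z → X z xor X′ z)  ≡⟨ cong (N xor_) (trans (∑-distrib-+ X X′) sums) ⟩
        N xor not N                     ≡⟨ ==⇒≡ (taut 1 (λ n → (n xor not n) == true) refl N) ⟩
        true                            ∎
        where open ≡-Reasoning

      R-pure : all-pure-in R
      R-pure z r = pure z (λ { refl → true≢false r (cong₂ (λ a b → true xor (a xor b)) u∈ u∉) })
                          (λ { refl → true≢false r (cong₂ (λ a b → true xor (a xor b)) v∉ v∈) })

      R-value : ∀ e → X (t e) ≡ X (h e) → X′ (t e) ≡ X′ (h e) → ⟨ J e , R ⟩ ≡ false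
      R-value e p q = trans (⟨⟩-xor (J e) (λ _ → true) (λ z → X z xor X′ z)) (cong₂ _xor_ (⟨⟩-full (J e))
        (trans (⟨⟩-xor (J e) X X′) (cong₂ _xor_ (J-odd e d p) (J-odd e d′ q))))

      -- Such an edge avoids both cuts and has both ends outside `R`; then `J e` meets `R` oddly by
      -- counting stars and evenly by `R-value`.
      no-difference-edge : ∀ e → X (t e) ≡ X (h e) → X′ (t e) ≡ X′ (h e) → X (t e) ≡ not (X′ (t e)) → ⊥
      no-difference-edge e p q r = true≢false (trans (pure-value e R R-pure (out (t e) r , out (h e) (trans (sym p) (trans r (cong not q))))) R-sum) (R-value e p q)
        where
        out : ∀ z → X z ≡ not (X′ z) → R z ≡ false
        out z s = trans (cong (λ a → true xor (a xor X′ z)) s) (==⇒≡ (taut 1 (λ a → (true xor (not a xor a)) == false) refl (X′ z)))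

      -- The component `C` of `P` around `e` is a dibond made of pure vertices. If `C` is even, `g`
      -- contradicts `even-side`. If `C` is odd, the rest of `R` is even and avoids `e`, so `J e`
      -- meets `R` oddly, against `R-value`.
      no-edge-inside : ∀ P → Directed P → Connected (not ∘ P) → (∀ z → P z ≡ true → R z ≡ true) →
        (∀ e → Inside P e → X (t e) ≡ X (h e) × X′ (t e) ≡ X′ (h e)) → ∀ g → Outside P g → ∀ e → Inside P e → ⊥
      no-edge-inside P dir conn P⊆R flat g (g₁ , g₂) e (e₁ , e₂) with component P dir conn (t g) (t e) g₁ e₁
      ... | C , C⊆P , Ct , uncut , dC with bool-cases (sum C)
      ...   | inj₂ even = even-side C dC (λ z p → R-pure z (P⊆R z (C⊆P z p))) even g
              (≢true⇒≡f (λ p → true≢false (C⊆P _ p) g₁) , ≢true⇒≡f (λ p → true≢false (C⊆P _ p) g₂))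
      ...   | inj₁ odd = true≢false value (R-value e (proj₁ (flat e (e₁ , e₂))) (proj₂ (flat e (e₁ , e₂))))
        where
        R∖C : VS
        R∖C z = R z xor C z
        Ch : C (h e) ≡ true
        Ch = trans (sym (xor≡f⇒≡ (uncut e e₁ e₂))) Ct
        pure′ : all-pure-in R∖C
        pure′ z p = R-pure z (taut 2 (λ r c → (c ⇒ r) ⇒ (r xor c) ⇒ r) refl (R z) (C z) ∙ ⇒-intro (P⊆R z ∘ C⊆P z) ∙ p)
        value : ⟨ J e , R ⟩ ≡ true
        value = begin
          ⟨ J e , R ⟩
            ≡⟨ ⟨⟩-cong (J e) {R} {λ z → R∖C z xor C z} (λ z → ==⇒≡ (taut 2 (λ r c → r == ((r xor c) xor c)) refl (R z) (C z))) ⟩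
          ⟨ J e , (λ z → R∖C z xor C z) ⟩
            ≡⟨ ⟨⟩-xor (J e) R∖C C ⟩
          ⟨ J e , R∖C ⟩ xor ⟨ J e , C ⟩
            ≡⟨ cong₂ _xor_ (trans (pure-value e R∖C pure′ (cong₂ _xor_ (P⊆R _ e₁) Ct , cong₂ _xor_ (P⊆R _ e₂) Ch))
                                  (trans (∑-distrib-+ R C) (cong₂ _xor_ R-sum odd)))
                           (J-odd e dC (trans Ct (sym Ch))) ⟩
          true ∎
          where open ≡-Reasoning

    module Half (w w′ : Fin (V D)) (pure : ∀ z → z ≢ w → z ≢ w′ → Dibond ⟪ z ⟫)
      (X X′ : VS) (d : Dibond X) (c : Closed X) (d′ : Dibond X′) (c′ : Closed X′)
      (w∈ : X w ≡ true) (w′∈ : X′ w′ ≡ true) (w∉ : X′ w ≡ false)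
      (no-difference-edge : ∀ e → X (t e) ≡ X (h e) → X′ (t e) ≡ X′ (h e) → X (t e) ≡ not (X′ (t e)) → ⊥) where

      closed-∉ : ∀ {Y} → Closed Y → ∀ e → Y (t e) ≡ false → Y (h e) ≡ false
      closed-∉ cY e p = ≢true⇒≡f (λ q → true≢false (cY e q) p)

      no-edge : ∀ e → X (t e) ≡ true → X (h e) ≡ true → X′ (t e) ≡ false → X′ (h e) ≡ false → ⊥
      no-edge e p q r s = no-difference-edge e (trans p (sym q)) (trans r (sym s)) (trans p (sym (cong not r)))

      before : ∀ e → h e ≡ w → X (t e) ≡ true × X′ (t e) ≡ true
      before e refl = c e w∈ , decidable-stable (X′ (t e) Boolₚ.≟ true) (λ n → no-edge e (c e w∈) w∈ (≢true⇒≡f n) w∉)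

      after : ∀ e → t e ≡ w → X (h e) ≡ false × X′ (h e) ≡ false
      after e refl = ≢true⇒≡f (λ p → no-edge e w∈ p w∉ (closed-∉ {X′} c′ e w∉)) , closed-∉ {X′} c′ e w∉

      X-conn : Connected X
      X-conn = bond⇒connected X (bond d)

      X′-conn : Connected (not ∘ X′)
      X′-conn = bond⇒connected (not ∘ X′) (bond (Dibond-not d′))

      -- Any other such `s` is a source or a sink. A source has an out-edge within the connected set
      -- `X`, whose head misses `X′` as `X′` is closed. A sink has an in-edge within the complement
      -- of `X′`, whose tail is in `X` as `X` is closed. Both contradict `no-edge`.
      only : ∀ s → X s ≡ true → X′ s ≡ false → s ≡ w
      only s s∈ s∉ with s ≟ w
      ... | yes p = p
      ... | no s≢w with pure-ends s (pure s s≢w (λ { refl → true≢false w′∈ s∉ }))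
                      | neighbour X X-conn s w s∈ w∈ s≢w
                      | neighbour (not ∘ X′) X′-conn s w (≡f⇒not s∉) (≡f⇒not w∉) s≢w
      ...   | inj₁ no-in | e , _ , inj₂ p | _ = ⊥-elim (no-in e p)
      ...   | inj₁ no-in | e , (p , q) , inj₁ refl | _ = ⊥-elim (no-edge e p q s∉ (closed-∉ {X′} c′ e s∉))
      ...   | inj₂ no-out | _ | e , _ , inj₁ p = ⊥-elim (no-out e p)
      ...   | inj₂ no-out | _ | e , (p , q) , inj₂ refl = ⊥-elim (no-edge e (c e s∈) s∈ (not⇒≡f p) s∉)

      to-w : (∀ e → Inside X e → Inside X′ e → ⊥) → ∀ z → X z ≡ true → X′ z ≡ true → ∃ λ e → t e ≡ z × h e ≡ w
      to-w none z z∈ z∈′ with neighbour X X-conn z w z∈ w∈ (λ { refl → true≢false z∈′ w∉ })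
      ... | e , (p , q) , inj₁ refl with bool-cases (X′ (h e))
      ...   | inj₁ r = ⊥-elim (none e (p , q) (z∈′ , r))
      ...   | inj₂ r = e , refl , only (h e) q r
      to-w none z z∈ z∈′ | e , (p , q) , inj₂ refl = ⊥-elim (none e (p , q) (c′ e z∈′ , z∈′))

      from-w : (∀ e → Outside X e → Outside X′ e → ⊥) → ∀ z → X z ≡ false → X′ z ≡ false → ∃ λ e → t e ≡ w × h e ≡ z
      from-w none z z∉ z∉′ with neighbour (not ∘ X′) X′-conn z w (≡f⇒not z∉′) (≡f⇒not w∉) (λ { refl → true≢false w∈ z∉ })
      ... | e , (p , q) , inj₂ refl with bool-cases (X (t e))
      ...   | inj₂ r = ⊥-elim (none e (r , z∉) (not⇒≡f p , not⇒≡f q))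
      ...   | inj₁ r = e , only (t e) r (not⇒≡f p) , refl
      from-w none z z∉ z∉′ | e , (p , q) , inj₁ refl = ⊥-elim (none e (z∉ , closed-∉ {X} c e z∉) (z∉′ , not⇒≡f q))

    -- Only `u` lies in `X` alone and only `v` in `X′` alone. The common part `P` and the outer part
    -- `Q` contain no edges, so connectivity of `X`, `X′` and their complements joins every rim
    -- vertex to both hubs.
    opposite : ∀ X X′ → Dibond X → Closed X → Dibond X′ → Closed X′ →
      X u ≡ true → X′ v ≡ true → X v ≡ false → X′ u ≡ false → sum X xor sum X′ ≡ not N → ⊥
    opposite X X′ d c d′ c′ u∈ v∈ v∉ u∉ sums = no-diamond ((u , v , u≢v , 5≤V , rim , hubs) , odd-V N-odd)
      where
      open Opposite X X′ d c d′ c′ u∈ v∈ v∉ u∉ sums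
      module U = Half u v pure X X′ d c d′ c′ u∈ v∈ u∉ no-difference-edge
      module W = Half v u (λ z p q → pure z q p) X′ X d′ c′ d c v∈ u∈ v∉
        (λ e p q r → no-difference-edge e q p (trans (sym (Boolₚ.not-involutive (X (t e)))) (cong not (sym r))))
      p₀ q₀ : Fin (V D)
      p₀ = t (proj₁ (in-edge u ¬pure-u))
      q₀ = h (proj₁ (out-edge u ¬pure-u))
      p₀∈ : X p₀ ≡ true × X′ p₀ ≡ true
      p₀∈ = U.before _ (proj₂ (in-edge u ¬pure-u))
      q₀∉ : X q₀ ≡ false × X′ q₀ ≡ false
      q₀∉ = U.after _ (proj₂ (out-edge u ¬pure-u))
      P Q : VS
      P = X ⊓ X′
      Q = (not ∘ X) ⊓ (not ∘ X′)
      P-closed : Closed P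
      P-closed e p with ∧-true {X (h e)} p
      ... | a , b = cong₂ _∧_ (c e a) (c′ e b)
      Q-closed : Closed (not ∘ Q)
      Q-closed e p = taut 4 (λ a b x y → (b ⇒ a) ⇒ (y ⇒ x) ⇒ not (not b ∧ not y) ⇒ not (not a ∧ not x)) refl (X (t e)) (X (h e)) (X′ (t e)) (X′ (h e))
        ∙ ⇒-intro (c e) ∙ ⇒-intro (c′ e) ∙ p
      -- The complement of `P` is the union of the connected complements of `X` and `X′`, which
      -- share `q₀`. Dually, `Q-conn` glues `X` and `X′` at `p₀`.
      P-conn : Connected (not ∘ P)
      P-conn K unc x y x∉ y∉ = trans (to-q x x∉) (sym (to-q y y∉))
        where
        to-q : ∀ x → not (P x) ≡ true → K x ≡ K q₀
        to-q x x∉ with bool-cases (X x)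
        ... | inj₂ p = W.X′-conn K (λ e a b → unc e (widen (t e) a) (widen (h e) b)) x q₀ (≡f⇒not p) (≡f⇒not (proj₁ q₀∉))
          where
          widen : ∀ z → not (X z) ≡ true → not (P z) ≡ true
          widen z a = cong (λ b → not (b ∧ X′ z)) (not⇒≡f a)
        ... | inj₁ p = U.X′-conn K (λ e a b → unc e (widen (t e) a) (widen (h e) b)) x q₀
                         (trans (sym (cong (λ b → not (b ∧ X′ x)) p)) x∉) (≡f⇒not (proj₂ q₀∉))
          where
          widen : ∀ z → not (X′ z) ≡ true → not (P z) ≡ true
          widen z a = cong not (trans (cong (X z ∧_) (not⇒≡f a)) (Boolₚ.∧-zeroʳ (X z)))
      Q-conn : Connected (not ∘ Q)
      Q-conn K unc x y x∉ y∉ = trans (to-p x x∉) (sym (to-p y y∉))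
        where
        to-p : ∀ x → not (Q x) ≡ true → K x ≡ K p₀
        to-p x x∉ with bool-cases (X x)
        ... | inj₁ p = U.X-conn K (λ e a b → unc e (widen (t e) a) (widen (h e) b)) x p₀ p (proj₁ p₀∈)
          where
          widen : ∀ z → X z ≡ true → not (Q z) ≡ true
          widen z a = cong (λ b → not (not b ∧ not (X′ z))) a
        ... | inj₂ p = W.X-conn K (λ e a b → unc e (widen (t e) a) (widen (h e) b)) x p₀
                         (trans (sym (trans (cong (λ b → not (not b ∧ not (X′ x))) p) (Boolₚ.not-involutive (X′ x)))) x∉) (proj₂ p₀∈)
          where
          widen : ∀ z → X′ z ≡ true → not (Q z) ≡ true
          widen z a = cong not (trans (cong (λ b → not (X z) ∧ not b) a) (Boolₚ.∧-zeroʳ (not (X z))))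
      P-edgeless : ∀ e → Inside X e → Inside X′ e → ⊥
      P-edgeless e (a , b) (a′ , b′) = no-edge-inside P (inj₁ P-closed) P-conn
        (λ z → taut 2 (λ x y → (x ∧ y) ⇒ (true xor (x xor y))) refl (X z) (X′ z) ∙_)
        (λ f (p , q) → trans (proj₁ (∧-true p)) (sym (proj₁ (∧-true q))) , trans (proj₂ (∧-true {X (t f)} p)) (sym (proj₂ (∧-true {X (h f)} q))))
        (proj₁ (out-edge u ¬pure-u))
        (trans (cong P (proj₂ (out-edge u ¬pure-u))) (cong₂ _∧_ u∈ u∉) , cong (_∧ X′ q₀) (proj₁ q₀∉))
        e (cong₂ _∧_ a a′ , cong₂ _∧_ b b′)
      Q-edgeless : ∀ e → Outside X e → Outside X′ e → ⊥
      Q-edgeless e (a , b) (a′ , b′) = no-edge-inside Q (inj₂ Q-closed) Q-conn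
        (λ z → taut 2 (λ x y → (not x ∧ not y) ⇒ (true xor (x xor y))) refl (X z) (X′ z) ∙_)
        (λ f (p , q) → trans (not⇒≡f (proj₁ (∧-true p))) (sym (not⇒≡f (proj₁ (∧-true q)))) ,
                       trans (not⇒≡f (proj₂ (∧-true {not (X (t f))} p))) (sym (not⇒≡f (proj₂ (∧-true {not (X (h f))} q)))))
        (proj₁ (in-edge u ¬pure-u))
        (cong (λ b → not b ∧ not (X′ p₀)) (proj₁ p₀∈) ,
         trans (cong Q (proj₂ (in-edge u ¬pure-u))) (cong₂ (λ x y → not x ∧ not y) u∈ u∉))
        e (cong₂ (λ x y → not x ∧ not y) a a′ , cong₂ (λ x y → not x ∧ not y) b b′)
      data Position (z : Fin (V D)) : Set where
        lower : X z ≡ true → X′ z ≡ true → Position z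
        upper : X z ≡ false → X′ z ≡ false → Position z
        at-u  : z ≡ u → Position z
        at-v  : z ≡ v → Position z
      position : ∀ z → Position z
      position z with bool-cases (X z) | bool-cases (X′ z)
      ... | inj₁ p | inj₁ q = lower p q
      ... | inj₁ p | inj₂ q = at-u (U.only z p q)
      ... | inj₂ p | inj₁ q = at-v (W.only z q p)
      ... | inj₂ p | inj₂ q = upper p q
      rim : ∀ z → z ≢ u → z ≢ v → OutVertex D u v z ⊎ InVertex D u v z
      rim z z≢u z≢v with position z
      ... | at-u p = ⊥-elim (z≢u p)
      ... | at-v p = ⊥-elim (z≢v p)
      ... | lower p p′ with U.to-w P-edgeless z p p′ | W.to-w (λ e i i′ → P-edgeless e i′ i) z p′ p
      ...   | e₁ , a₁ , b₁ | e₂ , a₂ , b₂ = inj₁ (e₁ , e₂ , a₁ , b₁ , a₂ , b₂ , all)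
        where
        all : ∀ f → t f ≡ z ⊎ h f ≡ z → f ≡ e₁ ⊎ f ≡ e₂
        all f (inj₂ refl) = ⊥-elim (P-edgeless f (c f p , p) (c′ f p′ , p′))
        all f (inj₁ refl) with position (h f)
        ... | at-u q = inj₁ (no-parallel f e₁ (sym a₁) (trans q (sym b₁)))
        ... | at-v q = inj₂ (no-parallel f e₂ (sym a₂) (trans q (sym b₂)))
        ... | lower q q′ = ⊥-elim (P-edgeless f (p , q) (p′ , q′))
        -- An edge from a source to a sink would bypass the path of length two through `u`.
        ... | upper q q′ with U.from-w Q-edgeless (h f) q q′
        ...   | g , a , b = ⊥-elim (no-shortcut f e₁ g (sym a₁) (trans b₁ (sym a)) b)
      rim z z≢u z≢v | upper p p′ with U.from-w Q-edgeless z p p′ | W.from-w (λ e i i′ → Q-edgeless e i′ i) z p′ p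
      ...   | e₁ , a₁ , b₁ | e₂ , a₂ , b₂ = inj₂ (e₁ , e₂ , a₁ , b₁ , a₂ , b₂ , all)
        where
        all : ∀ f → t f ≡ z ⊎ h f ≡ z → f ≡ e₁ ⊎ f ≡ e₂
        all f (inj₁ refl) = ⊥-elim (Q-edgeless f (p , U.closed-∉ {X} c f p) (p′ , U.closed-∉ {X′} c′ f p′))
        all f (inj₂ refl) with position (t f)
        ... | at-u q = inj₁ (no-parallel f e₁ (trans q (sym a₁)) (sym b₁))
        ... | at-v q = inj₂ (no-parallel f e₂ (trans q (sym a₂)) (sym b₂))
        ... | upper q q′ = ⊥-elim (Q-edgeless f (q , p) (q′ , p′))
        ... | lower q q′ with U.to-w P-edgeless (t f) q q′
        ...   | g , a , b = ⊥-elim (no-shortcut f g e₁ (sym a) (trans b (sym a₁)) b₁)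
      hubs : ∀ f → ¬ ((t f ≡ u ⊎ t f ≡ v) × (h f ≡ u ⊎ h f ≡ v))
      hubs f (inj₁ refl , inj₁ q) = no-loop f (sym q)
      hubs f (inj₂ refl , inj₂ q) = no-loop f (sym q)
      hubs f (inj₁ refl , inj₂ refl) = true≢false (c′ f v∈) u∉
      hubs f (inj₂ refl , inj₁ refl) = true≢false (c f u∈) v∉
      N-odd : N ≡ true
      N-odd = begin
        N ≡⟨ sym (Boolₚ.xor-identityʳ N) ⟩
        N xor false
          ≡⟨ cong (N xor_) (sym (trans (∑-distrib-+ ⟪ u ⟫ ⟪ v ⟫) (cong₂ _xor_ (sum-single u) (sum-single v)))) ⟩
        N xor sum (λ z → ⟪ u ⟫ z xor ⟪ v ⟫ z)
          ≡⟨ sym (∑-distrib-+ (λ _ → true) (λ z → ⟪ u ⟫ z xor ⟪ v ⟫ z)) ⟩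
        sum (λ z → true xor (⟪ u ⟫ z xor ⟪ v ⟫ z))
          ≡⟨ sum-cong-≗ (λ z → cong (true xor_) (same z (position z))) ⟩
        sum R ≡⟨ R-sum ⟩
        true ∎
        where
        open ≡-Reasoning
        same : ∀ z → Position z → ⟪ u ⟫ z xor ⟪ v ⟫ z ≡ X z xor X′ z
        same z (at-u refl) = trans (cong₂ _xor_ (∈⟪⟫ {z = u} refl) (∉⟪⟫ (u≢v ∘ sym))) (sym (cong₂ _xor_ u∈ u∉))
        same z (at-v refl) = trans (cong₂ _xor_ (∉⟪⟫ u≢v) (∈⟪⟫ {z = v} refl)) (sym (cong₂ _xor_ v∉ v∈))
        same z (lower p q) = trans (cong₂ _xor_ (∉⟪⟫ {z = u} {z} (λ { refl → true≢false q u∉ })) (∉⟪⟫ {z = v} {z} (λ { refl → true≢false p v∉ }))) (sym (cong₂ _xor_ p q))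
        same z (upper p q) = trans (cong₂ _xor_ (∉⟪⟫ {z = u} {z} (λ { refl → true≢false u∈ p })) (∉⟪⟫ {z = v} {z} (λ { refl → true≢false v∈ q }))) (sym (cong₂ _xor_ p q))
      -- The chain from the empty set through `u` alone, `X` and `X+v` to all vertices is strict,
      -- gaining `u`, `p₀`, `v` and `q₀`. As the number of vertices is odd, four improves to five.
      4≤V : 4 ≤ V D
      4≤V = ℕₚ.≤-trans (s≤s (ℕₚ.≤-trans (s≤s (ℕₚ.≤-trans (s≤s (ℕₚ.≤-trans (s≤s z≤n) one)) two)) three)) (ℕₚ.≤-trans four (∣p∣≤n (tabulate {n = V D} (λ _ → true))))
        where
        X+v : VS
        X+v = add X v
        one : size {V D} (λ _ → false) < size ⟪ u ⟫
        one = size-< {X = λ _ → false} {⟪ u ⟫} (λ _ ()) u (∈⟪⟫ {z = u} refl) refl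
        two : size ⟪ u ⟫ < size X
        two = size-< {X = ⟪ u ⟫} {X} (λ z p → trans (cong X (sym (⟪⟫⇒≡ p))) u∈) p₀ (proj₁ p₀∈) (∉⟪⟫ (λ p → true≢false (trans (cong X′ p) (proj₂ p₀∈)) u∉))
        three : size X < size X+v
        three = size-< {X = X} {X+v} (λ z → add-old X v) v (add-new X v) v∉
        four : size X+v < size {V D} (λ _ → true)
        four = size-< {X = X+v} {λ _ → true} (λ _ _ → refl) q₀ refl (add-∉ X v (proj₁ q₀∉) (λ p → true≢false v∈ (trans (cong X′ p) (proj₂ q₀∉))))
      5≤V : 5 ≤ V D
      5≤V with ℕₚ.m≤n⇒m<n∨m≡n 4≤V
      ... | inj₁ p = p
      ... | inj₂ p = ⊥-elim (true≢false N-odd (trans (sum-true (V D)) (cong parity (sym p))))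

    -- The closed dibonds of even weight for the weights (α, α + N) at (u , v).
    Bad : Bool → Set
    Bad α = ∃ λ X → Dibond X × Closed X ×
      ((X u ≡ true × X v ≡ false × sum X ≡ not α) ⊎ (X u ≡ false × X v ≡ true × sum X ≡ not (α xor N)))

    bad : ∀ α → (Bad α → ⊥) → ⊥
    bad α k = bad-dibond c c-even λ
      { X d@(dibond _ (inj₁ cX)) p → closed X d cX p
      ; X d@(dibond _ (inj₂ cX)) p → closed (not ∘ X) (Dibond-not d) cX (sum-complement c X c-even p) }
      where
      c : VS
      c = weight₂ u v α (α xor N)
      c-even : sum c ≡ false
      c-even = trans (weight₂-sum u v α (α xor N) (λ _ → true)) (==⇒≡ (taut 2 (λ a n → (n xor (not a xor not (a xor n))) == false) refl α N))
      closed : ∀ X → Dibond X → Closed X → sum (λ z → X z ∧ c z) ≡ false → ⊥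
      closed X d cX p with bool-cases (X u) | bool-cases (X v) | trans (sym (weight₂-sum u v α (α xor N) X)) p
      ... | inj₁ a | inj₂ b | q = k (X , d , cX , inj₁ (a , b , xor≡f⇒≡ (trans (cong (sum X xor_) (sym (trans (cong₂ (λ x y → (x ∧ not α) xor (y ∧ not (α xor N))) a b) (Boolₚ.xor-identityʳ (not α))))) q)))
      ... | inj₂ a | inj₁ b | q = k (X , d , cX , inj₂ (a , b , xor≡f⇒≡ (trans (cong (sum X xor_) (sym (cong₂ (λ x y → (x ∧ not α) xor (y ∧ not (α xor N))) a b))) q)))
      -- With `u` and `v` on the same side, `light-side` reduces that side to one vertex.
      ... | inj₂ a | inj₂ b | _ = u≢v (proj₂ (light-side u v α (α xor N) pure X d a b p) u v a b)
      ... | inj₁ a | inj₁ b | _ = u≢v (proj₂ (light-side u v α (α xor N) pure (not ∘ X) (Dibond-not d) (cong not a) (cong not b) (sum-complement c X c-even p)) u v (cong not a) (cong not b))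

    -- The closed bad dibonds for the two values of `α` have sizes of different parity if they
    -- contain the same one of `u` and `v`. Otherwise their sizes add up to `not N`, the condition
    -- in `opposite`.
    contradiction : ⊥
    contradiction = bad false λ b₀ → bad true λ b₁ → combine b₀ b₁
      where
      combine : Bad false → Bad true → ⊥
      combine (X , d , c , inj₁ (a , b , s)) (X′ , d′ , c′ , inj₁ (a′ , b′ , s′)) =
        same-orientation u v X X′ ¬pure-u pure d c d′ c′ a a′ b b′ (cong₂ _xor_ s s′)
      combine (X , d , c , inj₂ (a , b , s)) (X′ , d′ , c′ , inj₂ (a′ , b′ , s′)) =
        same-orientation v u X X′ ¬pure-v (λ z p q → pure z q p) d c d′ c′ b b′ a a′
          (trans (cong₂ _xor_ s s′) (==⇒≡ (taut 1 (λ n → (not n xor not (true xor n)) == true) refl N)))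
      combine (X , d , c , inj₁ (a , b , s)) (X′ , d′ , c′ , inj₂ (a′ , b′ , s′)) =
        opposite X X′ d c d′ c′ a b′ b a′
          (trans (cong₂ _xor_ s s′) (==⇒≡ (taut 1 (λ n → (true xor not (true xor n)) == not n) refl N)))
      combine (X , d , c , inj₂ (a , b , s)) (X′ , d′ , c′ , inj₁ (a′ , b′ , s′)) =
        opposite X′ X d′ c′ d c a′ b b′ a (cong₂ _xor_ s′ s)

  impossible : ⊥
  impossible = two-impure λ u v u≢v pure → decide u v u≢v pure (Dibond? ⟪ u ⟫) (Dibond? ⟪ v ⟫)
    where
    decide : ∀ u v → u ≢ v → (∀ z → z ≢ u → z ≢ v → Dibond ⟪ z ⟫) → Dec (Dibond ⟪ u ⟫) → Dec (Dibond ⟪ v ⟫) → ⊥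
    decide u v u≢v pure _ (yes pv) = almost-pure u other
      where
      other : ∀ z → z ≢ u → Dibond ⟪ z ⟫
      other z p with z ≟ v
      ... | yes refl = pv
      ... | no q = pure z p q
    decide u v u≢v pure (yes pu) (no _) = almost-pure v other
      where
      other : ∀ z → z ≢ v → Dibond ⟪ z ⟫
      other z p with z ≟ u
      ... | yes refl = pu
      ... | no q = pure z q p
    decide u v u≢v pure (no nu) (no nv) = TwoInner.contradiction u v u≢v pure nu nv

-- Induction over cut minors

-- Deleting an isolated vertex keeps all edges and contracting a loop keeps all vertices, so the
-- measure counts both.
order : Digraph → ℕ
order D = V D + E D

ψ-onto-punch : ∀ {m} (e g : Fin (suc m)) → g ≢ e → ∃ λ f → punchIn e f ≡ g
ψ-onto-punch e g g≢e = punchOut (g≢e ∘ sym) , Finₚ.punchIn-punchOut (g≢e ∘ sym)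

contract-edge : ∀ D (e : Fin (E D)) →
  ∃ λ D′ → Σ (Contraction D D′) λ c → Contraction.e c ≡ e × order D′ < order D
contract-edge (record { V = n ; E = suc m ; tail = t ; head = h }) e with t e ≟ h e
... | yes loop = record { V = n ; E = m ; tail = t ∘ punchIn e ; head = h ∘ punchIn e } ,
  record
    { e = e ; φ = λ u → u ; φ-surj = λ w → w , refl ; φ-merge = loop ; φ-only = λ _ _ → inj₁
    ; ψ = punchIn e ; ψ-inj = Finₚ.punchIn-injective e ; ψ-avoid = Finₚ.punchInᵢ≢i e ; ψ-onto = ψ-onto-punch e
    ; tail-ok = λ _ → refl ; head-ok = λ _ → refl } ,
  refl , ℕₚ.+-monoʳ-< n (ℕₚ.n<1+n m)
contract-edge (record { V = zero ; E = suc m ; tail = t ; head = h }) e | no t≢h = ⊥-elim (Finₚ.¬Fin0 (t e))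
contract-edge (record { V = suc n ; E = suc m ; tail = t ; head = h }) e | no t≢h =
  record { V = n ; E = m ; tail = φ ∘ t ∘ punchIn e ; head = φ ∘ h ∘ punchIn e } ,
  record
    { e = e ; φ = φ ; φ-surj = λ w → punchIn (h e) w , surj w ; φ-merge = trans (φ-other t≢h) (sym (φ-head refl)) ; φ-only = only
    ; ψ = punchIn e ; ψ-inj = Finₚ.punchIn-injective e ; ψ-avoid = Finₚ.punchInᵢ≢i e ; ψ-onto = ψ-onto-punch e
    ; tail-ok = λ _ → refl ; head-ok = λ _ → refl } ,
  refl , ℕₚ.+-mono-< (ℕₚ.n<1+n n) (ℕₚ.n<1+n m)
  where
  -- The index `h e` is removed, and that vertex is sent to the image of `t e`.
  φ : Fin (suc n) → Fin n
  φ u with u ≟ h e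
  ... | yes _  = punchOut (t≢h ∘ sym)
  ... | no u≢h = punchOut (u≢h ∘ sym)
  φ-head : ∀ {u} → u ≡ h e → φ u ≡ punchOut (t≢h ∘ sym)
  φ-head {u} p with u ≟ h e
  ... | yes _  = refl
  ... | no u≢h = ⊥-elim (u≢h p)
  φ-other : ∀ {u} (u≢h : u ≢ h e) → φ u ≡ punchOut (u≢h ∘ sym)
  φ-other {u} u≢h with u ≟ h e
  ... | yes p = ⊥-elim (u≢h p)
  ... | no _  = Finₚ.punchOut-cong (h e) refl
  surj : ∀ w → φ (punchIn (h e) w) ≡ w
  surj w = trans (φ-other (Finₚ.punchInᵢ≢i (h e) w)) (trans (Finₚ.punchOut-cong (h e) refl) (Finₚ.punchOut-punchIn (h e)))
  only : ∀ u v → φ u ≡ φ v → u ≡ v ⊎ (u ≡ t e × v ≡ h e) ⊎ (u ≡ h e × v ≡ t e)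
  only u v p = helper (u ≟ h e) (v ≟ h e)
    where
    helper : Dec (u ≡ h e) → Dec (v ≡ h e) → _
    helper (yes a) (yes b) = inj₁ (trans a (sym b))
    helper (yes a) (no b)  = inj₂ (inj₂ (a , sym (Finₚ.punchOut-injective (t≢h ∘ sym) (b ∘ sym) (trans (sym (φ-head a)) (trans p (φ-other b))))))
    helper (no a)  (yes b) = inj₂ (inj₁ (Finₚ.punchOut-injective (a ∘ sym) (t≢h ∘ sym) (trans (sym (φ-other a)) (trans p (φ-head b))) , b))
    helper (no a)  (no b)  = inj₁ (Finₚ.punchOut-injective (a ∘ sym) (b ∘ sym) (trans (sym (φ-other a)) (trans p (φ-other b))))

delete-edge : ∀ D (e : Fin (E D)) → Deletable D e → ∃ λ D′ → Deletion D D′ × order D′ < order D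
delete-edge (record { V = n ; E = suc m ; tail = t ; head = h }) e del =
  record { V = n ; E = m ; tail = t ∘ punchIn e ; head = h ∘ punchIn e } ,
  record
    { e = e ; e-del = del ; φ = λ u → u ; φ-surj = λ w → w , refl ; φ-inj = λ _ _ p → p
    ; ψ = punchIn e ; ψ-inj = Finₚ.punchIn-injective e ; ψ-avoid = Finₚ.punchInᵢ≢i e ; ψ-onto = ψ-onto-punch e
    ; tail-ok = λ _ → refl ; head-ok = λ _ → refl } ,
  ℕₚ.+-monoʳ-< n (ℕₚ.n<1+n m)

delete-vertex : ∀ D (v : Fin (V D)) → (∀ f → tail D f ≢ v × head D f ≢ v) →
                ∃ λ D′ → IsolatedDeletion D D′ × order D′ < order D
delete-vertex (record { V = suc n ; E = m ; tail = t ; head = h }) v iso =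
  record { V = n ; E = m ; tail = λ f → punchOut (proj₁ (iso f) ∘ sym) ; head = λ f → punchOut (proj₂ (iso f) ∘ sym) } ,
  record
    { v = v ; v-iso = iso ; φ = punchIn v ; φ-inj = Finₚ.punchIn-injective v ; φ-avoid = Finₚ.punchInᵢ≢i v ; φ-onto = ψ-onto-punch v
    ; ψ = λ f → f ; ψ-inj = λ _ _ p → p ; ψ-surj = λ g → g , refl
    ; tail-ok = λ f → sym (Finₚ.punchIn-punchOut (proj₁ (iso f) ∘ sym))
    ; head-ok = λ f → sym (Finₚ.punchIn-punchOut (proj₂ (iso f) ∘ sym)) } ,
  ℕₚ.+-monoˡ-< m (ℕₚ.n<1+n n)

Excluded : Digraph → Set
Excluded D = ¬ HasOddDiamondCutMinor D × ¬ HasOddOneDirectionCutMinor D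

excluded-minor : ∀ {D D₁} → (∀ {D′} → CutMinor D₁ D′ → CutMinor D D′) → Excluded D → Excluded D₁
excluded-minor lift (dia , one) = (λ { (D′ , m , p) → dia (D′ , lift m , p) }) , (λ { (D′ , m , p) → one (D′ , lift m , p) })

-- Minimality is expressed by induction: every smaller cut minor inherits the exclusions and so has
-- an odd dijoin. Vertex removal then yields `Touched`, contraction `EdgeCritical`, and deletion the
-- two restrictions on edges.
excluded⇒dijoin : ∀ k D → order D < k → Excluded D → ∃ (Cuts.OddDijoin D)
excluded⇒dijoin (suc k) D (s≤s le) excluded = decidable-stable (Cuts.∃OddDijoin? D) λ n → impossible n (isolated n)
  where
  open Cuts D using (OddDijoin)
  ih : ∀ {D₁} → order D₁ < order D → (∀ {D′} → CutMinor D₁ D′ → CutMinor D D′) → ∃ (Cuts.OddDijoin D₁)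
  ih {D₁} smaller lift = excluded⇒dijoin k D₁ (ℕₚ.<-≤-trans smaller le) (excluded-minor lift excluded)
  isolated : ¬ ∃ OddDijoin → Touched D
  isolated n v with Finₚ.any? (λ e → (tail D e ≟ v) ⊎-dec (head D e ≟ v))
  ... | yes p = p
  ... | no m with delete-vertex D v (λ f → (λ p → m (f , inj₁ p)) , (λ p → m (f , inj₂ p)))
  ...   | D₁ , i , smaller = ⊥-elim (n (unisolated-dijoin i (ih smaller (deleteIsolated i))))
  critical : EdgeCritical D
  critical e with contract-edge D e
  ... | D₁ , c , refl , smaller = uncontract-dijoin c (ih smaller (contract c))
  not-deletable : ¬ ∃ OddDijoin → ∀ e → ¬ Deletable D e
  not-deletable n e del with delete-edge D e del
  ... | D₁ , d , smaller = n (undelete-dijoin d (ih smaller (delete d)))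
  impossible : (n : ¬ ∃ OddDijoin) → Touched D → ⊥
  impossible n touched = Final.impossible D n critical touched no-parallel no-shortcut
    (λ p → proj₁ excluded (D , done , p)) (λ p → proj₂ excluded (D , done , p))
    where
    open Critical D n critical touched using (no-loop)
    no-parallel : ∀ e f → tail D e ≡ tail D f → head D e ≡ head D f → e ≡ f
    no-parallel e f p q with e ≟ f
    ... | yes r = r
    ... | no r  = ⊥-elim (not-deletable n e (no-loop e ,
      subst₂ (WalkAvoiding D e) (sym p) (sym q) (there f (r ∘ sym) here)))
    no-shortcut : ∀ e f g → tail D e ≡ tail D f → head D f ≡ tail D g → head D g ≡ head D e → ⊥
    no-shortcut e f g p q r = not-deletable n e (no-loop e ,
      subst₂ (WalkAvoiding D e) (sym p) r (there f f≢e (subst (λ x → WalkAvoiding D e x (head D g)) (sym q) (there g g≢e here))))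
      where
      f≢e : f ≢ e
      f≢e refl = no-loop g (trans (sym q) (sym r))
      g≢e : g ≢ e
      g≢e refl = no-loop f (trans (sym p) (sym q))

theorem4p17 : (D : Digraph) →
    HasOddDijoin D ⇔ (¬ HasOddDiamondCutMinor D × ¬ HasOddOneDirectionCutMinor D)
theorem4p17 D = mk⇔
  (λ o → (λ { (D′ , m , p) → odd-diamond D′ p (minor-dijoin m (Cuts.HasOddDijoin⇒∃ D o)) }) ,
         (λ { (D′ , m , p) → odd-one-direction D′ p (minor-dijoin m (Cuts.HasOddDijoin⇒∃ D o)) }))
  (λ excluded → Cuts.∃⇒HasOddDijoin D (excluded⇒dijoin (suc (order D)) D ℕₚ.≤-refl excluded))
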